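{- Let $q=2^h$ with $h>1$ and let $n$ be a prime. Let $\mathcal{H}$ be a pseudo-hyperoval in $\mathrm{PG}(3n-1,q)$ such that the spread induced by at least $q^n+1$ elements of $\mathcal{H}$ is Desarguesian (i.e. there are at least $q^n+1$ elements of $\mathcal{H}$ each of which induces a Desarguesian spread). Then $\mathcal{H}$ is elementary.
   Context: Dimensions are projective: an $(n-1)$-space of $\mathrm{PG}(m,q)$ comes from an $n$-dimensional $\mathbb{F}_q$-vector subspace. A pseudo-arc in $\mathrm{PG}(3n-1,q)$ is a set of $(n-1)$-spaces any three distinct elements $E_i,E_j,E_k$ of which satisfy $\langle E_i,E_j\rangle\cap E_k=\emptyset$ (equivalently, any three span the whole space). A pseudo-hyperoval is a pseudo-arc of size $q^n+2$. An $(n-1)$-spread of $\mathrm{PG}(2n-1,q)$ is a set of $(n-1)$-spaces partitioning the point set. An element $E_i$ of a pseudo-hyperoval $\mathcal{H}$ induces the spread $\{\langle E_i,E_j\rangle/E_i : E_j\in\mathcal{H},\ j\ne i\}$ (which has $q^n+1$ elements) of the quotient space $\mathrm{PG}(3n-1,q)/E_i\cong\mathrm{PG}(2n-1,q)$. Field reduction: given an $\mathbb{F}_q$-linear isomorphism $\mathbb{F}_{q^n}^r\cong\mathbb{F}_q^{rn}$, a point of $\mathrm{PG}(r-1,q^n)$, being a 1-dimensional $\mathbb{F}_{q^n}$-subspace, corresponds to an $n$-dimensional $\mathbb{F}_q$-subspace, i.e. an $(n-1)$-space of $\mathrm{PG}(rn-1,q)$. A Desarguesian $(n-1)$-spread of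 $\mathrm{PG}(rn-1,q)$ is the set of $(n-1)$-spaces arising in this way (for some such isomorphism) from all points of $\mathrm{PG}(r-1,q^n)$. A pseudo-arc in $\mathrm{PG}(3n-1,q)$ is elementary if it is obtained by field reduction from an arc (a set of points, no three collinear) of $\mathrm{PG}(2,q^n)$. -}

module Defs where

open import Algebra.Bundles using (CommutativeMonoid; CommutativeRing; Ring)
open import Algebra.Module.Bundles using (LeftModule)
open import Algebra.Module.Morphism.Structures using (module LeftModuleMorphisms)
open import Algebra.Morphism.Bundles using (RingHomomorphism)
open import Data.Fin.Base using (Fin)
open import Data.Fin.Subset using (Subset; _∈_; ∣_∣)
open import Data.Nat.Base as ℕ using (ℕ)
open import Data.Product.Base using (Σ; ∃; _×_; _,_; proj₁; proj₂)
open import Data.Vec.Functional using (Vector)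
open import Function.Bundles using (Inverse)
open import Level using (Level; _⊔_; suc)
open import Relation.Binary.PropositionalEquality as ≡ using (_≡_; _≢_)
open import Relation.Nullary.Negation using (¬_)
open import Relation.Unary using (Pred; _⊆_; _≐_)

import Algebra.Module.Properties.LeftModule as LeftModuleProperties
import Algebra.Properties.AbelianGroup as AbelianGroupProperties
import Algebra.Properties.CommutativeMonoid.Sum as Sum
import Algebra.Properties.CommutativeSemigroup as CommutativeSemigroupProperties
import Relation.Binary.Reasoning.Setoid as ≈-Reasoning

private
  variable
    r ℓr s ℓs v ℓv w ℓw p p′ p″ i j c ℓ c′ ℓ′ : Level

record FiniteField (q : ℕ) (c ℓ : Level) : Set (suc (c ⊔ ℓ)) where
  field
    commutativeRing : CommutativeRing c ℓ
  open CommutativeRing commutativeRing public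
  field
    0≉1         : 0# ≉ 1#
    inverse     : ∀ x → x ≉ 0# → ∃ λ y → x * y ≈ 1#
    enumeration : Inverse setoid (≡.setoid (Fin q))

-- A homomorphism of fields is injective, so this exhibits K as an extension
-- of F.
Extension : ∀ {q q′} → FiniteField q c ℓ → FiniteField q′ c′ ℓ′ →
            Set (c ⊔ ℓ ⊔ c′ ⊔ ℓ′)
Extension F K = RingHomomorphism (FiniteField.rawRing F) (FiniteField.rawRing K)

_^ᵛ_ : (R : Ring r ℓr) → ℕ → LeftModule R r ℓr
R ^ᵛ m = record
  { Carrierᴹ     = Vector Carrier m
  ; _≈ᴹ_         = λ x y → ∀ k → x k ≈ y k
  ; _+ᴹ_         = λ x y k → x k + y k
  ; _*ₗ_         = λ a x k → a * x k
  ; 0ᴹ           = λ _ → 0#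
  ; -ᴹ_          = λ x k → - x k
  ; isLeftModule = record
    { isLeftSemimodule = record
      { +ᴹ-isCommutativeMonoid = record
        { isMonoid = record
          { isSemigroup = record
            { isMagma = record
              { isEquivalence = record
                { refl  = λ _ → refl
                ; sym   = λ x≈y k → sym (x≈y k)
                ; trans = λ x≈y y≈z k → trans (x≈y k) (y≈z k)
                }
              ; ∙-cong = λ x≈y u≈v k → +-cong (x≈y k) (u≈v k)
              }
            ; assoc = λ x y z k → +-assoc (x k) (y k) (z k)
            }
          ; identity = (λ x k → +-identityˡ (x k)) , (λ x k → +-identityʳ (x k))
          }
        ; comm = λ x y k → +-comm (x k) (y k)
        }
      ; isPreleftSemimodule = record
        { *ₗ-cong      = λ a≈b x≈y k → *-cong a≈b (x≈y k)
        ; *ₗ-zeroˡ     = λ x k → zeroˡ (x k)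
        ; *ₗ-distribʳ  = λ x a b k → distribʳ (x k) a b
        ; *ₗ-identityˡ = λ x k → *-identityˡ (x k)
        ; *ₗ-assoc     = λ a b x k → *-assoc a b (x k)
        ; *ₗ-zeroʳ     = λ a k → zeroʳ a
        ; *ₗ-distribˡ  = λ a x y k → distribˡ a (x k) (y k)
        }
      }
    ; -ᴹ‿cong    = λ x≈y k → -‿cong (x≈y k)
    ; -ᴹ‿inverse = (λ x k → -‿inverseˡ (x k)) , (λ x k → -‿inverseʳ (x k))
    }
  }
  where open Ring R

record Subspace {R : Ring r ℓr} (V : LeftModule R v ℓv) (p : Level) :
                Set (r ⊔ v ⊔ ℓv ⊔ suc p) where
  open LeftModule V
  field
    member    : Pred Carrierᴹ p
    resp      : ∀ {x y} → x ≈ᴹ y → member x → member y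
    0ᴹ-closed : member 0ᴹ
    +ᴹ-closed : ∀ {x y} → member x → member y → member (x +ᴹ y)
    *ₗ-closed : ∀ a {x} → member x → member (a *ₗ x)

open Subspace using (member)

-- Dimensions are vector space dimensions: an (n-1)-space of PG(V) is a
-- subspace W of V with HasDimension W n.
record HasDimension {R : Ring r ℓr} {V : LeftModule R v ℓv}
                    (W : Subspace V p) (n : ℕ) : Set (r ⊔ ℓr ⊔ v ⊔ ℓv ⊔ p) where
  open Ring R using (Carrier; _≈_; 0#)
  open LeftModule V
  open Sum +ᴹ-commutativeMonoid using (sum)
  field
    basis       : Vector Carrierᴹ n
    contained   : ∀ k → member W (basis k)
    independent : ∀ (a : Vector Carrier n) →
                  sum (λ k → a k *ₗ basis k) ≈ᴹ 0ᴹ → ∀ k → a k ≈ 0#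
    spanning    : ∀ {x} → member W x →
                  ∃ λ (a : Vector Carrier n) → x ≈ᴹ sum (λ k → a k *ₗ basis k)

-- Two families enumerate the same set of subspaces.
_≋_ : {R : Ring r ℓr} {V : LeftModule R v ℓv} {I : Set i} {J : Set j} →
      (I → Subspace V p) → (J → Subspace V p′) → Set (i ⊔ j ⊔ v ⊔ p ⊔ p′)
S ≋ T = (∀ k → ∃ λ l → member (S k) ≐ member (T l)) ×
        (∀ l → ∃ λ k → member (S k) ≐ member (T l))

module _ {R : Ring r ℓr} {V : LeftModule R v ℓv} where
  open LeftModule V
  open CommutativeSemigroupProperties
    (CommutativeMonoid.commutativeSemigroup +ᴹ-commutativeMonoid)
    using (interchange)

  ⟨_,_⟩ : Subspace V p → Subspace V p′ → Subspace V (v ⊔ ℓv ⊔ p ⊔ p′)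
  ⟨ A , B ⟩ = record
    { member    = λ x → ∃ λ a → ∃ λ b → member A a × member B b × x ≈ᴹ a +ᴹ b
    ; resp      = λ x≈y (a , b , a∈A , b∈B , x≈) →
                  a , b , a∈A , b∈B , ≈ᴹ-trans (≈ᴹ-sym x≈y) x≈
    ; 0ᴹ-closed = 0ᴹ , 0ᴹ , A.0ᴹ-closed , B.0ᴹ-closed , ≈ᴹ-sym (+ᴹ-identityˡ 0ᴹ)
    ; +ᴹ-closed = λ (a , b , a∈A , b∈B , x≈) (a′ , b′ , a′∈A , b′∈B , y≈) →
                  a +ᴹ a′ , b +ᴹ b′ , A.+ᴹ-closed a∈A a′∈A , B.+ᴹ-closed b∈B b′∈B ,
                  ≈ᴹ-trans (+ᴹ-cong x≈ y≈) (interchange a b a′ b′)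
    ; *ₗ-closed = λ t (a , b , a∈A , b∈B , x≈) →
                  t *ₗ a , t *ₗ b , A.*ₗ-closed t a∈A , B.*ₗ-closed t b∈B ,
                  ≈ᴹ-trans (*ₗ-congˡ x≈) (*ₗ-distribˡ t a b)
    }
    where
    module A = Subspace A
    module B = Subspace B

  -- Empty intersection in the projective space: only the zero vector is shared.
  Disjoint : Subspace V p → Subspace V p′ → Set (v ⊔ ℓv ⊔ p ⊔ p′)
  Disjoint A B = ∀ {x} → member A x → member B x → x ≈ᴹ 0ᴹ

-- The quotient has the same vectors, identified when they differ by an
-- element of W.
_/_ : {R : Ring r ℓr} (V : LeftModule R v ℓv) → Subspace V p → LeftModule R v p
_/_ {R = R} V W = record
  { Carrierᴹ     = Carrierᴹ
  ; _≈ᴹ_         = λ x y → W.member (x +ᴹ -ᴹ y)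
  ; _+ᴹ_         = _+ᴹ_
  ; _*ₗ_         = _*ₗ_
  ; 0ᴹ           = 0ᴹ
  ; -ᴹ_          = -ᴹ_
  ; isLeftModule = record
    { isLeftSemimodule = record
      { +ᴹ-isCommutativeMonoid = record
        { isMonoid = record
          { isSemigroup = record
            { isMagma = record
              { isEquivalence = record
                { refl  = lift ≈ᴹ-refl
                ; sym   = λ {x} {y} x∼y → W.resp (⁻¹-anti-homo-// x y) (neg x∼y)
                ; trans = λ {x} {y} {z} x∼y y∼z →
                          W.resp (telescope x y z) (W.+ᴹ-closed x∼y y∼z)
                }
              ; ∙-cong = λ {x} {y} {u} {t} x∼y u∼t →
                         W.resp (difference-+ x y u t) (W.+ᴹ-closed x∼y u∼t)
              }
            ; assoc = λ x y z → lift (+ᴹ-assoc x y z)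
            }
          ; identity = (λ x → lift (+ᴹ-identityˡ x)) , (λ x → lift (+ᴹ-identityʳ x))
          }
        ; comm = λ x y → lift (+ᴹ-comm x y)
        }
      ; isPreleftSemimodule = record
        { *ₗ-cong      = λ {a} {b} {x} {y} a≈b x∼y →
                         W.resp (difference-* a b x y a≈b) (W.*ₗ-closed a x∼y)
        ; *ₗ-zeroˡ     = λ x → lift (*ₗ-zeroˡ x)
        ; *ₗ-distribʳ  = λ x a b → lift (*ₗ-distribʳ x a b)
        ; *ₗ-identityˡ = λ x → lift (*ₗ-identityˡ x)
        ; *ₗ-assoc     = λ a b x → lift (*ₗ-assoc a b x)
        ; *ₗ-zeroʳ     = λ a → lift (*ₗ-zeroʳ a)
        ; *ₗ-distribˡ  = λ a x y → lift (*ₗ-distribˡ a x y)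
        }
      }
    ; -ᴹ‿cong    = λ {x} {y} x∼y →
                   W.resp (≈ᴹ-sym (⁻¹-∙-comm x (-ᴹ y))) (neg x∼y)
    ; -ᴹ‿inverse = (λ x → lift (-ᴹ‿inverseˡ x)) , (λ x → lift (-ᴹ‿inverseʳ x))
    }
  }
  where
  open Ring R using (_≈_; 1#; -_; _+_; -‿inverseʳ)
  open LeftModule V
  open LeftModuleProperties V using (inverseʳ-uniqueᴹ)
  open AbelianGroupProperties +ᴹ-abelianGroup
    using (⁻¹-∙-comm; ⁻¹-anti-homo-//)
  open CommutativeSemigroupProperties
    (CommutativeMonoid.commutativeSemigroup +ᴹ-commutativeMonoid)
    using (interchange)
  open ≈-Reasoning ≈ᴹ-setoid
  module W = Subspace W

  lift : ∀ {x y} → x ≈ᴹ y → W.member (x +ᴹ -ᴹ y)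
  lift {x} {y} x≈y =
    W.resp (≈ᴹ-trans (≈ᴹ-sym (-ᴹ‿inverseʳ y)) (+ᴹ-congʳ (≈ᴹ-sym x≈y))) W.0ᴹ-closed

  x+-1x≈0 : ∀ x → x +ᴹ (- 1#) *ₗ x ≈ᴹ 0ᴹ
  x+-1x≈0 x = begin
    x +ᴹ (- 1#) *ₗ x         ≈⟨ +ᴹ-congʳ (*ₗ-identityˡ x) ⟨
    1# *ₗ x +ᴹ (- 1#) *ₗ x   ≈⟨ *ₗ-distribʳ x 1# (- 1#) ⟨
    (1# + - 1#) *ₗ x         ≈⟨ *ₗ-congʳ (-‿inverseʳ 1#) ⟩
    Ring.0# R *ₗ x           ≈⟨ *ₗ-zeroˡ x ⟩
    0ᴹ                       ∎

  neg : ∀ {x} → W.member x → W.member (-ᴹ x)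
  neg {x} x∈W = W.resp (inverseʳ-uniqueᴹ x _ (x+-1x≈0 x)) (W.*ₗ-closed (- 1#) x∈W)

  telescope : ∀ x y z → (x +ᴹ -ᴹ y) +ᴹ (y +ᴹ -ᴹ z) ≈ᴹ x +ᴹ -ᴹ z
  telescope x y z = begin
    (x +ᴹ -ᴹ y) +ᴹ (y +ᴹ -ᴹ z)   ≈⟨ +ᴹ-assoc x (-ᴹ y) (y +ᴹ -ᴹ z) ⟩
    x +ᴹ (-ᴹ y +ᴹ (y +ᴹ -ᴹ z))   ≈⟨ +ᴹ-congˡ (+ᴹ-assoc (-ᴹ y) y (-ᴹ z)) ⟨
    x +ᴹ ((-ᴹ y +ᴹ y) +ᴹ -ᴹ z)   ≈⟨ +ᴹ-congˡ (+ᴹ-congʳ (-ᴹ‿inverseˡ y)) ⟩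
    x +ᴹ (0ᴹ +ᴹ -ᴹ z)            ≈⟨ +ᴹ-congˡ (+ᴹ-identityˡ (-ᴹ z)) ⟩
    x +ᴹ -ᴹ z                    ∎

  difference-+ : ∀ x y u t →
                 (x +ᴹ -ᴹ y) +ᴹ (u +ᴹ -ᴹ t) ≈ᴹ (x +ᴹ u) +ᴹ -ᴹ (y +ᴹ t)
  difference-+ x y u t =
    ≈ᴹ-trans (interchange x (-ᴹ y) u (-ᴹ t)) (+ᴹ-congˡ (⁻¹-∙-comm y t))

  *ₗ-neg : ∀ a y → a *ₗ (-ᴹ y) ≈ᴹ -ᴹ (a *ₗ y)
  *ₗ-neg a y = inverseʳ-uniqueᴹ (a *ₗ y) (a *ₗ (-ᴹ y)) (begin
    a *ₗ y +ᴹ a *ₗ (-ᴹ y)   ≈⟨ *ₗ-distribˡ a y (-ᴹ y) ⟨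
    a *ₗ (y +ᴹ -ᴹ y)        ≈⟨ *ₗ-congˡ (-ᴹ‿inverseʳ y) ⟩
    a *ₗ 0ᴹ                 ≈⟨ *ₗ-zeroʳ a ⟩
    0ᴹ                      ∎)

  difference-* : ∀ a b x y → a ≈ b → a *ₗ (x +ᴹ -ᴹ y) ≈ᴹ a *ₗ x +ᴹ -ᴹ (b *ₗ y)
  difference-* a b x y a≈b = begin
    a *ₗ (x +ᴹ -ᴹ y)         ≈⟨ *ₗ-distribˡ a x (-ᴹ y) ⟩
    a *ₗ x +ᴹ a *ₗ (-ᴹ y)    ≈⟨ +ᴹ-congˡ (*ₗ-neg a y) ⟩
    a *ₗ x +ᴹ -ᴹ (a *ₗ y)    ≈⟨ +ᴹ-congˡ (-ᴹ‿cong (*ₗ-congʳ a≈b)) ⟩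
    a *ₗ x +ᴹ -ᴹ (b *ₗ y)    ∎

-- (A + W)/W, for an arbitrary subspace A of V.
_/ₛ_ : {R : Ring r ℓr} {V : LeftModule R v ℓv} →
       Subspace V p → (W : Subspace V p′) → Subspace (V / W) (v ⊔ p ⊔ p′)
_/ₛ_ {V = V} A W = record
  { member    = λ x → ∃ λ a → member A a × x ∼ a
  ; resp      = λ x∼y (a , a∈A , x∼a) → a , a∈A , Q.≈ᴹ-trans (Q.≈ᴹ-sym x∼y) x∼a
  ; 0ᴹ-closed = Q.0ᴹ , A.0ᴹ-closed , Q.≈ᴹ-refl
  ; +ᴹ-closed = λ (a , a∈A , x∼a) (b , b∈A , y∼b) →
                a Q.+ᴹ b , A.+ᴹ-closed a∈A b∈A , Q.+ᴹ-cong x∼a y∼b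
  ; *ₗ-closed = λ t (a , a∈A , x∼a) → t Q.*ₗ a , A.*ₗ-closed t a∈A , Q.*ₗ-congˡ x∼a
  }
  where
  module A = Subspace A
  module Q = LeftModule (V / W)
  open Q using () renaming (_≈ᴹ_ to _∼_)

restrictScalars : {R : Ring r ℓr} {S : Ring s ℓs} →
                  RingHomomorphism (Ring.rawRing R) (Ring.rawRing S) →
                  LeftModule S v ℓv → LeftModule R v ℓv
restrictScalars ι V = record
  { Carrierᴹ     = Carrierᴹ
  ; _≈ᴹ_         = _≈ᴹ_
  ; _+ᴹ_         = _+ᴹ_
  ; _*ₗ_         = λ a x → ⟦ a ⟧ *ₗ x
  ; 0ᴹ           = 0ᴹ
  ; -ᴹ_          = -ᴹ_
  ; isLeftModule = record
    { isLeftSemimodule = record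
      { +ᴹ-isCommutativeMonoid = +ᴹ-isCommutativeMonoid
      ; isPreleftSemimodule = record
        { *ₗ-cong      = λ a≈b x≈y → *ₗ-cong (⟦⟧-cong a≈b) x≈y
        ; *ₗ-zeroˡ     = λ x → ≈ᴹ-trans (*ₗ-congʳ 0#-homo) (*ₗ-zeroˡ x)
        ; *ₗ-distribʳ  = λ x a b →
                         ≈ᴹ-trans (*ₗ-congʳ (+-homo a b)) (*ₗ-distribʳ x ⟦ a ⟧ ⟦ b ⟧)
        ; *ₗ-identityˡ = λ x → ≈ᴹ-trans (*ₗ-congʳ 1#-homo) (*ₗ-identityˡ x)
        ; *ₗ-assoc     = λ a b x →
                         ≈ᴹ-trans (*ₗ-congʳ (*-homo a b)) (*ₗ-assoc ⟦ a ⟧ ⟦ b ⟧ x)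
        ; *ₗ-zeroʳ     = λ a → *ₗ-zeroʳ ⟦ a ⟧
        ; *ₗ-distribˡ  = λ a → *ₗ-distribˡ ⟦ a ⟧
        }
      }
    ; -ᴹ‿cong    = -ᴹ‿cong
    ; -ᴹ‿inverse = -ᴹ‿inverse
    }
  }
  where
  open LeftModule V
  open RingHomomorphism ι

record _≅_ {R : Ring r ℓr} (V : LeftModule R v ℓv) (W : LeftModule R w ℓw) :
           Set (r ⊔ v ⊔ ℓv ⊔ w ⊔ ℓw) where
  private
    module V = LeftModule V
    module W = LeftModule W
  open LeftModuleMorphisms V.rawLeftModule W.rawLeftModule
  field
    to            : V.Carrierᴹ → W.Carrierᴹ
    isIsomorphism : IsLeftModuleIsomorphism to
  open IsLeftModuleIsomorphism isIsomorphism public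

module _ {R : Ring r ℓr} {S : Ring s ℓs}
         (ι : RingHomomorphism (Ring.rawRing R) (Ring.rawRing S))
         {U : LeftModule S w ℓw} {V : LeftModule R v ℓv} where

  -- The image under φ of an S-subspace of U, regarded as an R-subspace of V.
  fieldReduction : restrictScalars ι U ≅ V → Subspace U p → Subspace V (w ⊔ ℓv ⊔ p)
  fieldReduction φ P = record
    { member    = λ y → ∃ λ x → member P x × y ≈ᴹ to x
    ; resp      = λ y≈z (x , x∈P , y≈) → x , x∈P , ≈ᴹ-trans (≈ᴹ-sym y≈z) y≈
    ; 0ᴹ-closed = U.0ᴹ , P.0ᴹ-closed , ≈ᴹ-sym 0ᴹ-homo
    ; +ᴹ-closed = λ (x , x∈P , y≈) (x′ , x′∈P , z≈) →
                  x U.+ᴹ x′ , P.+ᴹ-closed x∈P x′∈P ,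
                  ≈ᴹ-trans (+ᴹ-cong y≈ z≈) (≈ᴹ-sym (+ᴹ-homo x x′))
    ; *ₗ-closed = λ a (x , x∈P , y≈) →
                  ⟦ a ⟧ U.*ₗ x , P.*ₗ-closed ⟦ a ⟧ x∈P ,
                  ≈ᴹ-trans (*ₗ-congˡ y≈) (≈ᴹ-sym (*ₗ-homo a x))
    }
    where
    module U = LeftModule U
    module P = Subspace P
    open LeftModule V
    open RingHomomorphism ι using (⟦_⟧)
    open _≅_ φ using (to; 0ᴹ-homo; +ᴹ-homo; *ₗ-homo)

record Point {R : Ring r ℓr} (V : LeftModule R v ℓv) (p : Level) :
             Set (r ⊔ ℓr ⊔ v ⊔ ℓv ⊔ suc p) where
  field
    subspace     : Subspace V p
    hasDimension : HasDimension subspace 1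

open Point using (subspace)

module _ {R : Ring r ℓr} {V : LeftModule R v ℓv} where

  Collinear : Point V p → Point V p → Point V p → Set (r ⊔ ℓr ⊔ v ⊔ ℓv ⊔ suc p)
  Collinear {p = p} P Q S =
    ∃ λ (L : Subspace V p) → HasDimension L 2 ×
      member (subspace P) ⊆ member L ×
      member (subspace Q) ⊆ member L ×
      member (subspace S) ⊆ member L

  -- Arcs and pseudo-arcs, being sets, are given as families without
  -- repetition.
  record IsArc {I : Set i} (A : I → Point V p) :
               Set (i ⊔ r ⊔ ℓr ⊔ v ⊔ ℓv ⊔ suc p) where
    field
      distinct    : ∀ {k l} → k ≢ l → ¬ member (subspace (A k)) ≐ member (subspace (A l))
      noCollinear : ∀ {k l m} → k ≢ l → k ≢ m → l ≢ m → ¬ Collinear (A k) (A l) (A m)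

  record IsPseudoArc (n : ℕ) {I : Set i} (H : I → Subspace V p) :
                     Set (i ⊔ r ⊔ ℓr ⊔ v ⊔ ℓv ⊔ p) where
    field
      dimension : ∀ k → HasDimension (H k) n
      distinct  : ∀ {k l} → k ≢ l → ¬ member (H k) ≐ member (H l)
      disjoint  : ∀ {k l m} → k ≢ l → k ≢ m → l ≢ m → Disjoint ⟨ H k , H l ⟩ (H m)

  inducedSpread : {I : Set i} (H : I → Subspace V p) (k : I) →
                  (∃ λ l → l ≢ k) → Subspace (V / H k) (v ⊔ ℓv ⊔ p)
  inducedSpread H k (l , _) = ⟨ H k , H l ⟩ /ₛ H k

record PseudoHyperoval {q : ℕ} (F : FiniteField q c ℓ) (n : ℕ) (p : Level) :
                       Set (c ⊔ ℓ ⊔ suc p) where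
  field
    element     : Fin (q ℕ.^ n ℕ.+ 2) → Subspace (FiniteField.ring F ^ᵛ (3 ℕ.* n)) p
    isPseudoArc : IsPseudoArc n element

AtLeast : ∀ {N} → ℕ → (Fin N → Set p) → Set p
AtLeast {N = N} m P = ∃ λ (T : Subset N) → m ℕ.≤ ∣ T ∣ × (∀ {k} → k ∈ T → P k)

module _ {q n : ℕ} {F : FiniteField q c ℓ} (K : FiniteField (q ℕ.^ n) c′ ℓ′)
         (ι : Extension F K) where
  private
    module F = FiniteField F
    module K = FiniteField K

  -- V is any F-vector space rather than F ^ᵛ (r * n), so that it may be a
  -- quotient; the isomorphism with K ^ᵛ r forces its dimension to be r * n.
  IsDesarguesian : ℕ → {V : LeftModule F.ring v ℓv} {I : Set i} →
                   (I → Subspace V p) → Set (c ⊔ v ⊔ ℓv ⊔ i ⊔ p ⊔ suc (c′ ⊔ ℓ′))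
  IsDesarguesian r {V} S =
    Σ (restrictScalars ι (K.ring ^ᵛ r) ≅ V) λ φ →
      S ≋ λ (P : Point (K.ring ^ᵛ r) (c′ ⊔ ℓ′)) → fieldReduction ι φ (subspace P)

  InducesDesarguesianSpread : (H : PseudoHyperoval F n p) → Fin (q ℕ.^ n ℕ.+ 2) →
                              Set (c ⊔ ℓ ⊔ p ⊔ suc (c′ ⊔ ℓ′))
  InducesDesarguesianSpread H k =
    IsDesarguesian 2 (inducedSpread (PseudoHyperoval.element H) k)

  IsElementary : PseudoHyperoval F n p → Set (c ⊔ ℓ ⊔ p ⊔ suc (c′ ⊔ ℓ′))
  IsElementary H =
    Σ (restrictScalars ι (K.ring ^ᵛ 3) ≅ (F.ring ^ᵛ (3 ℕ.* n))) λ φ →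
    Σ ℕ λ m →
    Σ (Fin m → Point (K.ring ^ᵛ 3) (c′ ⊔ ℓ′)) λ A →
      IsArc A × PseudoHyperoval.element H ≋ λ k → fieldReduction ι φ (subspace (A k))

{-# OPTIONS --safe #-}
-- Choose H a, H b, H c inducing Desarguesian spreads and coordinates over K with
-- H a = K × 0 × 0, H b = 0 × K × 0, H c = 0 × 0 × K, in which the other elements
-- are the graphs {(x , κ x , B κ x)}, κ ∈ K.  The spread induced by H b says that
-- the maps B κ form a field: g (B κ x) = σ κ · g x for an F-linear bijection g.
-- The k for which g ∘ (k *_) ∘ g⁻¹ is again a multiplication form a field between
-- F and K, so it is F or K because n is prime.  If it is K, then every B κ is a
-- multiplication by some μ, and the points (1 , κ , μ), (0 , 1 , 0), (0 , 0 , 1)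
-- form the required arc.
-- If it is F, then the spreads induced by the other elements imply that σ maps
-- affine F-lines of K to F-lines, so σ is additive on independent pairs since
-- q > 2; the same holds after exchanging the roles of a and b, i.e. for
-- κ ↦ B κ⁻¹ ∘ (κ *_).  Additivity of both at 1/A - 1/(A + 1) = 1/(A² + A) gives
-- B (A²) = - A for A ∉ F, so that A lies in the intermediate field after all.
module Submission where

open import Defs
open import Algebra.Bundles using (CommutativeMonoid; CommutativeRing)
open import Algebra.Module.Bundles using (LeftModule)
open import Algebra.Morphism.Bundles using (RingHomomorphism)
open import Algebra.Solver.Ring.AlmostCommutativeRing
  using (fromCommutativeRing; _-Raw-AlmostCommutative⟶_)
open import Data.Empty using (⊥)
open import Data.Fin.Base using (Fin; zero; suc; combine; remQuot; punchIn; punchOut)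
open import Data.Fin.Patterns using (0F; 1F; 2F)
open import Data.Fin.Properties as Fin
  using (any?; all?; injective⇒≤; combine-remQuot; remQuot-combine)
open import Data.Fin.Subset as Subset using (Subset; _∈_; ∣_∣)
open import Data.Fin.Subset.Properties using (∣p∣≡n⇒p≡⊤; ∣p∣≤n; ∈⊤)
open import Data.Integer.Base as ℤ using (ℤ; +_; -[1+_])
open import Data.Maybe.Base using (just; nothing)
open import Data.Nat.Base as ℕ using (ℕ; zero; suc; _≤_; z≤n; s≤s)
open import Data.Nat.Divisibility using (divides)
open import Data.Nat.Primality using (Prime; prime⇒irreducible; prime⇒nonTrivial)
open import Data.Product.Base using (Σ; ∃; _×_; _,_; proj₁; proj₂; uncurry)
open import Data.Sum.Base using (_⊎_; inj₁; inj₂)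
open import Data.Unit.Polymorphic.Base using (⊤; tt)
open import Data.Vec.Base using ([]; _∷_; here; there)
open import Function.Base using (_∘_)
open import Function.Bundles using (Inverse)
open import Level using (Level; _⊔_; 0ℓ)
open import Relation.Binary.Definitions using (WeaklyDecidable; tri<; tri≈; tri>)
open import Relation.Binary.PropositionalEquality as ≡ using (_≡_; _≢_)
open import Relation.Nullary.Decidable using (Dec; yes; no; map′; ¬?; decidable-stable; _×-dec_)
open import Relation.Nullary.Negation using (¬_; contradiction)
open import Relation.Unary using (Pred; _⊆_; _≐_)

import Algebra.Module.Properties.LeftModule as LeftModuleProperties
import Algebra.Properties.AbelianGroup as AbelianGroupProperties
import Algebra.Properties.CommutativeSemigroup as CommutativeSemigroupProperties
import Algebra.Solver.Ring as RingSolver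
import Data.Integer.Properties as ℤ
import Data.Nat.Properties as ℕ
import Relation.Binary.Reasoning.Setoid as ≈-Reasoning

-- The hypothesis leaves at most one element `H d` whose spread is uncontrolled. It is made the
-- graph of slope 1, where `B` is the identity.
--
-- Each spread brings its own identification of a quotient with K², and a priori these
-- identifications share only F-linearity. The K-structure of `H b` (coordinate g) and that of the
-- graph of slope a (coordinate h) are compared by G = g ∘ h⁻¹. For two slopes on an F-line through
-- a this gives an equation G (k x) = k′ G x. Either k lies in F, so that σ respects the line, or
-- the stabiliser of G exceeds F, hence is K, and then K stabilises g too.
--
-- Additivity of σ by itself relates no slope to a product of slopes. The exchange supplies
-- additivity in terms of inverse slopes as well, and, as in Hua's identity, additivity on both
-- sides of an inversion determines products: here it evaluates B at the square A².

private
  variable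
    c c″ ℓ c′ ℓ′ p v ℓv : Level

-- Polynomial identities in commutative rings, with integer coefficients.

module IntegerSolver (R : CommutativeRing c ℓ) where
  open CommutativeRing R
  open import Algebra.Properties.Ring ring
    using (-0#≈0#; -‿involutive; -‿+-comm; -‿distribˡ-*; -‿distribʳ-*)
  open import Algebra.Properties.CommutativeSemigroup +-commutativeSemigroup
    using (interchange)
  open import Algebra.Properties.Semiring.Mult.TCOptimised semiring
    using (×-homo-+; ×1-homo-*; 1+×) renaming (_×_ to _⋆_)
  open ≈-Reasoning setoid

  fromℤ : ℤ → Carrier
  fromℤ (+ n)    = n ⋆ 1#
  fromℤ -[1+ n ] = - (suc n ⋆ 1#)

  fromℤ-neg : ∀ i → fromℤ (ℤ.- i) ≈ - fromℤ i
  fromℤ-neg (+ zero)  = sym -0#≈0#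
  fromℤ-neg (+ suc n) = refl
  fromℤ-neg -[1+ n ]  = sym (-‿involutive _)

  fromℤ-⊖ : ∀ m n → fromℤ (m ℤ.⊖ n) ≈ m ⋆ 1# + - (n ⋆ 1#)
  fromℤ-⊖ zero    zero    = sym (-‿inverseʳ 0#)
  fromℤ-⊖ zero    (suc n) = sym (+-identityˡ _)
  fromℤ-⊖ (suc m) zero    = sym (trans (+-congˡ -0#≈0#) (+-identityʳ _))
  fromℤ-⊖ (suc m) (suc n) = begin
    fromℤ (suc m ℤ.⊖ suc n)                   ≡⟨ ≡.cong fromℤ (ℤ.[1+m]⊖[1+n]≡m⊖n m n) ⟩
    fromℤ (m ℤ.⊖ n)                           ≈⟨ fromℤ-⊖ m n ⟩
    m ⋆ 1# + - (n ⋆ 1#)                       ≈⟨ +-identityˡ _ ⟨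
    0# + (m ⋆ 1# + - (n ⋆ 1#))                ≈⟨ +-congʳ (-‿inverseʳ 1#) ⟨
    (1# + - 1#) + (m ⋆ 1# + - (n ⋆ 1#))       ≈⟨ interchange 1# (- 1#) _ _ ⟩
    (1# + m ⋆ 1#) + (- 1# + - (n ⋆ 1#))       ≈⟨ +-congˡ (-‿+-comm 1# _) ⟩
    (1# + m ⋆ 1#) + - (1# + n ⋆ 1#)           ≈⟨ +-cong (1+× m 1#) (-‿cong (1+× n 1#)) ⟨
    suc m ⋆ 1# + - (suc n ⋆ 1#)               ∎

  fromℤ-+ : ∀ i j → fromℤ (i ℤ.+ j) ≈ fromℤ i + fromℤ j
  fromℤ-+ (+ m)    (+ n)    = ×-homo-+ 1# m n
  fromℤ-+ (+ m)    -[1+ n ] = fromℤ-⊖ m (suc n)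
  fromℤ-+ -[1+ m ] (+ n)    = trans (fromℤ-⊖ n (suc m)) (+-comm _ _)
  fromℤ-+ -[1+ m ] -[1+ n ] = begin
    - (suc (suc (m ℕ.+ n)) ⋆ 1#)              ≡⟨ ≡.cong (λ k → - (suc k ⋆ 1#)) (ℕ.+-suc m n) ⟨
    - ((suc m ℕ.+ suc n) ⋆ 1#)                ≈⟨ -‿cong (×-homo-+ 1# (suc m) (suc n)) ⟩
    - (suc m ⋆ 1# + suc n ⋆ 1#)               ≈⟨ -‿+-comm _ _ ⟨
    - (suc m ⋆ 1#) + - (suc n ⋆ 1#)           ∎

  fromℤ-*-pos : ∀ m j → fromℤ (+ m ℤ.* j) ≈ (m ⋆ 1#) * fromℤ j
  fromℤ-*-pos m (+ n) = begin
    fromℤ (+ m ℤ.* + n)     ≡⟨ ≡.cong fromℤ (ℤ.pos-* m n) ⟨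
    (m ℕ.* n) ⋆ 1#          ≈⟨ ×1-homo-* m n ⟩
    (m ⋆ 1#) * (n ⋆ 1#)     ∎
  fromℤ-*-pos m -[1+ n ] = begin
    fromℤ (+ m ℤ.* -[1+ n ])       ≡⟨ ≡.cong fromℤ (ℤ.neg-distribʳ-* (+ m) (+ suc n)) ⟨
    fromℤ (ℤ.- (+ m ℤ.* + suc n))  ≈⟨ fromℤ-neg (+ m ℤ.* + suc n) ⟩
    - fromℤ (+ m ℤ.* + suc n)      ≈⟨ -‿cong (fromℤ-*-pos m (+ suc n)) ⟩
    - ((m ⋆ 1#) * (suc n ⋆ 1#))    ≈⟨ -‿distribʳ-* _ _ ⟩
    (m ⋆ 1#) * - (suc n ⋆ 1#)      ∎

  fromℤ-* : ∀ i j → fromℤ (i ℤ.* j) ≈ fromℤ i * fromℤ j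
  fromℤ-* (+ m)    j = fromℤ-*-pos m j
  fromℤ-* -[1+ m ] j = begin
    fromℤ (-[1+ m ] ℤ.* j)          ≡⟨ ≡.cong fromℤ (ℤ.neg-distribˡ-* (+ suc m) j) ⟨
    fromℤ (ℤ.- (+ suc m ℤ.* j))     ≈⟨ fromℤ-neg (+ suc m ℤ.* j) ⟩
    - fromℤ (+ suc m ℤ.* j)         ≈⟨ -‿cong (fromℤ-*-pos (suc m) j) ⟩
    - ((suc m ⋆ 1#) * fromℤ j)      ≈⟨ -‿distribˡ-* _ _ ⟩
    - (suc m ⋆ 1#) * fromℤ j        ∎

  morphism : ℤ.+-*-rawRing -Raw-AlmostCommutative⟶ fromCommutativeRing R
  morphism = record
    { ⟦_⟧    = fromℤ
    ; +-homo = fromℤ-+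
    ; *-homo = fromℤ-*
    ; -‿homo = fromℤ-neg
    ; 0-homo = refl
    ; 1-homo = refl
    }

  -- Only equality of integers is recognised, not congruence modulo the characteristic, so the
  -- solver proves identities that hold in every commutative ring.
  fromℤ-≟ : WeaklyDecidable (λ i j → fromℤ i ≈ fromℤ j)
  fromℤ-≟ i j with i ℤ.≟ j
  ... | yes ≡.refl = just refl
  ... | no  _      = nothing

  open RingSolver ℤ.+-*-rawRing (fromCommutativeRing R) morphism fromℤ-≟ public
    using (solve; _:=_; _:+_; _:*_; _:-_; :-_; con)

-- If `y` were missed, punching it out would inject `Fin m` into a set with fewer elements.
injective⇒surjective : ∀ {m n} → n ≤ m → (f : Fin m → Fin n) →
                       (∀ {i j} → f i ≡ f j → i ≡ j) → ∀ y → ∃ λ x → f x ≡ y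
injective⇒surjective {m} {zero}  n≤m f inj ()
injective⇒surjective {m} {suc n} n≤m f inj y with any? (λ x → f x Fin.≟ y)
... | yes x∈ = x∈
... | no  ∉  = contradiction (injective⇒≤ g-injective) (ℕ.<⇒≱ n≤m)
  where
  y≢f : ∀ x → y ≢ f x
  y≢f x y≡fx = ∉ (x , ≡.sym y≡fx)
  g-injective : ∀ {i j} → punchOut (y≢f i) ≡ punchOut (y≢f j) → i ≡ j
  g-injective {i} {j} eq = inj (Fin.punchOut-injective (y≢f i) (y≢f j) eq)

-- Finite fields: decidable equality, exhaustive search and inverses.

module FiniteFieldProperties {q} (K : FiniteField q c ℓ) where
  open FiniteField K public hiding (zero)
  open IntegerSolver commutativeRing public
    using (solve; _:=_; _:+_; _:*_; _:-_; :-_; con)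
  open Inverse enumeration public
    using (to-cong) renaming (to to index; from to element)

  element-index : ∀ x → element (index x) ≈ x
  element-index x = Inverse.strictlyInverseʳ enumeration x

  index-element : ∀ i → index (element i) ≡ i
  index-element i = Inverse.strictlyInverseˡ enumeration i

  index-injective : ∀ {x y} → index x ≡ index y → x ≈ y
  index-injective {x} {y} eq =
    trans (sym (element-index x)) (trans (reflexive (≡.cong element eq)) (element-index y))

  element-injective : ∀ {i j} → element i ≈ element j → i ≡ j
  element-injective {i} {j} eq =
    ≡.trans (≡.sym (index-element i)) (≡.trans (to-cong eq) (index-element j))

  infix 4 _≟_
  _≟_ : ∀ x y → Dec (x ≈ y)
  x ≟ y = map′ index-injective to-cong (index x Fin.≟ index y)

  ∃? : {P : Pred Carrier p} → (∀ {x y} → x ≈ y → P x → P y) →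
       (∀ x → Dec (P x)) → Dec (∃ P)
  ∃? resp P? = map′ (λ (i , Pi) → element i , Pi)
                    (λ (x , Px) → index x , resp (sym (element-index x)) Px)
                    (any? (P? ∘ element))

  ∀? : {P : Pred Carrier p} → (∀ {x y} → x ≈ y → P x → P y) →
       (∀ x → Dec (P x)) → Dec (∀ x → P x)
  ∀? resp P? = map′ (λ P x → resp (element-index x) (P (index x)))
                    (λ P i → P (element i))
                    (all? (P? ∘ element))

  *-cancelˡ : ∀ {a x y} → a ≉ 0# → a * x ≈ a * y → x ≈ y
  *-cancelˡ {a} {x} {y} a≉0 ax≈ay with b , ab≈1 ← inverse a a≉0 = begin
    x             ≈⟨ *-identityˡ x ⟨
    1# * x        ≈⟨ *-congʳ ab≈1 ⟨
    (a * b) * x   ≈⟨ solve 3 (λ a b x → (a :* b) :* x := b :* (a :* x)) refl a b x ⟩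
    b * (a * x)   ≈⟨ *-congˡ ax≈ay ⟩
    b * (a * y)   ≈⟨ solve 3 (λ a b x → (a :* b) :* x := b :* (a :* x)) refl a b y ⟨
    (a * b) * y   ≈⟨ *-congʳ ab≈1 ⟩
    1# * y        ≈⟨ *-identityˡ y ⟩
    y             ∎
    where open ≈-Reasoning setoid

  1≉0 : 1# ≉ 0#
  1≉0 eq = 0≉1 (sym eq)

  x-0≈x : ∀ x → x - 0# ≈ x
  x-0≈x = solve 1 (λ x → x :- con (+ 0) := x) refl

  x*y≈0⇒y≈0 : ∀ {x y} → x ≉ 0# → x * y ≈ 0# → y ≈ 0#
  x*y≈0⇒y≈0 x≉0 xy≈0 = *-cancelˡ x≉0 (trans xy≈0 (sym (zeroʳ _)))

  x*y≉0 : ∀ {x y} → x ≉ 0# → y ≉ 0# → x * y ≉ 0#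
  x*y≉0 x≉0 y≉0 xy≈0 = y≉0 (x*y≈0⇒y≈0 x≉0 xy≈0)

  x-y≈0⇒x≈y : ∀ {x y} → x - y ≈ 0# → x ≈ y
  x-y≈0⇒x≈y {x} {y} eq = trans (solve 2 (λ x y → x := (x :- y) :+ y) refl x y)
                               (trans (+-congʳ eq) (+-identityˡ y))

  x≈y⇒x-y≈0 : ∀ {x y} → x ≈ y → x - y ≈ 0#
  x≈y⇒x-y≈0 {x} {y} eq = trans (+-congʳ eq) (-‿inverseʳ y)

  abstract
    -- The inverse of 0# is 0#.
    _⁻¹ : Carrier → Carrier
    x ⁻¹ with x ≟ 0#
    ... | yes _   = 0#
    ... | no x≉0 = proj₁ (inverse x x≉0)

    ⁻¹-inverseʳ : ∀ {x} → x ≉ 0# → x * x ⁻¹ ≈ 1#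
    ⁻¹-inverseʳ {x} x≉0 with x ≟ 0#
    ... | yes x≈0 = contradiction x≈0 x≉0
    ... | no x≉0′ = proj₂ (inverse x x≉0′)

    0⁻¹≈0 : ∀ {x} → x ≈ 0# → x ⁻¹ ≈ 0#
    0⁻¹≈0 {x} x≈0 with x ≟ 0#
    ... | yes _   = refl
    ... | no x≉0 = contradiction x≈0 x≉0

  ⁻¹-inverseˡ : ∀ {x} → x ≉ 0# → x ⁻¹ * x ≈ 1#
  ⁻¹-inverseˡ x≉0 = trans (*-comm _ _) (⁻¹-inverseʳ x≉0)

  x⁻¹*[x*y]≈y : ∀ {x} y → x ≉ 0# → x ⁻¹ * (x * y) ≈ y
  x⁻¹*[x*y]≈y y x≉0 =
    trans (sym (*-assoc _ _ y)) (trans (*-congʳ (⁻¹-inverseˡ x≉0)) (*-identityˡ y))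

  x*[x⁻¹*y]≈y : ∀ {x} y → x ≉ 0# → x * (x ⁻¹ * y) ≈ y
  x*[x⁻¹*y]≈y y x≉0 =
    trans (sym (*-assoc _ _ y)) (trans (*-congʳ (⁻¹-inverseʳ x≉0)) (*-identityˡ y))

  ⁻¹-unique : ∀ {x y} → x * y ≈ 1# → x ⁻¹ ≈ y
  ⁻¹-unique {x} {y} xy≈1 = *-cancelˡ x≉0 (trans (⁻¹-inverseʳ x≉0) (sym xy≈1))
    where
    x≉0 : x ≉ 0#
    x≉0 x≈0 = 0≉1 (trans (sym (zeroˡ y)) (trans (*-congʳ (sym x≈0)) xy≈1))

  ⁻¹-cong : ∀ {x y} → x ≈ y → x ⁻¹ ≈ y ⁻¹
  ⁻¹-cong {x} {y} x≈y with y ≟ 0#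
  ... | yes y≈0 = trans (0⁻¹≈0 (trans x≈y y≈0)) (sym (0⁻¹≈0 y≈0))
  ... | no y≉0  = ⁻¹-unique (trans (*-congʳ x≈y) (⁻¹-inverseʳ y≉0))

  x⁻¹≉0 : ∀ {x} → x ≉ 0# → x ⁻¹ ≉ 0#
  x⁻¹≉0 x≉0 x⁻¹≈0 =
    0≉1 (trans (sym (zeroʳ _)) (trans (*-congˡ (sym x⁻¹≈0)) (⁻¹-inverseʳ x≉0)))

  ⁻¹-involutive : ∀ x → (x ⁻¹) ⁻¹ ≈ x
  ⁻¹-involutive x with x ≟ 0#
  ... | yes x≈0 = trans (0⁻¹≈0 (0⁻¹≈0 x≈0)) (sym x≈0)
  ... | no x≉0  = ⁻¹-unique (⁻¹-inverseˡ x≉0)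

  1⁻¹≈1 : 1# ⁻¹ ≈ 1#
  1⁻¹≈1 = ⁻¹-unique (*-identityˡ 1#)

  injection⇒surjection : (f : Carrier → Carrier) → (∀ {x y} → f x ≈ f y → x ≈ y) →
                         ∀ y → ∃ λ x → f x ≈ y
  injection⇒surjection f f-injective y
    with i , eq ← injective⇒surjective ℕ.≤-refl (index ∘ f ∘ element)
                    (element-injective ∘ f-injective ∘ index-injective) (index y)
    = element i , index-injective eq

-- Counting subfields, and subspaces over them.

n<m^n : ∀ {m} n → 2 ≤ m → n ℕ.< m ℕ.^ n
n<m^n zero    2≤m = s≤s z≤n
n<m^n {m} (suc n) 2≤m = begin-strict
  suc n                     <⟨ s≤s (n<m^n n 2≤m) ⟩
  suc (m ℕ.^ n)             ≤⟨ ℕ.+-monoˡ-≤ (m ℕ.^ n) (ℕ.≤-trans (s≤s z≤n) (n<m^n n 2≤m)) ⟩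
  m ℕ.^ n ℕ.+ m ℕ.^ n       ≡⟨ ≡.cong (m ℕ.^ n ℕ.+_) (ℕ.+-identityʳ _) ⟨
  2 ℕ.* m ℕ.^ n             ≤⟨ ℕ.*-monoˡ-≤ (m ℕ.^ n) 2≤m ⟩
  m ℕ.* m ℕ.^ n             ∎
  where open ℕ.≤-Reasoning

^-injectiveʳ : ∀ {m} i j → 2 ≤ m → m ℕ.^ i ≡ m ℕ.^ j → i ≡ j
^-injectiveʳ {m} i j 2≤m eq with ℕ.<-cmp i j
... | tri< i<j _ _ = contradiction eq (ℕ.<⇒≢ (ℕ.^-monoʳ-< m 2≤m i<j))
... | tri≈ _ i≡j _ = i≡j
... | tri> _ _ j<i = contradiction (≡.sym eq) (ℕ.<⇒≢ (ℕ.^-monoʳ-< m 2≤m j<i))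

module FieldCounting {q} (K : FiniteField q c ℓ) where
  open FiniteFieldProperties K

  record Enumerates {m} (f : Fin m → Carrier) (P : Pred Carrier p) : Set (c ⊔ ℓ ⊔ p) where
    field
      injective : ∀ {i j} → f i ≈ f j → i ≡ j
      sound     : ∀ i → P (f i)
      complete  : ∀ {x} → P x → ∃ λ i → f i ≈ x

  open Enumerates

  module _ {m n p p′} {f : Fin m → Carrier} {g : Fin n → Carrier}
           {P : Pred Carrier p} {Q : Pred Carrier p′}
           (F : Enumerates f P) (G : Enumerates g Q) (P⊆Q : P ⊆ Q) where

    ⊆⇒reindex : ∀ i → ∃ λ k → g k ≈ f i
    ⊆⇒reindex i = complete G (P⊆Q (sound F i))

    ⊆⇒reindex-injective : ∀ {i j} → proj₁ (⊆⇒reindex i) ≡ proj₁ (⊆⇒reindex j) → i ≡ j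
    ⊆⇒reindex-injective {i} {j} eq = injective F
      (trans (sym (proj₂ (⊆⇒reindex i))) (trans (reflexive (≡.cong g eq)) (proj₂ (⊆⇒reindex j))))

    ⊆⇒≤ : m ≤ n
    ⊆⇒≤ = injective⇒≤ ⊆⇒reindex-injective

    -- The reindexing of `f` inside `g` is injective, so for n ≤ m it hits every index of `g`.
    ⊆-equinumerous : n ≤ m → ∀ {x} → Q x → ∃ λ i → f i ≈ x
    ⊆-equinumerous n≤m x∈Q
      with k , gk≈x ← complete G x∈Q
      with i , eq ← injective⇒surjective n≤m (proj₁ ∘ ⊆⇒reindex) ⊆⇒reindex-injective k
      = i , trans (sym (proj₂ (⊆⇒reindex i))) (trans (reflexive (≡.cong g eq)) gk≈x)

  record IsSubfield (D : Pred Carrier p) : Set (c ⊔ ℓ ⊔ p) where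
    field
      resp : ∀ {x y} → x ≈ y → D x → D y
      1∈   : D 1#
      -∈   : ∀ {x} → D x → D (- x)
      +∈   : ∀ {x y} → D x → D y → D (x + y)
      *∈   : ∀ {x y} → D x → D y → D (x * y)
      ⁻¹∈  : ∀ {x} → x ≉ 0# → D x → D (x ⁻¹)

    0∈ : D 0#
    0∈ = resp (-‿inverseʳ 1#) (+∈ 1∈ (-∈ 1∈))

  -- Starting from {0}, the lines D v with v ∈ S are adjoined one after the other;
  -- each step multiplies the number of elements by d = |D|.
  module _ {d p′} {D : Pred Carrier p} (isSubfield : IsSubfield D)
           {e : Fin d → Carrier} (E : Enumerates e D) (2≤d : 2 ≤ d)
           {S : Pred Carrier p′} (S-resp : ∀ {x y} → x ≈ y → S x → S y) (S? : ∀ x → Dec (S x))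
           (0∈S : S 0#) (+∈S : ∀ {x y} → S x → S y → S (x + y))
           (*∈S : ∀ {a x} → D a → S x → S (a * x)) where
    open IsSubfield isSubfield
    open ≈-Reasoning setoid

    private
      record Stage (m : ℕ) : Set (c ⊔ ℓ ⊔ p ⊔ p′) where
        field
          g     : Fin m → Carrier
          g-inj : ∀ {i j} → g i ≈ g j → i ≡ j
          g∈S   : ∀ i → S (g i)
          g-+   : ∀ i j → ∃ λ k → g k ≈ g i + g j
          g-*   : ∀ {a} → D a → ∀ i → ∃ λ k → g k ≈ a * g i

      trivial : Stage 1
      trivial = record
        { g     = λ _ → 0#
        ; g-inj = λ { {zero} {zero} _ → ≡.refl }
        ; g∈S   = λ _ → 0∈S
        ; g-+   = λ _ _ → zero , sym (+-identityʳ 0#)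
        ; g-*   = λ _ _ → zero , sym (zeroʳ _)
        }

      module _ {m} (T : Stage m) {v} (v∈S : S v) (v∉T : ¬ ∃ λ i → Stage.g T i ≈ v) where
        open Stage T

        g⁺ : Fin d × Fin m → Carrier
        g⁺ (j , i) = e j * v + g i

        -- If `a` were invertible, `v` would be a⁻¹ (g j - g i), which the stage already lists
        -- because it is closed under sums and `D`-multiples.
        no-multiple : ∀ {a} → D a → ∀ i j → a * v + g i ≈ g j → a ≈ 0#
        no-multiple {a} a∈D i j eq = decidable-stable (a ≟ 0#) λ a≉0 →
          let i′ , gi′≈ = g-* (-∈ 1∈) i
              k  , gk≈  = g-+ j i′
              l  , gl≈  = g-* (⁻¹∈ a≉0 a∈D) k
          in v∉T (l , (begin
            g l                            ≈⟨ gl≈ ⟩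
            a ⁻¹ * g k                     ≈⟨ *-congˡ (trans gk≈ (+-cong (sym eq) gi′≈)) ⟩
            a ⁻¹ * ((a * v + g i) + (- 1#) * g i)
              ≈⟨ *-congˡ (solve 3 (λ a v g → (a :* v :+ g) :+ (:- con (ℤ.+ 1)) :* g := a :* v) refl a v (g i)) ⟩
            a ⁻¹ * (a * v)                 ≈⟨ x⁻¹*[x*y]≈y v a≉0 ⟩
            v                              ∎))

        g⁺-inj : ∀ {x y} → g⁺ x ≈ g⁺ y → x ≡ y
        g⁺-inj {j , i} {j′ , i′} eq = ≡.cong₂ _,_ (injective E ej≈) (g-inj gi≈)
          where
          ej≈ : e j ≈ e j′
          ej≈ = x-y≈0⇒x≈y (no-multiple (+∈ (sound E j) (-∈ (sound E j′))) i i′ (begin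
            (e j - e j′) * v + g i
              ≈⟨ solve 4 (λ a b v g → (a :- b) :* v :+ g := (a :* v :+ g) :- b :* v) refl (e j) (e j′) v (g i) ⟩
            (e j * v + g i) - e j′ * v      ≈⟨ +-congʳ eq ⟩
            (e j′ * v + g i′) - e j′ * v
              ≈⟨ solve 3 (λ b v g → (b :* v :+ g) :- b :* v := g) refl (e j′) v (g i′) ⟩
            g i′                            ∎))
          gi≈ : g i ≈ g i′
          gi≈ = begin
            g i
              ≈⟨ solve 3 (λ b v g → (b :* v :+ g) :- b :* v := g) refl (e j) v (g i) ⟨
            (e j * v + g i) - e j * v       ≈⟨ +-cong eq (-‿cong (*-congʳ ej≈)) ⟩
            (e j′ * v + g i′) - e j′ * v
              ≈⟨ solve 3 (λ b v g → (b :* v :+ g) :- b :* v := g) refl (e j′) v (g i′) ⟩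
            g i′                            ∎

        realise : ∀ {a x} → D a → (∃ λ i → g i ≈ x) → ∃ λ k → g⁺ (remQuot m k) ≈ a * v + x
        realise {a} {x} a∈D (i , gi≈x) with j , ej≈a ← complete E a∈D =
          combine j i , (begin
            g⁺ (remQuot m (combine j i))   ≡⟨ ≡.cong g⁺ (remQuot-combine j i) ⟩
            e j * v + g i                  ≈⟨ +-cong (*-congʳ ej≈a) gi≈x ⟩
            a * v + x                      ∎)

        adjoin : Stage (d ℕ.* m)
        adjoin = record
          { g     = λ k → g⁺ (remQuot m k)
          ; g-inj = λ {k} {l} eq →
              ≡.trans (≡.sym (combine-remQuot {d} m k))
                (≡.trans (≡.cong (uncurry combine) (g⁺-inj eq)) (combine-remQuot {d} m l))
          ; g∈S   = λ k → let j , i = remQuot {d} m k in +∈S (*∈S (sound E j) v∈S) (g∈S i)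
          ; g-+   = λ k l →
              let j , i = remQuot {d} m k ; j′ , i′ = remQuot {d} m l
                  n , eq = realise (+∈ (sound E j) (sound E j′)) (g-+ i i′)
              in n , trans eq (solve 5 (λ a b v g h →
                   (a :+ b) :* v :+ (g :+ h) := (a :* v :+ g) :+ (b :* v :+ h)) refl (e j) (e j′) v (g i) (g i′))
          ; g-*   = λ {a} a∈D k →
              let j , i = remQuot {d} m k
                  n , eq = realise (*∈ a∈D (sound E j)) (g-* a∈D i)
              in n , trans eq (solve 4 (λ a b v g →
                   (a :* b) :* v :+ a :* g := a :* (b :* v :+ g)) refl a (e j) v (g i))
          }

      -- `k` is fuel and `l` counts the adjoined vectors. The fuel cannot run out: after `suc q`
      -- steps there would be d^(q+1) > q distinct elements in a field of `q` elements.
      fill : ∀ k l → k ℕ.+ l ≡ suc q → Stage (d ℕ.^ l) →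
             ∃ λ l → Σ (Fin (d ℕ.^ l) → Carrier) λ g → Enumerates g S
      fill zero l ≡.refl T =
        contradiction (injective⇒≤ {f = index ∘ g} (g-inj ∘ index-injective))
          (ℕ.<⇒≱ (ℕ.<-trans (ℕ.n<1+n q) (n<m^n (suc q) 2≤d)))
        where open Stage T
      fill (suc k) l eq T
        with ∃? (λ x≈y (x∈S , x∉T) → S-resp x≈y x∈S , λ (i , gi≈y) → x∉T (i , trans gi≈y (sym x≈y)))
                (λ x → S? x ×-dec ¬? (any? λ i → Stage.g T i ≟ x))
      ... | yes (v , v∈S , v∉T) = fill k (suc l) (≡.trans (ℕ.+-suc k l) eq) (adjoin T v∈S v∉T)
      ... | no  S⊆T = l , Stage.g T , record
        { injective = Stage.g-inj T
        ; sound     = Stage.g∈S T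
        ; complete  = λ {x} x∈S → decidable-stable (any? λ i → Stage.g T i ≟ x) λ x∉T → S⊆T (x , x∈S , x∉T)
        }

    enumerateSubspace : ∃ λ l → Σ (Fin (d ℕ.^ l) → Carrier) λ g → Enumerates g S
    enumerateSubspace = fill (suc q) 0 (ℕ.+-identityʳ (suc q)) trivial

  all-enumerated : Enumerates element (λ _ → ⊤ {0ℓ})
  all-enumerated = record
    { injective = element-injective
    ; sound     = λ _ → tt
    ; complete  = λ {x} _ → index x , element-index x
    }

-- The image of F in K and the fields in between.

module ExtensionProperties {q n} {F : FiniteField q c ℓ} {K : FiniteField (q ℕ.^ n) c′ ℓ′}
                           (2≤q : 2 ≤ q) (ι : Extension F K) where
  private
    module F = FiniteFieldProperties F
  open FiniteFieldProperties K
  open FieldCounting K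
  open RingHomomorphism ι using (⟦_⟧; ⟦⟧-cong; +-homo; *-homo; -‿homo; 0#-homo; 1#-homo)

  InF : Pred Carrier (c ⊔ ℓ′)
  InF x = ∃ λ t → ⟦ t ⟧ ≈ x

  InF-resp : ∀ {x y} → x ≈ y → InF x → InF y
  InF-resp x≈y (t , eq) = t , trans eq x≈y

  InF? : ∀ x → Dec (InF x)
  InF? x = F.∃? (λ s≈t eq → trans (⟦⟧-cong (F.sym s≈t)) eq) (λ t → ⟦ t ⟧ ≟ x)

  ι-kernel : ∀ {t} → ⟦ t ⟧ ≈ 0# → t F.≈ F.0#
  ι-kernel {t} ιt≈0 = decidable-stable (t F.≟ F.0#) λ t≉0 → 0≉1 (begin
    0#                        ≈⟨ zeroˡ _ ⟨
    0# * ⟦ t F.⁻¹ ⟧           ≈⟨ *-congʳ ιt≈0 ⟨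
    ⟦ t ⟧ * ⟦ t F.⁻¹ ⟧        ≈⟨ *-homo _ _ ⟨
    ⟦ t F.* t F.⁻¹ ⟧          ≈⟨ ⟦⟧-cong (F.⁻¹-inverseʳ t≉0) ⟩
    ⟦ F.1# ⟧                  ≈⟨ 1#-homo ⟩
    1#                        ∎)
    where open ≈-Reasoning setoid

  ι-injective : ∀ {s t} → ⟦ s ⟧ ≈ ⟦ t ⟧ → s F.≈ t
  ι-injective {s} {t} eq = F.x-y≈0⇒x≈y (ι-kernel
    (trans (+-homo s (F.- t)) (trans (+-congˡ (-‿homo t)) (x≈y⇒x-y≈0 eq))))

  ι-⁻¹ : ∀ t → ⟦ t F.⁻¹ ⟧ ≈ ⟦ t ⟧ ⁻¹
  ι-⁻¹ t with t F.≟ F.0#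
  ... | yes t≈0 = trans (trans (⟦⟧-cong (F.0⁻¹≈0 t≈0)) 0#-homo) (sym (0⁻¹≈0 (trans (⟦⟧-cong t≈0) 0#-homo)))
  ... | no  t≉0 = sym (⁻¹-unique (trans (sym (*-homo _ _))
                    (trans (⟦⟧-cong (F.⁻¹-inverseʳ t≉0)) 1#-homo)))

  InF-isSubfield : IsSubfield InF
  InF-isSubfield = record
    { resp = InF-resp
    ; 1∈   = F.1# , 1#-homo
    ; -∈   = λ (t , eq) → F.- t , trans (-‿homo t) (-‿cong eq)
    ; +∈   = λ (s , eq) (t , eq′) → s F.+ t , trans (+-homo s t) (+-cong eq eq′)
    ; *∈   = λ (s , eq) (t , eq′) → s F.* t , trans (*-homo s t) (*-cong eq eq′)
    ; ⁻¹∈  = λ _ (t , eq) → t F.⁻¹ , trans (ι-⁻¹ t) (⁻¹-cong eq)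
    }

  InF-enumerated : Enumerates (λ i → ⟦ F.element i ⟧) InF
  InF-enumerated = record
    { injective = F.element-injective ∘ ι-injective
    ; sound     = λ i → F.element i , refl
    ; complete  = λ (t , eq) → F.index t , trans (⟦⟧-cong (F.element-index t)) eq
    }

  -- By the tower law, the degree of an intermediate field divides n.
  intermediateField : Prime n → {P : Pred Carrier p} → IsSubfield P → (∀ x → Dec (P x)) →
                      InF ⊆ P → ∀ {x} → P x → ¬ InF x → ∀ y → P y
  intermediateField n-prime {P} isSubfield P? F⊆P {x} x∈P x∉F y
    with l , f , fP ← enumerateSubspace InF-isSubfield InF-enumerated 2≤q
           (IsSubfield.resp isSubfield) P? (IsSubfield.0∈ isSubfield)
           (IsSubfield.+∈ isSubfield) (λ a∈F x∈P → IsSubfield.*∈ isSubfield (F⊆P a∈F) x∈P)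
    = conclude (prime⇒irreducible n-prime (divides m′ n≡ml))
    where
    2≤q^l : 2 ≤ q ℕ.^ l
    2≤q^l = ℕ.≤-trans 2≤q (⊆⇒≤ InF-enumerated fP F⊆P)
    full : ∃ λ m → Σ (Fin ((q ℕ.^ l) ℕ.^ m) → Carrier) λ g → Enumerates g (λ _ → ⊤ {0ℓ})
    full = enumerateSubspace isSubfield fP 2≤q^l (λ _ _ → tt) (λ _ → yes tt) tt (λ _ _ → tt) (λ _ _ → tt)
    m′ = proj₁ full
    G = proj₂ (proj₂ full)
    -- `K` is listed once by its own enumeration and once as a space over `P`, so q^n = (q^l)^m′.
    n≡ml : n ≡ m′ ℕ.* l
    n≡ml = ^-injectiveʳ n (m′ ℕ.* l) 2≤q (≡.trans
      (ℕ.≤-antisym (⊆⇒≤ all-enumerated G (λ _ → tt)) (⊆⇒≤ G all-enumerated (λ _ → tt)))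
      (≡.trans (ℕ.^-*-assoc q l m′) (≡.cong (q ℕ.^_) (ℕ.*-comm l m′))))
    conclude : l ≡ 1 ⊎ l ≡ n → P y
    -- Now `P` has only q elements, as many as `F`, and leaves no room for `x`.
    conclude (inj₁ l≡1) = contradiction (F.element (proj₁ x∈) , proj₂ x∈) x∉F
      where
      x∈ : ∃ λ i → ⟦ F.element i ⟧ ≈ x
      x∈ = ⊆-equinumerous InF-enumerated fP F⊆P
             (ℕ.≤-reflexive (≡.trans (≡.cong (q ℕ.^_) l≡1) (ℕ.^-identityʳ q))) x∈P
    conclude (inj₂ l≡n) = IsSubfield.resp isSubfield (proj₂ y∈) (Enumerates.sound fP (proj₁ y∈))
      where
      y∈ : ∃ λ i → f i ≈ y
      y∈ = ⊆-equinumerous fP all-enumerated (λ _ → tt) (ℕ.≤-reflexive (≡.cong (q ℕ.^_) (≡.sym l≡n))) tt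

  ∃∉F : 2 ≤ n → ∃ λ x → ¬ InF x
  ∃∉F 2≤n with ∃? (λ x≈y x∉F y∈F → x∉F (InF-resp (sym x≈y) y∈F)) (λ x → ¬? (InF? x))
  ... | yes found = found
  ... | no  none  = contradiction
    (⊆⇒≤ all-enumerated InF-enumerated λ {x} _ → decidable-stable (InF? x) λ x∉F → none (x , x∉F))
    (ℕ.<⇒≱ (≡.subst (ℕ._< q ℕ.^ n) (ℕ.*-identityʳ q) (ℕ.^-monoʳ-< q 2≤q 2≤n)))

  -- In a field {0, 1} the test for 0 would be injective into `Fin 2`. The element found provides
  -- the two invertible weights in `σ-plane`.
  ∃≉0,1 : 3 ≤ q → ∃ λ t → (t F.≉ F.0#) × (t F.≉ F.1#)
  ∃≉0,1 3≤q
    with F.∃? (λ s≈t (s≉0 , s≉1) → (λ t≈0 → s≉0 (F.trans s≈t t≈0)) , (λ t≈1 → s≉1 (F.trans s≈t t≈1)))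
              (λ t → ¬? (t F.≟ F.0#) ×-dec ¬? (t F.≟ F.1#))
  ... | yes found = found
  ... | no  none  = contradiction (injective⇒≤ {f = f ∘ F.element} (F.element-injective ∘ f-injective _ _)) (ℕ.<⇒≱ 3≤q)
    where
    f : F.Carrier → Fin 2
    f t with t F.≟ F.0#
    ... | yes _ = zero
    ... | no  _ = suc zero
    f-injective : ∀ s t → f s ≡ f t → s F.≈ t
    f-injective s t eq with s F.≟ F.0# | t F.≟ F.0#
    ... | yes s≈0 | yes t≈0 = F.trans s≈0 (F.sym t≈0)
    ... | no  s≉0 | no t≉0 = F.trans (is1 s s≉0) (F.sym (is1 t t≉0))
      where
      is1 : ∀ t → t F.≉ F.0# → t F.≈ F.1#
      is1 t t≉0 = decidable-stable (t F.≟ F.1#) λ t≉1 → none (t , t≉0 , t≉1)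

-- F-linear maps of K and the multiplications that they carry to multiplications.

module LinearMaps {q n} {F : FiniteField q c ℓ} {K : FiniteField (q ℕ.^ n) c′ ℓ′}
                  (n-prime : Prime n) (2≤q : 2 ≤ q) (ι : Extension F K) where
  private
    module F = FiniteFieldProperties F
  open FiniteFieldProperties K
  open FieldCounting K
  open ExtensionProperties {n = n} {F = F} {K = K} 2≤q ι
  open RingHomomorphism ι using (⟦_⟧; 0#-homo)
  open ≈-Reasoning setoid

  record IsLinear (g : Carrier → Carrier) : Set (c ⊔ c′ ⊔ ℓ′) where
    field
      cong   : ∀ {x y} → x ≈ y → g x ≈ g y
      +-homo : ∀ x y → g (x + y) ≈ g x + g y
      *-homo : ∀ t x → g (⟦ t ⟧ * x) ≈ ⟦ t ⟧ * g x

    0-homo : ∀ {x} → x ≈ 0# → g x ≈ 0#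
    0-homo {x} x≈0 = begin
      g x                  ≈⟨ cong (trans x≈0 (sym (trans (*-congʳ 0#-homo) (zeroˡ 0#)))) ⟩
      g (⟦ F.0# ⟧ * 0#)    ≈⟨ *-homo F.0# 0# ⟩
      ⟦ F.0# ⟧ * g 0#      ≈⟨ *-congʳ 0#-homo ⟩
      0# * g 0#            ≈⟨ zeroˡ _ ⟩
      0#                   ∎

    -‿hom : ∀ x y → g (x - y) ≈ g x - g y
    -‿hom x y = begin
      g (x - y)
        ≈⟨ solve 3 (λ a x y → a := (a :+ y) :- y) refl (g (x - y)) x (g y) ⟩
      (g (x - y) + g y) - g y     ≈⟨ +-congʳ (+-homo _ _) ⟨
      g ((x - y) + y) - g y       ≈⟨ +-congʳ (cong (solve 2 (λ x y → (x :- y) :+ y := x) refl x y)) ⟩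
      g x - g y                   ∎

  record IsBijectiveLinear (g : Carrier → Carrier) : Set (c ⊔ c′ ⊔ ℓ′) where
    field
      isLinear   : IsLinear g
      kernel     : ∀ {x} → g x ≈ 0# → x ≈ 0#
      surjective : ∀ y → ∃ λ x → g x ≈ y
    open IsLinear isLinear public

    injective : ∀ {x y} → g x ≈ g y → x ≈ y
    injective {x} {y} eq = x-y≈0⇒x≈y (kernel (trans (-‿hom x y) (x≈y⇒x-y≈0 eq)))

    _⁻ : Carrier → Carrier
    x ⁻ = proj₁ (surjective x)

    section : ∀ x → g (x ⁻) ≈ x
    section x = proj₂ (surjective x)

    ⁻-isBijectiveLinear : IsBijectiveLinear _⁻
    ⁻-isBijectiveLinear = record
      { isLinear = record
        { cong   = λ x≈y → injective (trans (section _) (trans x≈y (sym (section _))))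
        ; +-homo = λ x y → injective (trans (section _)
                     (sym (trans (+-homo _ _) (+-cong (section x) (section y)))))
        ; *-homo = λ t x → injective (trans (section _)
                     (sym (trans (*-homo t _) (*-congˡ (section x)))))
        }
      ; kernel     = λ x⁻≈0 → trans (sym (section _)) (0-homo x⁻≈0)
      ; surjective = λ x → g x , injective (section (g x))
      }

  ∘-isLinear : ∀ {g h} → IsLinear g → IsLinear h → IsLinear (g ∘ h)
  ∘-isLinear G H = record
    { cong   = λ eq → G.cong (H.cong eq)
    ; +-homo = λ x y → trans (G.cong (H.+-homo x y)) (G.+-homo _ _)
    ; *-homo = λ t x → trans (G.cong (H.*-homo t x)) (G.*-homo t _)
    }
    where
    module G = IsLinear G
    module H = IsLinear H

  ∘-isBijectiveLinear : ∀ {g h} → IsBijectiveLinear g → IsBijectiveLinear h → IsBijectiveLinear (g ∘ h)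
  ∘-isBijectiveLinear G H = record
    { isLinear   = ∘-isLinear G.isLinear H.isLinear
    ; kernel     = λ eq → H.kernel (G.kernel eq)
    ; surjective = λ y → proj₁ (H.surjective (y G.⁻)) ,
                   trans (G.cong (H.section _)) (G.section y)
    }
    where
    module G = IsBijectiveLinear G
    module H = IsBijectiveLinear H

  -- For bijective g the elements k such that g ∘ (k *_) ∘ g ⁻ is again a
  -- multiplication form a field between F and K, hence are F or all of K.
  Stabilises : (Carrier → Carrier) → Pred Carrier (c′ ⊔ ℓ′)
  Stabilises g k = ∃ λ k′ → ∀ x → g (k * x) ≈ k′ * g x

  module _ {g : Carrier → Carrier} (bijective : IsBijectiveLinear g) where
    open IsBijectiveLinear bijective

    stabilises-F : InF ⊆ Stabilises g
    stabilises-F (t , eq) = ⟦ t ⟧ , λ x → trans (cong (*-congʳ (sym eq))) (*-homo t x)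

    preimage-1 : Carrier
    preimage-1 = 1# ⁻

    multiplier-unique : ∀ {a b x} → g x ≈ 1# → a * g x ≈ b * g x → a ≈ b
    multiplier-unique gx≈1 eq =
      trans (sym (*-identityʳ _)) (trans (*-congˡ (sym gx≈1)) (trans eq (trans (*-congˡ gx≈1) (*-identityʳ _))))

    multiplier-nonzero : ∀ {k k′} → (∀ x → g (k * x) ≈ k′ * g x) → k ≉ 0# → k′ ≉ 0#
    multiplier-nonzero {k} {k′} eq k≉0 k′≈0 = 0≉1 (begin
      0#             ≈⟨ 0-homo (x*y≈0⇒y≈0 k≉0 (kernel (trans (eq _) (trans (*-congʳ k′≈0) (zeroˡ _))))) ⟨
      g (1# ⁻)       ≈⟨ section 1# ⟩
      1#             ∎)

    multiplier-injective : ∀ {k l k′ l′} → (∀ x → g (k * x) ≈ k′ * g x) →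
                           (∀ x → g (l * x) ≈ l′ * g x) → k′ ≈ l′ → k ≈ l
    multiplier-injective {k} {l} eq eq′ k′≈l′ = begin
      k              ≈⟨ *-identityʳ k ⟨
      k * 1#         ≈⟨ injective (trans (eq 1#) (trans (*-congʳ k′≈l′) (sym (eq′ 1#)))) ⟩
      l * 1#         ≈⟨ *-identityʳ l ⟩
      l              ∎

    stabilises-resp : ∀ {x y} → x ≈ y → Stabilises g x → Stabilises g y
    stabilises-resp x≈y (k′ , eq) = k′ , λ z → trans (cong (*-congʳ (sym x≈y))) (eq z)

    stabiliser-isSubfield : IsSubfield (Stabilises g)
    stabiliser-isSubfield = record
      { resp = stabilises-resp
      ; 1∈   = 1# , λ x → trans (cong (*-identityˡ x)) (sym (*-identityˡ _))
      ; -∈   = λ {x} (k′ , eq) → - k′ , λ z → begin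
          g (- x * z)        ≈⟨ cong (solve 2 (λ x z → (:- x) :* z := con (ℤ.+ 0) :- x :* z) refl x z) ⟩
          g (0# - x * z)     ≈⟨ -‿hom 0# (x * z) ⟩
          g 0# - g (x * z)   ≈⟨ +-cong (0-homo refl) (-‿cong (eq z)) ⟩
          0# - k′ * g z      ≈⟨ solve 2 (λ x z → (:- x) :* z := con (ℤ.+ 0) :- x :* z) refl k′ (g z) ⟨
          - k′ * g z         ∎
      ; +∈   = λ {x} {y} (k , eq) (l , eq′) → k + l , λ z → begin
          g ((x + y) * z)         ≈⟨ cong (distribʳ z x y) ⟩
          g (x * z + y * z)       ≈⟨ +-homo _ _ ⟩
          g (x * z) + g (y * z)   ≈⟨ +-cong (eq z) (eq′ z) ⟩
          k * g z + l * g z       ≈⟨ distribʳ (g z) k l ⟨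
          (k + l) * g z           ∎
      ; *∈   = λ {x} {y} (k , eq) (l , eq′) → k * l , λ z → begin
          g ((x * y) * z)         ≈⟨ cong (*-assoc x y z) ⟩
          g (x * (y * z))         ≈⟨ eq (y * z) ⟩
          k * g (y * z)           ≈⟨ *-congˡ (eq′ z) ⟩
          k * (l * g z)           ≈⟨ *-assoc k l (g z) ⟨
          (k * l) * g z           ∎
      ; ⁻¹∈  = λ {x} x≉0 (k , eq) → k ⁻¹ , λ z → begin
          g (x ⁻¹ * z)                  ≈⟨ x⁻¹*[x*y]≈y _ (multiplier-nonzero eq x≉0) ⟨
          k ⁻¹ * (k * g (x ⁻¹ * z))     ≈⟨ *-congˡ (eq (x ⁻¹ * z)) ⟨
          k ⁻¹ * g (x * (x ⁻¹ * z))     ≈⟨ *-congˡ (cong (x*[x⁻¹*y]≈y z x≉0)) ⟩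
          k ⁻¹ * g z                    ∎
      }

    stabilises? : ∀ k → Dec (Stabilises g k)
    stabilises? k = ∃? (λ k′≈l′ eq x → trans (eq x) (*-congʳ k′≈l′)) λ k′ →
      ∀? (λ x≈y eq → trans (cong (*-congˡ (sym x≈y))) (trans eq (*-congˡ (cong x≈y))))
         (λ x → g (k * x) ≟ k′ * g x)

    stabilises-all : ∀ {k} → Stabilises g k → ¬ InF k → ∀ l → Stabilises g l
    stabilises-all = intermediateField n-prime stabiliser-isSubfield stabilises? stabilises-F

    -- The passage from k to its multiplier is injective on the finite set `K`, hence onto. This
    -- pulls a slope, given as a multiplication after `g`, back to a multiplication before `g`.
    stabilises-all⇒multiplier-surjective : (∀ k → Stabilises g k) →
      ∀ k′ → ∃ λ k → ∀ x → g (k * x) ≈ k′ * g x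
    stabilises-all⇒multiplier-surjective S k′ =
      proj₁ preimage , λ x → trans (proj₂ (S (proj₁ preimage)) x) (*-congʳ (proj₂ preimage))
      where
      preimage : ∃ λ k → proj₁ (S k) ≈ k′
      preimage = injection⇒surjection (proj₁ ∘ S)
        (λ {k} {l} → multiplier-injective (proj₂ (S k)) (proj₂ (S l))) k′

-- Slope families: the Desarguesian spreads as equations for the maps B.

module SlopeFamilies {q n} {F : FiniteField q c ℓ} {K : FiniteField (q ℕ.^ n) c′ ℓ′}
                     (n-prime : Prime n) (3≤q : 3 ≤ q) (ι : Extension F K) where
  private
    2≤q : 2 ≤ q
    2≤q = ℕ.≤-trans (ℕ.n≤1+n 2) 3≤q
  open FiniteFieldProperties K
  open FieldCounting K
  open ExtensionProperties {n = n} {F = F} {K = K} 2≤q ι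
  open LinearMaps {n = n} {F = F} {K = K} n-prime 2≤q ι
  open RingHomomorphism ι using (⟦_⟧)
  open ≈-Reasoning setoid
  open IsSubfield InF-isSubfield using (0∈)

  -- `slope` expresses the spread of `H b`, and `base` the spread of the graph of slope `a`: modulo
  -- that graph, the graph of slope κ is described by (κ - a) x and B κ x - B a x, and these differ
  -- by one multiplication in suitable coordinates `h′` and `h`. Slope 1 is exempt because it
  -- belongs to `H d`, whose spread is not known. `B-separated` comes from the disjointness of two
  -- graphs and `H b`.
  record IsSlopeFamily (B : Carrier → Carrier → Carrier) (g : Carrier → Carrier) :
                       Set (c ⊔ c′ ⊔ ℓ′) where
    field
      B-cong      : ∀ {κ μ x y} → κ ≈ μ → x ≈ y → B κ x ≈ B μ y
      B-0         : ∀ x → B 0# x ≈ 0#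
      B-1         : ∀ x → B 1# x ≈ x
      B-separated : ∀ {κ μ x} → κ ≉ μ → B κ x ≈ B μ x → x ≈ 0#
      bijective   : IsBijectiveLinear g
      slope       : ∀ κ → ∃ λ s → ∀ x → g (B κ x) ≈ s * g x
      base        : ∀ {a} → a ≉ 1# → ∃ λ h → ∃ λ h′ →
                    IsBijectiveLinear h × IsLinear h′ ×
                    (∀ {κ} → κ ≉ a → ∃ λ t → ∀ x → h (B κ x - B a x) ≈ t * h′ ((κ - a) * x))

    open IsBijectiveLinear bijective public

    σ : Carrier → Carrier
    σ κ = proj₁ (slope κ)

    g∘B : ∀ κ x → g (B κ x) ≈ σ κ * g x
    g∘B κ = proj₂ (slope κ)

    one : Carrier
    one = preimage-1 bijective

    σ≈ : ∀ κ → σ κ ≈ g (B κ one)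
    σ≈ κ = sym (trans (g∘B κ one) (trans (*-congˡ (section 1#)) (*-identityʳ _)))

    σ-cong : ∀ {κ μ} → κ ≈ μ → σ κ ≈ σ μ
    σ-cong {κ} {μ} κ≈μ = trans (σ≈ κ) (trans (cong (B-cong κ≈μ refl)) (sym (σ≈ μ)))

    -- Equal values of `σ` make `B κ` and `B μ` agree at `one`, which is not 0 because `g` maps it
    -- to 1.
    σ-injective : ∀ {κ μ} → σ κ ≈ σ μ → κ ≈ μ
    σ-injective {κ} {μ} eq = decidable-stable (κ ≟ μ) λ κ≉μ →
      0≉1 (trans (sym (0-homo (B-separated κ≉μ
        (injective (trans (sym (σ≈ κ)) (trans eq (σ≈ μ))))))) (section 1#))

    σ-0 : σ 0# ≈ 0#
    σ-0 = trans (σ≈ 0#) (0-homo (B-0 one))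

    B-+-homo : ∀ κ x y → B κ (x + y) ≈ B κ x + B κ y
    B-+-homo κ x y = injective (begin
      g (B κ (x + y))          ≈⟨ g∘B κ _ ⟩
      σ κ * g (x + y)          ≈⟨ *-congˡ (+-homo x y) ⟩
      σ κ * (g x + g y)        ≈⟨ distribˡ _ _ _ ⟩
      σ κ * g x + σ κ * g y    ≈⟨ +-cong (g∘B κ x) (g∘B κ y) ⟨
      g (B κ x) + g (B κ y)    ≈⟨ +-homo _ _ ⟨
      g (B κ x + B κ y)        ∎)

    B-0-homo : ∀ κ {x} → x ≈ 0# → B κ x ≈ 0#
    B-0-homo κ {x} x≈0 = kernel (trans (g∘B κ x) (trans (*-congˡ (0-homo x≈0)) (zeroʳ _)))

    B-‿hom : ∀ κ x y → B κ (x - y) ≈ B κ x - B κ y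
    B-‿hom κ x y = begin
      B κ (x - y)
        ≈⟨ solve 2 (λ a y → a := (a :+ y) :- y) refl (B κ (x - y)) (B κ y) ⟩
      (B κ (x - y) + B κ y) - B κ y     ≈⟨ +-congʳ (B-+-homo κ _ _) ⟨
      B κ ((x - y) + y) - B κ y
        ≈⟨ +-congʳ (B-cong refl (solve 2 (λ x y → (x :- y) :+ y := x) refl x y)) ⟩
      B κ x - B κ y                     ∎

  -- F-lines through a base slope, when g is not stabilised by K.

  module Collineation {B g} (family : IsSlopeFamily B g) (¬stable : ¬ (∀ k → Stabilises g k)) where
    open IsSlopeFamily family

    module FromBase {a} (a≉1 : a ≉ 1#) where
      h = proj₁ (base a≉1)
      h′ = proj₁ (proj₂ (base a≉1))

      h-bijective : IsBijectiveLinear h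
      h-bijective = proj₁ (proj₂ (proj₂ (base a≉1)))

      h′-linear : IsLinear h′
      h′-linear = proj₁ (proj₂ (proj₂ (proj₂ (base a≉1))))

      module H = IsBijectiveLinear h-bijective
      module H′ = IsLinear h′-linear

      Δ : Carrier → Carrier → Carrier
      Δ κ x = B κ x - B a x

      τ : ∀ {κ} → κ ≉ a → Carrier
      τ κ≉a = proj₁ (proj₂ (proj₂ (proj₂ (proj₂ (base a≉1)))) κ≉a)

      h∘Δ : ∀ {κ} (κ≉a : κ ≉ a) x → h (Δ κ x) ≈ τ κ≉a * h′ ((κ - a) * x)
      h∘Δ κ≉a = proj₂ (proj₂ (proj₂ (proj₂ (proj₂ (base a≉1)))) κ≉a)

      g∘Δ : ∀ κ x → g (Δ κ x) ≈ (σ κ - σ a) * g x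
      g∘Δ κ x = begin
        g (B κ x - B a x)          ≈⟨ -‿hom _ _ ⟩
        g (B κ x) - g (B a x)      ≈⟨ +-cong (g∘B κ x) (-‿cong (g∘B a x)) ⟩
        σ κ * g x - σ a * g x
          ≈⟨ solve 3 (λ s t x → s :* x :- t :* x := (s :- t) :* x) refl (σ κ) (σ a) (g x) ⟩
        (σ κ - σ a) * g x          ∎

      τ≉0 : ∀ {κ} (κ≉a : κ ≉ a) → τ κ≉a ≉ 0#
      τ≉0 {κ} κ≉a τ≈0 = 0≉1 (sym (B-separated κ≉a (x-y≈0⇒x≈y
        (H.kernel (trans (h∘Δ κ≉a 1#) (trans (*-congʳ τ≈0) (zeroˡ _)))))))

      σκ-σa≉0 : ∀ {κ} → κ ≉ a → σ κ - σ a ≉ 0#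
      σκ-σa≉0 κ≉a eq = κ≉a (σ-injective (x-y≈0⇒x≈y eq))

      -- The change from the K-structure of the base `a` to that of `slope`; both are coordinates
      -- for the same values of `Δ`.
      G : Carrier → Carrier
      G x = g (x H.⁻)

      G-bijective : IsBijectiveLinear G
      G-bijective = ∘-isBijectiveLinear bijective H.⁻-isBijectiveLinear

      G∘h : ∀ x → G (h x) ≈ g x
      G∘h x = cong (H.injective (H.section (h x)))

      G-cong : ∀ {x y} → x ≈ y → G x ≈ G y
      G-cong = IsBijectiveLinear.cong G-bijective

      module _ {y} (y≉a : y ≉ a) where
        w : Carrier
        w = σ y - σ a

        w≉0 : w ≉ 0#
        w≉0 = σκ-σa≉0 y≉a

        -- Once `G` turns the factors `τ` into multiplications, σ μ - σ a times g x equals a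
        -- constant times G (h′ ((μ - a) x)) for each slope μ. Replacing x by k x at μ = y has the
        -- same effect on the right as moving to another slope, so g (k x) and g x are proportional
        -- by a constant.
        G-stabilised⇒g-stabilised : (∀ k → Stabilises G k) → ∀ k → Stabilises g k
        G-stabilised⇒g-stabilised S k with k ≟ 0#
        ... | yes k≈0 = 0# , λ x → trans (0-homo (trans (*-congʳ k≈0) (zeroˡ x))) (sym (zeroˡ _))
        ... | no  k≉0 = w ⁻¹ * (proj₁ (S τy) * (proj₁ (S τκ) ⁻¹ * (σ κ - σ a))) , λ x → begin
          g (k * x)                                         ≈⟨ x⁻¹*[x*y]≈y _ w≉0 ⟨
          w ⁻¹ * (w * g (k * x))                            ≈⟨ *-congˡ (transfer y≉a (k * x)) ⟩
          w ⁻¹ * (proj₁ (S τy) * G (h′ ((y - a) * (k * x))))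
            ≈⟨ *-congˡ (*-congˡ (G-cong (H′.cong (solve 4 (λ a y k x →
                 (y :- a) :* (k :* x) := ((a :+ k :* (y :- a)) :- a) :* x) refl a y k x)))) ⟩
          w ⁻¹ * (proj₁ (S τy) * G (h′ ((κ - a) * x)))
            ≈⟨ *-congˡ (*-congˡ (x⁻¹*[x*y]≈y _ τκ′≉0)) ⟨
          w ⁻¹ * (proj₁ (S τy) * (proj₁ (S τκ) ⁻¹ * (proj₁ (S τκ) * G (h′ ((κ - a) * x)))))
            ≈⟨ *-congˡ (*-congˡ (*-congˡ (transfer κ≉a x))) ⟨
          w ⁻¹ * (proj₁ (S τy) * (proj₁ (S τκ) ⁻¹ * ((σ κ - σ a) * g x)))
            ≈⟨ solve 5 (λ a b c d e → a :* (b :* (c :* (d :* e))) := (a :* (b :* (c :* d))) :* e) refl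
                 (w ⁻¹) (proj₁ (S τy)) (proj₁ (S τκ) ⁻¹) (σ κ - σ a) (g x) ⟩
          (w ⁻¹ * (proj₁ (S τy) * (proj₁ (S τκ) ⁻¹ * (σ κ - σ a)))) * g x  ∎
          where
          -- Chosen so that (κ - a) x = (y - a) (k x).
          κ : Carrier
          κ = a + k * (y - a)
          κ≉a : κ ≉ a
          κ≉a κ≈a = x*y≉0 k≉0 (λ eq → y≉a (x-y≈0⇒x≈y eq))
            (trans (solve 3 (λ a y k → k :* (y :- a) := (a :+ k :* (y :- a)) :- a) refl a y k) (x≈y⇒x-y≈0 κ≈a))
          τy = τ y≉a
          τκ = τ κ≉a
          τκ′≉0 : proj₁ (S τκ) ≉ 0#
          τκ′≉0 = multiplier-nonzero G-bijective (proj₂ (S τκ)) (τ≉0 κ≉a)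
          transfer : ∀ {μ} (μ≉a : μ ≉ a) x →
                     (σ μ - σ a) * g x ≈ proj₁ (S (τ μ≉a)) * G (h′ ((μ - a) * x))
          transfer {μ} μ≉a x = begin
            (σ μ - σ a) * g x                            ≈⟨ g∘Δ μ x ⟨
            g (Δ μ x)                                    ≈⟨ G∘h _ ⟨
            G (h (Δ μ x))                                ≈⟨ G-cong (h∘Δ μ≉a x) ⟩
            G (τ μ≉a * h′ ((μ - a) * x))                 ≈⟨ proj₂ (S (τ μ≉a)) _ ⟩
            proj₁ (S (τ μ≉a)) * G (h′ ((μ - a) * x))     ∎

        module _ {z} (z≉a : z ≉ a) {t} (z-a≈ : z - a ≈ ⟦ t ⟧ * (y - a)) where
          k : Carrier
          k = τ z≉a * (⟦ t ⟧ * τ y≉a ⁻¹)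

          k′ : Carrier
          k′ = (σ z - σ a) * w ⁻¹

          -- Since `h′` is F-linear, h (Δ z x₀) = k · h (Δ y x₀), while g (Δ z x₀) = k′ · g (Δ y
          -- x₀). As `G` carries `h` to `g`, it remains to write x as h (Δ y x₀).
          G-ratio : ∀ x → G (k * x) ≈ k′ * G x
          G-ratio x = begin
            G (k * x)                                        ≈⟨ G-cong kx≈ ⟩
            G (h (Δ z x₀))                                    ≈⟨ G∘h _ ⟩
            g (Δ z x₀)                                        ≈⟨ g∘Δ z x₀ ⟩
            (σ z - σ a) * g x₀                                ≈⟨ *-congˡ (section _) ⟩
            (σ z - σ a) * (w ⁻¹ * G x)                       ≈⟨ *-assoc _ _ _ ⟨
            k′ * G x                                         ∎
            where
            -- The solution of h (Δ y x₀) = x, read off through `g`, where `Δ y` is multiplication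
            -- by `w`.
            x₀ : Carrier
            x₀ = (w ⁻¹ * G x) ⁻
            x≈ : x ≈ τ y≉a * h′ ((y - a) * x₀)
            x≈ = begin
              x                             ≈⟨ H.section x ⟨
              h (x H.⁻)                     ≈⟨ H.cong (injective (begin
                g (x H.⁻)                     ≈⟨ x*[x⁻¹*y]≈y _ w≉0 ⟨
                w * (w ⁻¹ * G x)              ≈⟨ *-congˡ (section _) ⟨
                w * g x₀                       ≈⟨ g∘Δ y x₀ ⟨
                g (Δ y x₀)                     ∎)) ⟩
              h (Δ y x₀)                     ≈⟨ h∘Δ y≉a x₀ ⟩
              τ y≉a * h′ ((y - a) * x₀)      ∎
            kx≈ : k * x ≈ h (Δ z x₀)
            kx≈ = begin
              (τ z≉a * (⟦ t ⟧ * τ y≉a ⁻¹)) * x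
                ≈⟨ solve 4 (λ a b c d → (a :* (b :* c)) :* d := a :* (b :* (c :* d))) refl
                     (τ z≉a) ⟦ t ⟧ (τ y≉a ⁻¹) x ⟩
              τ z≉a * (⟦ t ⟧ * (τ y≉a ⁻¹ * x))
                ≈⟨ *-congˡ (*-congˡ (trans (*-congˡ x≈) (x⁻¹*[x*y]≈y _ (τ≉0 y≉a)))) ⟩
              τ z≉a * (⟦ t ⟧ * h′ ((y - a) * x₀))
                ≈⟨ *-congˡ (H′.*-homo t _) ⟨
              τ z≉a * h′ (⟦ t ⟧ * ((y - a) * x₀))
                ≈⟨ *-congˡ (H′.cong (trans (sym (*-assoc _ _ _)) (*-congʳ (sym z-a≈)))) ⟩
              τ z≉a * h′ ((z - a) * x₀)      ≈⟨ h∘Δ z≉a x₀ ⟨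
              h (Δ z x₀)                     ∎

          -- If `k` were outside F, all of `K` would stabilise `G` and then `g`, against `¬stable`.
          -- So `k` is in F, and F-linearity of `G` gives k′ = k.
          ratio∈F : InF k′
          ratio∈F with InF? k
          ... | no  k∉F = contradiction
            (G-stabilised⇒g-stabilised (stabilises-all G-bijective (k′ , G-ratio) k∉F)) ¬stable
          ... | yes (s , ⟦s⟧≈k) = s , multiplier-unique G-bijective (section₁ G-bijective)
            (begin
              ⟦ s ⟧ * G u     ≈⟨ IsBijectiveLinear.*-homo G-bijective s u ⟨
              G (⟦ s ⟧ * u)   ≈⟨ G-cong (*-congʳ ⟦s⟧≈k) ⟩
              G (k * u)       ≈⟨ G-ratio u ⟩
              k′ * G u        ∎)
            where
            u = preimage-1 G-bijective
            section₁ : ∀ {f} (b : IsBijectiveLinear f) → f (preimage-1 b) ≈ 1#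
            section₁ b = IsBijectiveLinear.section b 1#

      lineFrom : ∀ {y} → y ≉ a → ∀ t →
                 ∃ λ k → InF k × σ (a + ⟦ t ⟧ * (y - a)) ≈ σ a + k * (σ y - σ a)
      lineFrom {y} y≉a t with a + ⟦ t ⟧ * (y - a) ≟ a
      ... | yes z≈a = 0# , 0∈ , trans (σ-cong z≈a)
        (solve 2 (λ a b → a := a :+ con (ℤ.+ 0) :* b) refl (σ a) (σ y - σ a))
      ... | no  z≉a = k′ y≉a z≉a z-a≈ , ratio∈F y≉a z≉a z-a≈ , (begin
        σ z                                ≈⟨ solve 2 (λ z a → z := a :+ (z :- a)) refl (σ z) (σ a) ⟩
        σ a + (σ z - σ a)                  ≈⟨ +-congˡ (x*[x⁻¹*y]≈y _ (w≉0 y≉a)) ⟨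
        σ a + w y≉a * (w y≉a ⁻¹ * (σ z - σ a))
          ≈⟨ solve 4 (λ a b c d → a :+ b :* (c :* d) := a :+ (d :* c) :* b) refl
               (σ a) (w y≉a) (w y≉a ⁻¹) (σ z - σ a) ⟩
        σ a + k′ y≉a z≉a z-a≈ * (σ y - σ a)  ∎)
        where
        z = a + ⟦ t ⟧ * (y - a)
        z-a≈ : z - a ≈ ⟦ t ⟧ * (y - a)
        z-a≈ = solve 2 (λ a b → (a :+ b) :- a := b) refl a (⟦ t ⟧ * (y - a))

-- Affine F-lines, parallels and additivity of σ.

module AffineCollineation
         {q n} {F : FiniteField q c ℓ} {K : FiniteField (q ℕ.^ n) c′ ℓ′}
         (n-prime : Prime n) (3≤q : 3 ≤ q) (ι : Extension F K) where
  private
    module F = FiniteFieldProperties F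
    2≤q : 2 ≤ q
    2≤q = ℕ.≤-trans (ℕ.n≤1+n 2) 3≤q
  open FiniteFieldProperties K
  open FieldCounting K
  open ExtensionProperties {n = n} {F = F} {K = K} 2≤q ι
  open LinearMaps {n = n} {F = F} {K = K} n-prime 2≤q ι
  open SlopeFamilies {n = n} {F = F} {K = K} n-prime 3≤q ι
  open RingHomomorphism ι using (⟦_⟧; ⟦⟧-cong; 1#-homo)
  open ≈-Reasoning setoid
  open IsSubfield InF-isSubfield using (1∈; 0∈; -∈; +∈; *∈; ⁻¹∈)

  Independent : Carrier → Carrier → Set (c ⊔ c′ ⊔ ℓ′)
  Independent x y = ∀ {a b} → InF a → InF b → a * x + b * y ≈ 0# → (a ≈ 0#) × (b ≈ 0#)

  independent-sym : ∀ {x y} → Independent x y → Independent y x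
  independent-sym ind a∈F b∈F eq with b≈0 , a≈0 ← ind b∈F a∈F (trans (+-comm _ _) eq) = a≈0 , b≈0

  independent⇒≉0 : ∀ {x y} → Independent x y → x ≉ 0#
  independent⇒≉0 {x} {y} ind x≈0 = 1≉0 (proj₁ (ind 1∈ 0∈
    (trans (solve 2 (λ x y → con (ℤ.+ 1) :* x :+ con (ℤ.+ 0) :* y := x) refl x y) x≈0)))

  module Additivity {B g} (family : IsSlopeFamily B g) (¬stable : ¬ (∀ k → Stabilises g k)) where
    open IsSlopeFamily family
    open Collineation family ¬stable

    -- The slope 1 cannot serve as a base. If x = 1 the same line is therefore described from `y`,
    -- with 1 - s for s.
    line : ∀ {x y} → y ≉ x → ∀ {s} → InF s →
           ∃ λ k → InF k × σ (x + s * (y - x)) ≈ σ x + k * (σ y - σ x)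
    line {x} {y} y≉x {s} s∈F@(t , t≈s) with x ≟ 1#
    ... | no  x≉1 =
      let k , k∈F , eq = FromBase.lineFrom x≉1 y≉x t
      in k , k∈F , trans (σ-cong (+-congˡ (*-congʳ (sym t≈s)))) eq
    ... | yes x≈1 =
      let u , u≈1-s = +∈ 1∈ (-∈ s∈F)
          k , k∈F , eq = FromBase.lineFrom y≉1 (λ x≈y → y≉x (sym x≈y)) u
      in 1# - k , +∈ 1∈ (-∈ k∈F) , (begin
        σ (x + s * (y - x))
          ≈⟨ σ-cong (solve 3 (λ x y s → x :+ s :* (y :- x) :=
               y :+ (con (ℤ.+ 1) :- s) :* (x :- y)) refl x y s) ⟩
        σ (y + (1# - s) * (x - y))   ≈⟨ σ-cong (+-congˡ (*-congʳ u≈1-s)) ⟨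
        σ (y + ⟦ u ⟧ * (x - y))      ≈⟨ eq ⟩
        σ y + k * (σ x - σ y)
          ≈⟨ solve 3 (λ x y s → y :+ s :* (x :- y) :=
               x :+ (con (ℤ.+ 1) :- s) :* (y :- x)) refl (σ x) (σ y) k ⟩
        σ x + (1# - k) * (σ y - σ x) ∎)
      where
      y≉1 : y ≉ 1#
      y≉1 y≈1 = y≉x (trans y≈1 (sym x≈1))

    -- Injectivity of `σ` makes the passage from s to k an injective self-map of the finite field F,
    -- so every k occurs.
    line-surjective : ∀ {x y} → y ≉ x → ∀ {k} → InF k →
                      ∃ λ s → InF s × σ (x + s * (y - x)) ≈ σ x + k * (σ y - σ x)
    line-surjective {x} {y} y≉x {k} (u , u≈k) =
      ⟦ proj₁ t ⟧ , (proj₁ t , refl) , trans (proj₂ (proj₂ (image (proj₁ t))))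
        (+-congˡ (*-congʳ (trans (sym (proj₂ (proj₁ (proj₂ (image (proj₁ t))))))
                                 (trans (⟦⟧-cong (proj₂ t)) u≈k))))
      where
      image : ∀ t → ∃ λ k → InF k × σ (x + ⟦ t ⟧ * (y - x)) ≈ σ x + k * (σ y - σ x)
      image t = line y≉x (t , refl)
      f : F.Carrier → F.Carrier
      f t = proj₁ (proj₁ (proj₂ (image t)))
      f-injective : ∀ {s t} → f s F.≈ f t → s F.≈ t
      f-injective {s} {t} eq = ι-injective (*-cancelˡ (λ y-x≈0 → y≉x (x-y≈0⇒x≈y y-x≈0))
        (trans (*-comm _ _) (trans (+-cancelˡ x _ _ (σ-injective (begin
          σ (x + ⟦ s ⟧ * (y - x))                   ≈⟨ proj₂ (proj₂ (image s)) ⟩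
          σ x + proj₁ (image s) * (σ y - σ x)       ≈⟨ +-congˡ (*-congʳ (trans (trans (sym
            (proj₂ (proj₁ (proj₂ (image s))))) (⟦⟧-cong eq)) (proj₂ (proj₁ (proj₂ (image t)))))) ⟩
          σ x + proj₁ (image t) * (σ y - σ x)       ≈⟨ proj₂ (proj₂ (image t)) ⟨
          σ (x + ⟦ t ⟧ * (y - x))                   ∎))) (*-comm _ _))))
        where open import Algebra.Properties.AbelianGroup +-abelianGroup using () renaming (∙-cancelˡ to +-cancelˡ)
      t : ∃ λ t → f t F.≈ u
      t = F.injection⇒surjection f f-injective u

    ray : ∀ {x} → x ≉ 0# → ∀ {s} → InF s → ∃ λ k → InF k × σ (s * x) ≈ k * σ x
    ray {x} x≉0 {s} s∈F = let k , k∈F , eq = line x≉0 s∈F in k , k∈F , (begin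
      σ (s * x)                    ≈⟨ σ-cong (solve 2 (λ s x → s :* x := con (ℤ.+ 0) :+ s :* (x :- con (ℤ.+ 0))) refl s x) ⟩
      σ (0# + s * (x - 0#))        ≈⟨ eq ⟩
      σ 0# + k * (σ x - σ 0#)      ≈⟨ +-cong σ-0 (*-congˡ (+-congˡ (-‿cong σ-0))) ⟩
      0# + k * (σ x - 0#)          ≈⟨ solve 2 (λ s x → s :* x := con (ℤ.+ 0) :+ s :* (x :- con (ℤ.+ 0))) refl k (σ x) ⟨
      k * σ x                      ∎)

    ray-surjective : ∀ {x} → x ≉ 0# → ∀ {k} → InF k → ∃ λ s → InF s × σ (s * x) ≈ k * σ x
    ray-surjective {x} x≉0 {k} k∈F = let s , s∈F , eq = line-surjective x≉0 k∈F in s , s∈F , (begin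
      σ (s * x)                    ≈⟨ σ-cong (solve 2 (λ s x → s :* x := con (ℤ.+ 0) :+ s :* (x :- con (ℤ.+ 0))) refl s x) ⟩
      σ (0# + s * (x - 0#))        ≈⟨ eq ⟩
      σ 0# + k * (σ x - σ 0#)      ≈⟨ +-cong σ-0 (*-congˡ (+-congˡ (-‿cong σ-0))) ⟩
      0# + k * (σ x - 0#)          ≈⟨ solve 2 (λ s x → s :* x := con (ℤ.+ 0) :+ s :* (x :- con (ℤ.+ 0))) refl k (σ x) ⟨
      k * σ x                      ∎)

    -- x + y lies on a line joining a point of F x to a point of F y.
    σ-plane : ∀ {x y} → Independent x y →
              ∃ λ p → ∃ λ r → InF p × InF r × σ (x + y) ≈ p * σ x + r * σ y
    σ-plane {x} {y} ind =
      (1# - l) * k , l * k′ , *∈ (+∈ 1∈ (-∈ l∈F)) k∈F , *∈ l∈F k′∈F , (begin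
        σ (x + y)                                       ≈⟨ σ-cong (begin
          x + y
            ≈⟨ +-cong (x*[x⁻¹*y]≈y x s≉0) (x*[x⁻¹*y]≈y y 1-s≉0) ⟨
          s * (s ⁻¹ * x) + (1# - s) * ((1# - s) ⁻¹ * y)
            ≈⟨ solve 3 (λ s x y → s :* x :+ (con (ℤ.+ 1) :- s) :* y :=
                 x :+ (con (ℤ.+ 1) :- s) :* (y :- x)) refl s (s ⁻¹ * x) ((1# - s) ⁻¹ * y) ⟩
          s ⁻¹ * x + (1# - s) * ((1# - s) ⁻¹ * y - s ⁻¹ * x)   ∎) ⟩
        σ (s ⁻¹ * x + (1# - s) * ((1# - s) ⁻¹ * y - s ⁻¹ * x))  ≈⟨ l-eq ⟩
        σ (s ⁻¹ * x) + l * (σ ((1# - s) ⁻¹ * y) - σ (s ⁻¹ * x))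
          ≈⟨ +-cong k-eq (*-congˡ (+-cong k′-eq (-‿cong k-eq))) ⟩
        k * σ x + l * (k′ * σ y - k * σ x)
          ≈⟨ solve 5 (λ k x l k′ y → k :* x :+ l :* (k′ :* y :- k :* x) :=
               ((con (ℤ.+ 1) :- l) :* k) :* x :+ (l :* k′) :* y) refl k (σ x) l k′ (σ y) ⟩
        ((1# - l) * k) * σ x + (l * k′) * σ y           ∎)
      where
      -- `x + y` has weights s and 1 - s on the points s⁻¹ x and (1 - s)⁻¹ y. Both weights must be
      -- invertible, which calls for an element of F other than 0 and 1.
      s₀ : ∃ λ t → (t F.≉ F.0#) × (t F.≉ F.1#)
      s₀ = ∃≉0,1 3≤q
      s : Carrier
      s = ⟦ proj₁ s₀ ⟧
      s∈F : InF s
      s∈F = proj₁ s₀ , refl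
      s≉0 : s ≉ 0#
      s≉0 eq = proj₁ (proj₂ s₀) (ι-kernel eq)
      1-s≉0 : 1# - s ≉ 0#
      1-s≉0 eq = proj₂ (proj₂ s₀) (ι-injective (trans (sym (x-y≈0⇒x≈y eq)) (sym 1#-homo)))
      1-s∈F : InF (1# - s)
      1-s∈F = +∈ 1∈ (-∈ s∈F)
      y′≉x′ : (1# - s) ⁻¹ * y ≉ s ⁻¹ * x
      y′≉x′ eq = x⁻¹≉0 s≉0 (proj₁ (ind (⁻¹∈ s≉0 s∈F) (-∈ (⁻¹∈ 1-s≉0 1-s∈F)) (begin
        s ⁻¹ * x + - (1# - s) ⁻¹ * y
          ≈⟨ solve 3 (λ a b y → a :+ (:- b) :* y := a :- b :* y) refl (s ⁻¹ * x) ((1# - s) ⁻¹) y ⟩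
        s ⁻¹ * x - (1# - s) ⁻¹ * y   ≈⟨ x≈y⇒x-y≈0 (sym eq) ⟩
        0#                           ∎)))
      ray-x = ray (independent⇒≉0 ind) (⁻¹∈ s≉0 s∈F)
      ray-y = ray (independent⇒≉0 (independent-sym ind)) (⁻¹∈ 1-s≉0 1-s∈F)
      join  = line y′≉x′ 1-s∈F
      k = proj₁ ray-x
      k∈F = proj₁ (proj₂ ray-x)
      k-eq = proj₂ (proj₂ ray-x)
      k′ = proj₁ ray-y
      k′∈F = proj₁ (proj₂ ray-y)
      k′-eq = proj₂ (proj₂ ray-y)
      l = proj₁ join
      l∈F = proj₁ (proj₂ join)
      l-eq = proj₂ (proj₂ join)

    -- The parallel lines x + F y and F y have disjoint images, so the image of
    -- x + F y has the direction of σ y.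
    σ-parallel : ∀ {x y p r} → Independent x y → InF p → InF r →
                 σ (x + y) ≈ p * σ x + r * σ y → p ≈ 1#
    σ-parallel {x} {y} {p} {r} ind p∈F r∈F eq = decidable-stable (p ≟ 1#) λ p≉1 →
      let 1-p≉0 = λ 1-p≈0 → p≉1 (sym (x-y≈0⇒x≈y 1-p≈0))
          -- The parameter at which the line through σ x and σ (x + y) loses its σ x component and
          -- meets F σ y.
          k = (1# - p) ⁻¹
          k∈F = ⁻¹∈ 1-p≉0 (+∈ 1∈ (-∈ p∈F))
          s , s∈F , s-eq = line-surjective x+y≉x k∈F
          t , t∈F , t-eq = ray-surjective (independent⇒≉0 (independent-sym ind)) (*∈ k∈F r∈F)
          meet = σ-injective (begin
            σ (x + s * ((x + y) - x))             ≈⟨ s-eq ⟩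
            σ x + k * (σ (x + y) - σ x)           ≈⟨ +-congˡ (*-congˡ (+-congʳ eq)) ⟩
            σ x + k * ((p * σ x + r * σ y) - σ x)
              ≈⟨ solve 5 (λ x k p r y → x :+ k :* ((p :* x :+ r :* y) :- x) :=
                   (x :- (k :* ((con (ℤ.+ 1) :- p) :* x))) :+ (k :* r) :* y) refl (σ x) k p r (σ y) ⟩
            (σ x - k * ((1# - p) * σ x)) + (k * r) * σ y
              ≈⟨ +-congʳ (x≈y⇒x-y≈0 (sym (x⁻¹*[x*y]≈y (σ x) 1-p≉0))) ⟩
            0# + (k * r) * σ y                    ≈⟨ +-identityˡ _ ⟩
            (k * r) * σ y                         ≈⟨ t-eq ⟨
            σ (t * y)                             ∎)
      -- The preimages of the meeting point give x + s y = t y, against independence.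
      in 1≉0 (proj₁ (ind 1∈ (+∈ s∈F (-∈ t∈F)) (begin
        1# * x + (s - t) * y
          ≈⟨ solve 4 (λ x y s t → con (ℤ.+ 1) :* x :+ (s :- t) :* y :=
               (x :+ s :* ((x :+ y) :- x)) :- t :* y) refl x y s t ⟩
        (x + s * ((x + y) - x)) - t * y           ≈⟨ x≈y⇒x-y≈0 meet ⟩
        0#                                        ∎)))
      where
      x+y≉x : x + y ≉ x
      x+y≉x eq = independent⇒≉0 (independent-sym ind)
        (trans (solve 2 (λ x y → y := (x :+ y) :- x) refl x y) (x≈y⇒x-y≈0 eq))

    σ-additive : ∀ {x y} → Independent x y → σ (x + y) ≈ σ x + σ y
    σ-additive {x} {y} ind = let p , r , p∈F , r∈F , eq = σ-plane ind in begin
      σ (x + y)                ≈⟨ eq ⟩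
      p * σ x + r * σ y        ≈⟨ +-cong (*-congʳ (σ-parallel ind p∈F r∈F eq))
        (*-congʳ (σ-parallel (independent-sym ind) r∈F p∈F
          (trans (σ-cong (+-comm y x)) (trans eq (+-comm _ _))))) ⟩
      1# * σ x + 1# * σ y      ≈⟨ +-cong (*-identityˡ _) (*-identityˡ _) ⟩
      σ x + σ y                ∎

    B-additive : ∀ {κ μ} → Independent κ μ → ∀ x → B (κ + μ) x ≈ B κ x + B μ x
    B-additive {κ} {μ} ind x = injective (begin
      g (B (κ + μ) x)             ≈⟨ g∘B _ x ⟩
      σ (κ + μ) * g x             ≈⟨ *-congʳ (σ-additive ind) ⟩
      (σ κ + σ μ) * g x           ≈⟨ distribʳ _ _ _ ⟩
      σ κ * g x + σ μ * g x       ≈⟨ +-cong (g∘B κ x) (g∘B μ x) ⟨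
      g (B κ x) + g (B μ x)       ≈⟨ +-homo _ _ ⟨
      g (B κ x + B μ x)           ∎)

-- The slope family with the roles of a and b exchanged.

module SwappedFamily
         {q n} {F : FiniteField q c ℓ} {K : FiniteField (q ℕ.^ n) c′ ℓ′}
         (n-prime : Prime n) (3≤q : 3 ≤ q) (ι : Extension F K) where
  private
    2≤q : 2 ≤ q
    2≤q = ℕ.≤-trans (ℕ.n≤1+n 2) 3≤q
  open FiniteFieldProperties K
  open LinearMaps {n = n} {F = F} {K = K} n-prime 2≤q ι
  open SlopeFamilies {n = n} {F = F} {K = K} n-prime 3≤q ι
  open RingHomomorphism ι using (⟦_⟧)
  open ≈-Reasoning setoid

  open AffineCollineation {n = n} {F = F} {K = K} n-prime 3≤q ι

  *-isLinear : ∀ a → IsLinear (a *_)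
  *-isLinear a = record
    { cong   = *-congˡ
    ; +-homo = distribˡ a
    ; *-homo = λ t x → solve 3 (λ a t x → a :* (t :* x) := t :* (a :* x)) refl a ⟦ t ⟧ x
    }

  module Swap {B g} (family : IsSlopeFamily B g)
              (separated : ∀ {κ μ x} → κ ≉ 0# → μ ≉ 0# → κ ≉ μ → B κ (μ * x) ≈ B μ (κ * x) → x ≈ 0#) where
    open IsSlopeFamily family

    -- With y = κ x the graph of slope κ becomes {(κ⁻¹ y , y , B κ (κ⁻¹ y))}. Exchanging the first
    -- two coordinates thus yields slope κ⁻¹ with the map B⁻ (κ⁻¹). Slope 1 is fixed, so the exempt
    -- slope remains the same.
    B⁻ : Carrier → Carrier → Carrier
    B⁻ κ x = B (κ ⁻¹) (κ * x)

    B⁻-0 : ∀ {κ} → κ ≈ 0# → ∀ x → B⁻ κ x ≈ 0#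
    B⁻-0 κ≈0 x = B-0-homo _ (trans (*-congʳ κ≈0) (zeroˡ x))

    B⁻-injective : ∀ {κ x} → κ ≉ 0# → B⁻ κ x ≈ 0# → x ≈ 0#
    B⁻-injective κ≉0 eq = x*y≈0⇒y≈0 κ≉0 (B-separated (x⁻¹≉0 κ≉0) (trans eq (sym (B-0 _))))

    private
      0-base = base 0≉1

    -- `H a`, the graph of slope 0, takes over the role of `H b`, so the new coordinate is the one
    -- attached to base 0.
    g⁻ : Carrier → Carrier
    g⁻ = proj₁ 0-base

    g⁻-bijective : IsBijectiveLinear g⁻
    g⁻-bijective = proj₁ (proj₂ (proj₂ 0-base))

    private
      module G = IsBijectiveLinear g⁻-bijective
      g′ = proj₁ (proj₂ 0-base)
      module G′ = IsLinear (proj₁ (proj₂ (proj₂ (proj₂ 0-base))))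

      g⁻∘B : ∀ {κ} → κ ≉ 0# → ∃ λ t → ∀ x → g⁻ (B κ x) ≈ t * g′ (κ * x)
      g⁻∘B {κ} κ≉0 = let t , eq = proj₂ (proj₂ (proj₂ (proj₂ 0-base))) κ≉0 in t , λ x → begin
        g⁻ (B κ x)            ≈⟨ G.cong (trans (+-congˡ (-‿cong (B-0 x))) (x-0≈x (B κ x))) ⟨
        g⁻ (B κ x - B 0# x)   ≈⟨ eq x ⟩
        t * g′ ((κ - 0#) * x) ≈⟨ *-congˡ (G′.cong (*-congʳ (x-0≈x κ))) ⟩
        t * g′ (κ * x)        ∎

      g⁻≈ : ∀ x → g⁻ x ≈ proj₁ (g⁻∘B 1≉0) * g′ x
      g⁻≈ x = begin
        g⁻ x                                ≈⟨ G.cong (B-1 x) ⟨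
        g⁻ (B 1# x)                         ≈⟨ proj₂ (g⁻∘B 1≉0) x ⟩
        proj₁ (g⁻∘B 1≉0) * g′ (1# * x)      ≈⟨ *-congˡ (G′.cong (*-identityˡ x)) ⟩
        proj₁ (g⁻∘B 1≉0) * g′ x             ∎

      t₁≉0 : proj₁ (g⁻∘B 1≉0) ≉ 0#
      t₁≉0 t≈0 = 1≉0 (G.kernel (trans (g⁻≈ 1#) (trans (*-congʳ t≈0) (zeroˡ _))))

      -- In base 0 the map `B (κ ⁻¹)` applied to κ x only sees κ⁻¹ (κ x) = x through `g′`, and slope
      -- 1 shows that `g′` is `g⁻` up to a constant.
      slope⁻ : ∀ κ → ∃ λ s → ∀ x → g⁻ (B⁻ κ x) ≈ s * g⁻ x
      slope⁻ κ with κ ≟ 0#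
      ... | yes κ≈0 = 0# , λ x → trans (G.0-homo (B⁻-0 κ≈0 x)) (sym (zeroˡ _))
      ... | no  κ≉0 = let t , eq = g⁻∘B (x⁻¹≉0 κ≉0) ; t₁ = proj₁ (g⁻∘B 1≉0) in
        t * t₁ ⁻¹ , λ x → begin
          g⁻ (B⁻ κ x)                 ≈⟨ eq (κ * x) ⟩
          t * g′ (κ ⁻¹ * (κ * x))     ≈⟨ *-congˡ (G′.cong (x⁻¹*[x*y]≈y x κ≉0)) ⟩
          t * g′ x                    ≈⟨ *-congˡ (x⁻¹*[x*y]≈y _ t₁≉0) ⟨
          t * (t₁ ⁻¹ * (t₁ * g′ x))   ≈⟨ *-congˡ (*-congˡ (g⁻≈ x)) ⟨
          t * (t₁ ⁻¹ * g⁻ x)          ≈⟨ *-assoc _ _ _ ⟨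
          (t * t₁ ⁻¹) * g⁻ x          ∎

      module NonzeroBase {a} (a≉0 : a ≉ 0#) (a≉1 : a ≉ 1#) where
        a⁻¹≉1 : a ⁻¹ ≉ 1#
        a⁻¹≉1 eq = a≉1 (trans (sym (⁻¹-involutive a)) (trans (⁻¹-cong eq) 1⁻¹≈1))

        h h′ : Carrier → Carrier
        h  = proj₁ (base a⁻¹≉1)
        h′ = proj₁ (proj₂ (base a⁻¹≉1))

        h-bijective : IsBijectiveLinear h
        h-bijective = proj₁ (proj₂ (proj₂ (base a⁻¹≉1)))

        h′-linear : IsLinear h′
        h′-linear = proj₁ (proj₂ (proj₂ (proj₂ (base a⁻¹≉1))))

        module H = IsBijectiveLinear h-bijective
        module H′ = IsLinear h′-linear

        h∘Δ : ∀ {κ} → κ ≉ a ⁻¹ → ∃ λ t → ∀ x → h (B κ x - B (a ⁻¹) x) ≈ t * h′ ((κ - a ⁻¹) * x)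
        h∘Δ = proj₂ (proj₂ (proj₂ (proj₂ (base a⁻¹≉1))))

        0≉a⁻¹ : 0# ≉ a ⁻¹
        0≉a⁻¹ eq = x⁻¹≉0 a≉0 (sym eq)

        t₀ : Carrier
        t₀ = proj₁ (h∘Δ 0≉a⁻¹)

        -- `B 0#` vanishes, so comparing slope 0 with the base a⁻¹ describes `B (a ⁻¹)` itself; it
        -- is applied to κ x - a x.
        second : ∀ κ x → h (B (a ⁻¹) (κ * x) - B⁻ a x) ≈ t₀ * h′ (a ⁻¹ * ((κ - a) * x))
        second κ x = begin
          h (B (a ⁻¹) (κ * x) - B (a ⁻¹) (a * x))   ≈⟨ H.cong (B-‿hom _ _ _) ⟨
          h (B (a ⁻¹) (κ * x - a * x))
            ≈⟨ H.cong (solve 2 (λ u v → u := con (ℤ.+ 0) :- (con (ℤ.+ 0) :- u)) refl (B (a ⁻¹) (κ * x - a * x)) 0#) ⟩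
          h (0# - (0# - B (a ⁻¹) (κ * x - a * x)))
            ≈⟨ H.-‿hom _ _ ⟩
          h 0# - h (0# - B (a ⁻¹) (κ * x - a * x))
            ≈⟨ +-cong (H.0-homo refl) (-‿cong (H.cong (+-congʳ (sym (B-0 _))))) ⟩
          0# - h (B 0# (κ * x - a * x) - B (a ⁻¹) (κ * x - a * x))
            ≈⟨ +-congˡ (-‿cong (proj₂ (h∘Δ 0≉a⁻¹) (κ * x - a * x))) ⟩
          0# - t₀ * h′ ((0# - a ⁻¹) * (κ * x - a * x))
            ≈⟨ +-congˡ (-‿cong (*-congˡ (H′.cong (solve 4 (λ b κ a x →
                 (con (ℤ.+ 0) :- b) :* (κ :* x :- a :* x) := con (ℤ.+ 0) :- b :* ((κ :- a) :* x)) refl (a ⁻¹) κ a x)))) ⟩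
          0# - t₀ * h′ (0# - a ⁻¹ * ((κ - a) * x))
            ≈⟨ +-congˡ (-‿cong (*-congˡ (trans (H′.-‿hom _ _) (+-congʳ (H′.0-homo refl))))) ⟩
          0# - t₀ * (0# - h′ (a ⁻¹ * ((κ - a) * x)))
            ≈⟨ solve 2 (λ t y → con (ℤ.+ 0) :- t :* (con (ℤ.+ 0) :- y) := t :* y) refl t₀ (h′ (a ⁻¹ * ((κ - a) * x))) ⟩
          t₀ * h′ (a ⁻¹ * ((κ - a) * x))            ∎

        -- This is `base` at a⁻¹ for the slope κ⁻¹ and the vector κ x, because (κ⁻¹ - a⁻¹) κ x = -
        -- a⁻¹ (κ - a) x. That identity fails at κ = 0, where however both terms on the left vanish
        -- and the multiplier 0 does.
        first : ∀ {κ} → κ ≉ a → Dec (κ ≈ 0#) → ∃ λ t → ∀ x →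
                h (B⁻ κ x - B (a ⁻¹) (κ * x)) ≈ - (t * h′ (a ⁻¹ * ((κ - a) * x)))
        first {κ} κ≉a (yes κ≈0) = 0# , λ x → trans (H.0-homo (x≈y⇒x-y≈0 (trans (B⁻-0 κ≈0 x)
          (sym (B-0-homo _ (trans (*-congʳ κ≈0) (zeroˡ x)))))))
          (solve 1 (λ y → con (ℤ.+ 0) := :- (con (ℤ.+ 0) :* y)) refl (h′ (a ⁻¹ * ((κ - a) * x))))
        first {κ} κ≉a (no  κ≉0) = let t , eq = h∘Δ κ⁻¹≉a⁻¹ in t , λ x → begin
          h (B (κ ⁻¹) (κ * x) - B (a ⁻¹) (κ * x))     ≈⟨ eq (κ * x) ⟩
          t * h′ ((κ ⁻¹ - a ⁻¹) * (κ * x))            ≈⟨ *-congˡ (H′.cong (begin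
            (κ ⁻¹ - a ⁻¹) * (κ * x)
              ≈⟨ solve 4 (λ m b κ x → (m :- b) :* (κ :* x) := m :* (κ :* x) :- b :* (κ :* x)) refl (κ ⁻¹) (a ⁻¹) κ x ⟩
            κ ⁻¹ * (κ * x) - a ⁻¹ * (κ * x)
              ≈⟨ +-congʳ (trans (x⁻¹*[x*y]≈y x κ≉0) (sym (x⁻¹*[x*y]≈y x a≉0))) ⟩
            a ⁻¹ * (a * x) - a ⁻¹ * (κ * x)
              ≈⟨ solve 4 (λ b a κ x → b :* (a :* x) :- b :* (κ :* x) := con (ℤ.+ 0) :- b :* ((κ :- a) :* x)) refl (a ⁻¹) a κ x ⟩
            0# - a ⁻¹ * ((κ - a) * x)                 ∎)) ⟩
          t * h′ (0# - a ⁻¹ * ((κ - a) * x))          ≈⟨ *-congˡ (trans (H′.-‿hom _ _) (+-congʳ (H′.0-homo refl))) ⟩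
          t * (0# - h′ (a ⁻¹ * ((κ - a) * x)))
            ≈⟨ solve 2 (λ t y → t :* (con (ℤ.+ 0) :- y) := :- (t :* y)) refl t (h′ (a ⁻¹ * ((κ - a) * x))) ⟩
          - (t * h′ (a ⁻¹ * ((κ - a) * x)))           ∎
          where
          κ⁻¹≉a⁻¹ : κ ⁻¹ ≉ a ⁻¹
          κ⁻¹≉a⁻¹ eq = κ≉a (trans (sym (⁻¹-involutive κ)) (trans (⁻¹-cong eq) (⁻¹-involutive a)))

        -- Inserting B (a⁻¹) (κ x) splits the difference into a change of slope at a fixed vector
        -- and a change of vector at a fixed slope. Both are constants times the same value of `h′`.
        slope-at : ∀ {κ} → κ ≉ a → ∃ λ t → ∀ x →
                   h (B⁻ κ x - B⁻ a x) ≈ t * h′ (a ⁻¹ * ((κ - a) * x))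
        slope-at {κ} κ≉a = let s , eq = first κ≉a (κ ≟ 0#) in t₀ - s , λ x → begin
          h (B⁻ κ x - B⁻ a x)
            ≈⟨ H.cong (solve 3 (λ u v w → u :- w := (v :- w) :+ (u :- v)) refl
                 (B⁻ κ x) (B (a ⁻¹) (κ * x)) (B⁻ a x)) ⟩
          h ((B (a ⁻¹) (κ * x) - B⁻ a x) + (B⁻ κ x - B (a ⁻¹) (κ * x)))   ≈⟨ H.+-homo _ _ ⟩
          h (B (a ⁻¹) (κ * x) - B⁻ a x) + h (B⁻ κ x - B (a ⁻¹) (κ * x))
            ≈⟨ +-cong (second κ x) (eq x) ⟩
          t₀ * h′ (a ⁻¹ * ((κ - a) * x)) + - (s * h′ (a ⁻¹ * ((κ - a) * x)))
            ≈⟨ solve 3 (λ s t y → s :* y :+ (:- (t :* y)) := (s :- t) :* y) refl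
                 t₀ s (h′ (a ⁻¹ * ((κ - a) * x))) ⟩
          (t₀ - s) * h′ (a ⁻¹ * ((κ - a) * x))    ∎

      -- Base 0 of the exchanged family is the former `H b`, whose coordinate is `g`; a nonzero base
      -- a is the former base a⁻¹.
      base⁻ : ∀ {a} → Dec (a ≈ 0#) → a ≉ 1# → ∃ λ h → ∃ λ h′ → IsBijectiveLinear h × IsLinear h′ ×
              (∀ {κ} → κ ≉ a → ∃ λ t → ∀ x → h (B⁻ κ x - B⁻ a x) ≈ t * h′ ((κ - a) * x))
      base⁻ {a} (yes a≈0) a≉1 = g , g , bijective , isLinear , λ {κ} _ → σ (κ ⁻¹) , λ x → begin
        g (B⁻ κ x - B⁻ a x)         ≈⟨ cong (trans (+-congˡ (-‿cong (B⁻-0 a≈0 x))) (x-0≈x (B⁻ κ x))) ⟩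
        g (B⁻ κ x)                  ≈⟨ g∘B _ _ ⟩
        σ (κ ⁻¹) * g (κ * x)        ≈⟨ *-congˡ (cong (*-congʳ (trans (+-congˡ (-‿cong a≈0)) (x-0≈x κ)))) ⟨
        σ (κ ⁻¹) * g ((κ - a) * x)  ∎
      base⁻ {a} (no a≉0) a≉1 =
        h , h′ ∘ (a ⁻¹ *_) , h-bijective , ∘-isLinear h′-linear (*-isLinear (a ⁻¹)) , slope-at
        where open NonzeroBase a≉0 a≉1

      separated⁻ : ∀ {κ μ x} → κ ≉ μ → B⁻ κ x ≈ B⁻ μ x → x ≈ 0#
      separated⁻ {κ} {μ} {x} κ≉μ eq with κ ≟ 0# | μ ≟ 0#
      ... | yes κ≈0 | yes μ≈0 = contradiction (trans κ≈0 (sym μ≈0)) κ≉μ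
      ... | yes κ≈0 | no  μ≉0 = B⁻-injective μ≉0 (trans (sym eq) (B⁻-0 κ≈0 x))
      ... | no  κ≉0 | yes μ≈0 = B⁻-injective κ≉0 (trans eq (B⁻-0 μ≈0 x))
      -- `separated` is applied to the slopes κ⁻¹ and μ⁻¹ and the vector μ κ x, where its two sides
      -- become `B⁻ κ x` and `B⁻ μ x`.
      ... | no  κ≉0 | no  μ≉0 = x*y≈0⇒y≈0 κ≉0 (x*y≈0⇒y≈0 μ≉0 (separated (x⁻¹≉0 κ≉0) (x⁻¹≉0 μ≉0) κ⁻¹≉μ⁻¹ (begin
        B (κ ⁻¹) (μ ⁻¹ * (μ * (κ * x)))     ≈⟨ B-cong refl (x⁻¹*[x*y]≈y _ μ≉0) ⟩
        B⁻ κ x                              ≈⟨ eq ⟩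
        B⁻ μ x                              ≈⟨ B-cong refl (x⁻¹*[x*y]≈y _ κ≉0) ⟨
        B (μ ⁻¹) (κ ⁻¹ * (κ * (μ * x)))
          ≈⟨ B-cong refl (*-congˡ (solve 3 (λ κ μ x → κ :* (μ :* x) := μ :* (κ :* x)) refl κ μ x)) ⟩
        B (μ ⁻¹) (κ ⁻¹ * (μ * (κ * x)))     ∎)))
        where
        κ⁻¹≉μ⁻¹ : κ ⁻¹ ≉ μ ⁻¹
        κ⁻¹≉μ⁻¹ eq = κ≉μ (trans (sym (⁻¹-involutive κ)) (trans (⁻¹-cong eq) (⁻¹-involutive μ)))

    swapped : IsSlopeFamily B⁻ g⁻
    swapped = record
      { B-cong      = λ κ≈μ x≈y → B-cong (⁻¹-cong κ≈μ) (*-cong κ≈μ x≈y)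
      ; B-0         = B⁻-0 refl
      ; B-1         = λ x → trans (B-cong 1⁻¹≈1 (*-identityˡ x)) (B-1 x)
      ; B-separated = separated⁻
      ; bijective   = g⁻-bijective
      ; slope       = slope⁻
      ; base        = λ {a} → base⁻ (a ≟ 0#)
      }

    -- If g⁻ is stabilised by K, then every B κ is a multiplication, and then g is.
    swapped-stable⇒stable : (∀ k → Stabilises g⁻ k) → ∀ k → Stabilises g k
    swapped-stable⇒stable S k = σ (proj₁ κ) , λ x → begin
      g (k * x)                   ≈⟨ cong (*-congʳ (proj₂ κ)) ⟨
      g (proj₁ (B-mult (proj₁ κ)) * x)   ≈⟨ cong (proj₂ (B-mult (proj₁ κ)) x) ⟨
      g (B (proj₁ κ) x)           ≈⟨ g∘B _ x ⟩
      σ (proj₁ κ) * g x           ∎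
      where
      B-mult : ∀ κ → ∃ λ k → ∀ x → B κ x ≈ k * x
      B-mult κ with κ ≟ 0#
      ... | yes κ≈0 = 0# , λ x → trans (B-cong κ≈0 refl) (trans (B-0 x) (sym (zeroˡ x)))
      ... | no  κ≉0 = let s , eq = slope⁻ (κ ⁻¹)
                          k , eq′ = stabilises-all⇒multiplier-surjective g⁻-bijective S s
        in k * κ , λ x → begin
          B κ x                        ≈⟨ B-cong (⁻¹-involutive κ) (x⁻¹*[x*y]≈y x κ≉0) ⟨
          B⁻ (κ ⁻¹) (κ * x)            ≈⟨ G.injective (trans (eq _) (sym (eq′ _))) ⟩
          k * (κ * x)                  ≈⟨ *-assoc k κ x ⟨
          (k * κ) * x                  ∎
      -- Distinct slopes have distinct multipliers by `B-separated`, so by finiteness each k is the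
      -- multiplier of some `B κ`.
      κ : ∃ λ κ → proj₁ (B-mult κ) ≈ k
      κ = injection⇒surjection (proj₁ ∘ B-mult) (λ {κ} {μ} eq → decidable-stable (κ ≟ μ) λ κ≉μ →
        1≉0 (B-separated κ≉μ (trans (proj₂ (B-mult κ) 1#) (trans (*-congʳ eq) (sym (proj₂ (B-mult μ) 1#)))))) k

-- Stability of g from additivity at slopes and at inverse slopes.

module StableSlopes
         {q n} {F : FiniteField q c ℓ} {K : FiniteField (q ℕ.^ n) c′ ℓ′}
         (n-prime : Prime n) (3≤q : 3 ≤ q) (ι : Extension F K) where
  private
    2≤q : 2 ≤ q
    2≤q = ℕ.≤-trans (ℕ.n≤1+n 2) 3≤q
  open FiniteFieldProperties K
  open FieldCounting K
  open ExtensionProperties {n = n} {F = F} {K = K} 2≤q ι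
  open LinearMaps {n = n} {F = F} {K = K} n-prime 2≤q ι
  open SlopeFamilies {n = n} {F = F} {K = K} n-prime 3≤q ι
  open ≈-Reasoning setoid
  open IsSubfield InF-isSubfield using (1∈; 0∈; -∈; +∈; *∈; ⁻¹∈)

  open AffineCollineation {n = n} {F = F} {K = K} n-prime 3≤q ι

  open SwappedFamily {n = n} {F = F} {K = K} n-prime 3≤q ι

  -- For A outside F, additivity of B at (A², A) and (A, 1) and additivity of B⁻ at
  -- 1/A = (1/A - 1/(A + 1)) + 1/(A + 1), where 1/A - 1/(A + 1) = 1/(A² + A),
  -- force B (A²) = - A, so that A stabilises g.
  slopeFamily⇒stable : 2 ≤ n → ∀ {B g} → IsSlopeFamily B g →
    (∀ {κ μ x} → κ ≉ 0# → μ ≉ 0# → κ ≉ μ → B κ (μ * x) ≈ B μ (κ * x) → x ≈ 0#) →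
    ∀ k → Stabilises g k
  slopeFamily⇒stable 2≤n {B} {g} family separated =
    -- If `A` did not stabilise `g`, both families would be additive, and additivity makes `A`
    -- stabilise `g`. So an element outside F does, and with it all of `K`.
    stabilises-all bijective (decidable-stable (stabilises? bijective A) λ A-unstable →
      A-unstable (A-stable λ S → A-unstable (S A))) A∉F
    where
    open IsSlopeFamily family
    open Swap family separated
    A : Carrier
    A = proj₁ (∃∉F 2≤n)
    A∉F : ¬ InF A
    A∉F = proj₂ (∃∉F 2≤n)
    independent-1 : ∀ {x} → ¬ InF x → Independent x 1#
    independent-1 {x} x∉F {a} {b} a∈F b∈F eq = a≈0 , (begin
      b                     ≈⟨ solve 3 (λ a b x → b := (a :* x :+ b :* con (ℤ.+ 1)) :- a :* x) refl a b x ⟩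
      (a * x + b * 1#) - a * x   ≈⟨ +-cong eq (-‿cong (*-congʳ a≈0)) ⟩
      0# - 0# * x           ≈⟨ solve 1 (λ x → con (ℤ.+ 0) :- con (ℤ.+ 0) :* x := con (ℤ.+ 0)) refl x ⟩
      0#                    ∎)
      where
      a≈0 : a ≈ 0#
      a≈0 = decidable-stable (a ≟ 0#) λ a≉0 → x∉F (InF-resp (begin
        a ⁻¹ * (- b)                 ≈⟨ *-congˡ (begin
          - b                          ≈⟨ solve 3 (λ a b x → :- b := a :* x :- (a :* x :+ b :* con (ℤ.+ 1))) refl a b x ⟩
          a * x - (a * x + b * 1#)     ≈⟨ +-congˡ (-‿cong eq) ⟩
          a * x - 0#                   ≈⟨ x-0≈x (a * x) ⟩
          a * x                        ∎) ⟩
        a ⁻¹ * (a * x)               ≈⟨ x⁻¹*[x*y]≈y x a≉0 ⟩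
        x                            ∎) (*∈ (⁻¹∈ a≉0 a∈F) (-∈ b∈F)))
    independent-scale : ∀ {x y} z → z ≉ 0# → Independent x y → Independent (z * x) (z * y)
    independent-scale {x} {y} z z≉0 ind {a} {b} a∈F b∈F eq = ind a∈F b∈F (x*y≈0⇒y≈0 z≉0
      (trans (solve 5 (λ z a x b y → z :* (a :* x :+ b :* y) := a :* (z :* x) :+ b :* (z :* y)) refl z a x b y) eq))
    A≉0 : A ≉ 0#
    A≉0 A≈0 = A∉F (InF-resp (sym A≈0) 0∈)
    A+1≉0 : A + 1# ≉ 0#
    A+1≉0 eq = A∉F (InF-resp (begin
      0# + - 1#         ≈⟨ +-congʳ eq ⟨
      (A + 1#) + - 1#   ≈⟨ solve 1 (λ a → (a :+ con (ℤ.+ 1)) :+ (:- con (ℤ.+ 1)) := a) refl A ⟩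
      A                 ∎) (+∈ 0∈ (-∈ 1∈)))
    P = A ⁻¹
    R = (A + 1#) ⁻¹
    A*P≈1 : A * P ≈ 1#
    A*P≈1 = ⁻¹-inverseʳ A≉0
    [A+1]*R≈1 : (A + 1#) * R ≈ 1#
    [A+1]*R≈1 = ⁻¹-inverseʳ A+1≉0
    [A²+A]*PR≈1 : (A * A + A) * (P * R) ≈ 1#
    [A²+A]*PR≈1 = begin
      (A * A + A) * (P * R)
        ≈⟨ solve 3 (λ a p r → (a :* a :+ a) :* (p :* r) := (a :* p) :* ((a :+ con (ℤ.+ 1)) :* r)) refl A P R ⟩
      (A * P) * ((A + 1#) * R)   ≈⟨ *-cong A*P≈1 [A+1]*R≈1 ⟩
      1# * 1#                    ≈⟨ *-identityˡ 1# ⟩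
      1#                         ∎
    P≈PR+R : P ≈ P * R + R
    P≈PR+R = begin
      P                          ≈⟨ *-identityʳ P ⟨
      P * 1#                     ≈⟨ *-congˡ [A+1]*R≈1 ⟨
      P * ((A + 1#) * R)
        ≈⟨ solve 3 (λ a p r → p :* ((a :+ con (ℤ.+ 1)) :* r) := p :* r :+ (a :* p) :* r) refl A P R ⟩
      P * R + (A * P) * R        ≈⟨ +-congˡ (trans (*-congʳ A*P≈1) (*-identityˡ R)) ⟩
      P * R + R                  ∎
    P∉F : ¬ InF P
    P∉F P∈F = A∉F (InF-resp (⁻¹-involutive A) (⁻¹∈ (x⁻¹≉0 A≉0) P∈F))
    independent-PR,R : Independent (P * R) R
    independent-PR,R a∈F b∈F eq = independent-scale R (x⁻¹≉0 A+1≉0) (independent-1 P∉F) a∈F b∈F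
      (trans (+-cong (*-congˡ (*-comm _ _)) (*-congˡ (*-identityʳ _))) eq)
    independent-A²,A : Independent (A * A) A
    independent-A²,A a∈F b∈F eq = independent-scale A A≉0 (independent-1 A∉F) a∈F b∈F
      (trans (+-congˡ (*-congˡ (*-identityʳ _))) eq)
    A-stable : ¬ (∀ k → Stabilises g k) → Stabilises g A
    A-stable ¬stable = - σ (A * A) , λ x → begin
      g (A * x)
        ≈⟨ cong (solve 2 (λ y z → y := con (ℤ.+ 0) :- (con (ℤ.+ 0) :- y)) refl (A * x) 0#) ⟩
      g (0# - (0# - A * x))          ≈⟨ cong (+-congˡ (-‿cong (B-A² x))) ⟨
      g (0# - B (A * A) x)           ≈⟨ -‿hom _ _ ⟩
      g 0# - g (B (A * A) x)         ≈⟨ +-cong (0-homo refl) (-‿cong (g∘B _ x)) ⟩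
      0# - σ (A * A) * g x
        ≈⟨ solve 2 (λ s y → con (ℤ.+ 0) :- s :* y := (:- s) :* y) refl (σ (A * A)) (g x) ⟩
      - σ (A * A) * g x              ∎
      where
      open Additivity family ¬stable using (B-additive)
      open Additivity swapped (λ S → ¬stable (swapped-stable⇒stable S)) using () renaming (B-additive to B⁻-additive)
      -- Additivity of `B⁻` at 1/A = 1/(A² + A) + 1/(A + 1), evaluated at (A² + A) x so that every
      -- denominator cancels.
      key : ∀ x → B A ((A + 1#) * x) ≈ B (A * A + A) x + B (A + 1#) (A * x)
      key x = begin
        B A ((A + 1#) * x)             ≈⟨ B-cong (sym (⁻¹-involutive A)) (begin
          (A + 1#) * x                   ≈⟨ *-identityˡ _ ⟨
          1# * ((A + 1#) * x)            ≈⟨ *-congʳ A*P≈1 ⟨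
          (A * P) * ((A + 1#) * x)
            ≈⟨ solve 3 (λ a p x → (a :* p) :* ((a :+ con (ℤ.+ 1)) :* x) := p :* ((a :* a :+ a) :* x)) refl A P x ⟩
          P * y                          ∎) ⟩
        B⁻ P y                         ≈⟨ IsSlopeFamily.B-cong swapped P≈PR+R refl ⟩
        B⁻ (P * R + R) y               ≈⟨ B⁻-additive independent-PR,R y ⟩
        B⁻ (P * R) y + B⁻ R y          ≈⟨ +-cong
          (B-cong (⁻¹-unique (trans (*-comm _ _) [A²+A]*PR≈1)) (begin
            (P * R) * ((A * A + A) * x)  ≈⟨ *-assoc _ _ _ ⟨
            ((P * R) * (A * A + A)) * x  ≈⟨ *-congʳ (trans (*-comm _ _) [A²+A]*PR≈1) ⟩
            1# * x                       ≈⟨ *-identityˡ x ⟩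
            x                            ∎))
          (B-cong (⁻¹-involutive (A + 1#)) (begin
            R * ((A * A + A) * x)
              ≈⟨ solve 3 (λ a r x → r :* ((a :* a :+ a) :* x) := ((a :+ con (ℤ.+ 1)) :* r) :* (a :* x)) refl A R x ⟩
            ((A + 1#) * R) * (A * x)     ≈⟨ *-congʳ [A+1]*R≈1 ⟩
            1# * (A * x)                 ≈⟨ *-identityˡ _ ⟩
            A * x                        ∎)) ⟩
        B (A * A + A) x + B (A + 1#) (A * x)   ∎
        where
        y : Carrier
        y = (A * A + A) * x
      -- In `key` the slopes A² + A and A + 1 split by additivity in the slope, and the argument (A
      -- + 1) x by additivity of `B A`. The terms B A (A x) and B A x cancel, leaving B (A²) x + A x
      -- = 0.
      B-A² : ∀ x → B (A * A) x ≈ 0# - A * x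
      B-A² x = begin
        B (A * A) x
          ≈⟨ solve 4 (λ u v w z → u := ((u :+ v) :+ (w :+ z)) :- ((w :+ v) :+ z)) refl
               (B (A * A) x) (B A x) (B A (A * x)) (A * x) ⟩
        ((B (A * A) x + B A x) + (B A (A * x) + A * x)) - ((B A (A * x) + B A x) + A * x)
          ≈⟨ +-congʳ (+-cong (B-additive independent-A²,A x)
               (trans (B-additive (independent-1 A∉F) (A * x)) (+-congˡ (B-1 (A * x))))) ⟨
        (B (A * A + A) x + B (A + 1#) (A * x)) - ((B A (A * x) + B A x) + A * x)
          ≈⟨ +-congʳ (key x) ⟨
        B A ((A + 1#) * x) - ((B A (A * x) + B A x) + A * x)
          ≈⟨ +-congʳ (trans (B-cong refl (trans (distribʳ x A 1#) (+-congˡ (*-identityˡ x)))) (B-+-homo A _ _)) ⟩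
        (B A (A * x) + B A x) - ((B A (A * x) + B A x) + A * x)
          ≈⟨ solve 2 (λ u z → u :- (u :+ z) := con (ℤ.+ 0) :- z) refl (B A (A * x) + B A x) (A * x) ⟩
        0# - A * x                     ∎

-- Points spanned by vectors, and F-linear maps between V and K.

module PointOf {q} (K : FiniteField q c ℓ) {r : ℕ} where
  open FiniteFieldProperties K

  pointOf : (w : Fin r → Carrier) → (∃ λ i → w i ≉ 0#) → Point (ring ^ᵛ r) (c ⊔ ℓ)
  pointOf w (i , wi≉0) = record
    { subspace = record
      { member    = λ x → ∃ λ α → ∀ i → x i ≈ α * w i
      ; resp      = λ x≈y (α , eq) → α , λ i → trans (sym (x≈y i)) (eq i)
      ; 0ᴹ-closed = 0# , λ i → sym (zeroˡ _)
      ; +ᴹ-closed = λ (α , eq) (β , eq′) → α + β , λ i → trans (+-cong (eq i) (eq′ i)) (sym (distribʳ _ _ _))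
      ; *ₗ-closed = λ t (α , eq) → t * α , λ i → trans (*-congˡ (eq i)) (sym (*-assoc _ _ _))
      }
    ; hasDimension = record
      { basis       = λ _ → w
      ; contained   = λ _ → 1# , λ i → sym (*-identityˡ _)
      ; independent = λ { a eq zero → x*y≈0⇒y≈0 wi≉0 (trans (*-comm _ _) (trans (sym (+-identityʳ _)) (eq i))) }
      ; spanning    = λ (α , eq) → (λ _ → α) , λ i → trans (eq i) (sym (+-identityʳ _))
      }
    }

module VectorSpace {q n} {F : FiniteField q c ℓ} {K : FiniteField (q ℕ.^ n) c′ ℓ′} (ι : Extension F K)
                   (V : LeftModule (FiniteField.ring F) v ℓv) where
  open FiniteFieldProperties K
  open LeftModule V public
    using (Carrierᴹ; _≈ᴹ_; _+ᴹ_; -ᴹ_; 0ᴹ; ≈ᴹ-refl; ≈ᴹ-sym; ≈ᴹ-trans; +ᴹ-cong; +ᴹ-congˡ; +ᴹ-congʳ; +ᴹ-comm;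
           +ᴹ-assoc; +ᴹ-identityˡ; +ᴹ-identityʳ; -ᴹ‿cong; -ᴹ‿inverseʳ; ≈ᴹ-setoid; *ₗ-distribˡ; *ₗ-congˡ;
           +ᴹ-commutativeMonoid; +ᴹ-abelianGroup; *ₗ-identityˡ; *ₗ-distribʳ; *ₗ-congʳ; *ₗ-zeroˡ)
    renaming (_*ₗ_ to _·_)
  open AbelianGroupProperties +ᴹ-abelianGroup public using ()
    renaming (⁻¹-∙-comm to -ᴹ-+ᴹ-comm; x∙y⁻¹≈ε⇒x≈y to x-y≈0⇒x≈ᴹy; x≈y⇒x∙y⁻¹≈ε to x≈y⇒x-y≈ᴹ0)
  open CommutativeSemigroupProperties (CommutativeMonoid.commutativeSemigroup +ᴹ-commutativeMonoid) public
    using (interchange)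
  open LeftModuleProperties V public using (inverseʳ-uniqueᴹ)
  open RingHomomorphism ι using (⟦_⟧; 0#-homo)
  private
    module F = FiniteField F

  infixl 6 _⊝_
  _⊝_ : Carrierᴹ → Carrierᴹ → Carrierᴹ
  x ⊝ y = x +ᴹ -ᴹ y

  x+[y-x]≈y : ∀ x y → x +ᴹ (y ⊝ x) ≈ᴹ y
  x+[y-x]≈y x y = begin
    x +ᴹ (y ⊝ x)          ≈⟨ +ᴹ-congˡ (+ᴹ-comm _ _) ⟩
    x +ᴹ (-ᴹ x +ᴹ y)      ≈⟨ +ᴹ-assoc _ _ _ ⟨
    (x ⊝ x) +ᴹ y          ≈⟨ +ᴹ-congʳ (-ᴹ‿inverseʳ x) ⟩
    0ᴹ +ᴹ y               ≈⟨ +ᴹ-identityˡ y ⟩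
    y                     ∎
    where open ≈-Reasoning ≈ᴹ-setoid

  ⊝-interchange : ∀ x y x′ y′ → (x +ᴹ y) ⊝ (x′ +ᴹ y′) ≈ᴹ (x ⊝ x′) +ᴹ (y ⊝ y′)
  ⊝-interchange x y x′ y′ = ≈ᴹ-trans (+ᴹ-congˡ (≈ᴹ-sym (-ᴹ-+ᴹ-comm x′ y′))) (interchange x y _ _)

  -1·x≈-x : ∀ x → (F.- F.1#) · x ≈ᴹ -ᴹ x
  -1·x≈-x x = inverseʳ-uniqueᴹ x _ (begin
    x +ᴹ (F.- F.1#) · x           ≈⟨ +ᴹ-congʳ (*ₗ-identityˡ x) ⟨
    F.1# · x +ᴹ (F.- F.1#) · x    ≈⟨ *ₗ-distribʳ x _ _ ⟨
    (F.1# F.- F.1#) · x           ≈⟨ *ₗ-congʳ (F.-‿inverseʳ F.1#) ⟩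
    F.0# · x                      ≈⟨ *ₗ-zeroˡ x ⟩
    0ᴹ                            ∎)
    where open ≈-Reasoning ≈ᴹ-setoid

  ⊝-closed : (W : Subspace V p) → ∀ {x y} → Subspace.member W x → Subspace.member W y → Subspace.member W (x ⊝ y)
  ⊝-closed W x∈W y∈W = W.+ᴹ-closed x∈W (W.resp (-1·x≈-x _) (W.*ₗ-closed (F.- F.1#) y∈W))
    where module W = Subspace W

  record IsForm (ψ : Carrierᴹ → Carrier) : Set (c ⊔ c′ ⊔ ℓ′ ⊔ v ⊔ ℓv) where
    field
      cong   : ∀ {x y} → x ≈ᴹ y → ψ x ≈ ψ y
      +-homo : ∀ x y → ψ (x +ᴹ y) ≈ ψ x + ψ y
      *-homo : ∀ t x → ψ (t · x) ≈ ⟦ t ⟧ * ψ x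

    ⊝-homo : ∀ x y → ψ (x ⊝ y) ≈ ψ x - ψ y
    ⊝-homo x y = begin
      ψ (x ⊝ y)                     ≈⟨ solve 2 (λ a b → a := (b :+ a) :- b) refl (ψ (x ⊝ y)) (ψ y) ⟩
      (ψ y + ψ (x ⊝ y)) - ψ y       ≈⟨ +-congʳ (+-homo _ _) ⟨
      ψ (y +ᴹ (x ⊝ y)) - ψ y        ≈⟨ +-congʳ (cong (x+[y-x]≈y y x)) ⟩
      ψ x - ψ y                     ∎
      where open ≈-Reasoning setoid

    0-homo : ∀ {x} → x ≈ᴹ 0ᴹ → ψ x ≈ 0#
    0-homo {x} x≈0 = trans (cong (≈ᴹ-trans x≈0 (≈ᴹ-sym (*ₗ-zeroˡ x))))
                           (trans (*-homo F.0# x) (trans (*-congʳ 0#-homo) (zeroˡ _)))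

  record IsLift (e : Carrier → Carrierᴹ) : Set (c ⊔ c′ ⊔ ℓ′ ⊔ v ⊔ ℓv) where
    field
      cong   : ∀ {x y} → x ≈ y → e x ≈ᴹ e y
      +-homo : ∀ x y → e (x + y) ≈ᴹ e x +ᴹ e y
      *-homo : ∀ t x → e (⟦ t ⟧ * x) ≈ᴹ t · e x

    0-homo : ∀ {x} → x ≈ 0# → e x ≈ᴹ 0ᴹ
    0-homo {x} x≈0 = begin
      e x                 ≈⟨ cong (trans x≈0 (trans (sym (zeroˡ x)) (*-congʳ (sym 0#-homo)))) ⟩
      e (⟦ F.0# ⟧ * x)    ≈⟨ *-homo F.0# x ⟩
      F.0# · e x          ≈⟨ *ₗ-zeroˡ _ ⟩
      0ᴹ                  ∎
      where open ≈-Reasoning ≈ᴹ-setoid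

    ⊝-homo : ∀ x y → e (x - y) ≈ᴹ e x ⊝ e y
    ⊝-homo x y = begin
      e (x - y)                     ≈⟨ x+[y-x]≈y (e y) _ ⟨
      e y +ᴹ (e (x - y) ⊝ e y)      ≈⟨ +ᴹ-assoc _ _ _ ⟨
      (e y +ᴹ e (x - y)) ⊝ e y      ≈⟨ +ᴹ-congʳ (+-homo _ _) ⟨
      e (y + (x - y)) ⊝ e y         ≈⟨ +ᴹ-congʳ (cong (solve 2 (λ x y → y :+ (x :- y) := x) refl x y)) ⟩
      e x ⊝ e y                     ∎
      where open ≈-Reasoning ≈ᴹ-setoid

-- Coordinates on the quotients, from the Desarguesian spreads.

module Projections {q n N} {F : FiniteField q c ℓ} {K : FiniteField (q ℕ.^ n) c′ ℓ′} (ι : Extension F K)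
                   {V : LeftModule (FiniteField.ring F) v ℓv} (H : Fin N → Subspace V p)
                   (disjoint : ∀ {k l m} → k ≢ l → k ≢ m → l ≢ m → Disjoint ⟨ H k , H l ⟩ (H m)) where
  open FiniteFieldProperties K
  open VectorSpace {n = n} {F = F} {K = K} ι V
  open RingHomomorphism ι using (⟦_⟧)

  infix 4 _∈H_
  _∈H_ : Carrierᴹ → Fin N → Set p
  x ∈H k = Subspace.member (H k) x

  ∈-resp : ∀ {k x y} → x ≈ᴹ y → x ∈H k → y ∈H k
  ∈-resp {k} = Subspace.resp (H k)

  ⊝∈ : ∀ {k x y} → x ∈H k → y ∈H k → x ⊝ y ∈H k
  ⊝∈ {k} = ⊝-closed (H k)

  disjoint⇒0 : ∀ {k l m x y z} → k ≢ l → k ≢ m → l ≢ m →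
               x ∈H k → y ∈H l → z ∈H m → z ≈ᴹ x +ᴹ y → z ≈ᴹ 0ᴹ
  disjoint⇒0 k≢l k≢m l≢m x∈ y∈ z∈ z≈x+y = disjoint k≢l k≢m l≢m (_ , _ , x∈ , y∈ , z≈x+y) z∈

  -- The projection from H k onto the plane K², with H l and H m mapped to the
  -- two axes; the slope of H m is ∞.
  record Projection (k l m : Fin N) : Set (c ⊔ ℓ ⊔ c′ ⊔ ℓ′ ⊔ v ⊔ ℓv ⊔ p) where
    field
      ψ₁ ψ₂    : Carrierᴹ → Carrier
      form₁    : IsForm ψ₁
      form₂    : IsForm ψ₂
      kernel   : ∀ {x} → ψ₁ x ≈ 0# → ψ₂ x ≈ 0# → x ∈H k
      vanishes : ∀ {x} → x ∈H k → (ψ₁ x ≈ 0#) × (ψ₂ x ≈ 0#)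

    HasSlope : Fin N → Carrier → Set (c′ ⊔ ℓ′ ⊔ v ⊔ p)
    HasSlope j κ = (∀ {x} → x ∈H j → ψ₂ x ≈ κ * ψ₁ x) × (∀ s → ∃ λ x → x ∈H j × ψ₁ x ≈ s)

    field
      horizontal : HasSlope l 0#
      vertical   : (∀ {x} → x ∈H m → ψ₁ x ≈ 0#) × (∀ s → ∃ λ x → x ∈H m × ψ₂ x ≈ s)
      slope      : ∀ {j} → j ≢ k → j ≢ m → ∃ (HasSlope j)
      ofSlope    : ∀ κ → ∃ λ j → j ≢ k × j ≢ m × HasSlope j κ

  record Direction (χ : Carrierᴹ → Fin 2 → Carrier) (k j : Fin N) (u : Fin 2 → Carrier) :
                   Set (c′ ⊔ ℓ′ ⊔ v ⊔ p) where
    field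
      j≢k     : j ≢ k
      nonzero : ¬ (∀ i → u i ≈ 0#)
      sound   : ∀ {x} → x ∈H j → ∃ λ α → ∀ i → χ x i ≈ α * u i
      onto    : ∀ α → ∃ λ x → x ∈H j × (∀ i → χ x i ≈ α * u i)

  -- Coordinates on the quotient by H k, identified with K².
  record Chart (k : Fin N) : Set (c ⊔ ℓ ⊔ c′ ⊔ ℓ′ ⊔ v ⊔ ℓv ⊔ p) where
    field
      χ        : Carrierᴹ → Fin 2 → Carrier
      χ-form   : ∀ i → IsForm (λ x → χ x i)
      kernel   : ∀ {x} → (∀ i → χ x i ≈ 0#) → x ∈H k
      vanishes : ∀ {x} → x ∈H k → ∀ i → χ x i ≈ 0#

    field
      directionOf : ∀ {j} → j ≢ k → ∃ (Direction χ k j)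
      ofDirection : ∀ {u} → (∃ λ i → u i ≉ 0#) → ∃ λ j → Direction χ k j u

  module FromSpread {k : Fin N} (φ : restrictScalars ι (FiniteField.ring K ^ᵛ 2) ≅ (V / H k))
         (spread : inducedSpread H k ≋ λ (P : Point (FiniteField.ring K ^ᵛ 2) (c′ ⊔ ℓ′)) →
                   fieldReduction ι φ (Point.subspace P)) where
    private
      infix 4 _∼_
      _∼_ : Carrierᴹ → Carrierᴹ → Set p
      x ∼ y = x ⊝ y ∈H k

      0∈ : 0ᴹ ∈H k
      0∈ = Subspace.0ᴹ-closed (H k)

      ∼-reflexive : ∀ {x y} → x ≈ᴹ y → x ∼ y
      ∼-reflexive x≈y = ∈-resp (≈ᴹ-sym (x≈y⇒x-y≈ᴹ0 x≈y)) 0∈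

      ∼-sym : ∀ {x y} → x ∼ y → y ∼ x
      ∼-sym {x} {y} = LeftModule.≈ᴹ-sym (V / H k) {x} {y}

      ∼-trans : ∀ {x y z} → x ∼ y → y ∼ z → x ∼ z
      ∼-trans {x} {y} {z} = LeftModule.≈ᴹ-trans (V / H k) {x} {y} {z}

      +-∼ : ∀ {x y x′ y′} → x ∼ x′ → y ∼ y′ → x +ᴹ y ∼ x′ +ᴹ y′
      +-∼ {x} {y} {x′} {y′} x∼ y∼ = ∈-resp (≈ᴹ-sym (⊝-interchange x y x′ y′)) (Subspace.+ᴹ-closed (H k) x∼ y∼)

      *-∼ : ∀ t {x y} → x ∼ y → t · x ∼ t · y
      *-∼ t {x} {y} x∼y = LeftModule.*ₗ-congˡ (V / H k) {t} {x} {y} x∼y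

      ∈⇒∼0 : ∀ {x} → x ∈H k → x ∼ 0ᴹ
      ∈⇒∼0 x∈ = ⊝∈ x∈ 0∈

      to : (Fin 2 → Carrier) → Carrierᴹ
      to = _≅_.to φ

      to-0 : to (λ _ → 0#) ∼ 0ᴹ
      to-0 = _≅_.0ᴹ-homo φ

      to-≈ : ∀ {u w} → (∀ i → u i ≈ w i) → to u ∼ to w
      to-≈ {u} {w} = _≅_.⟦⟧-cong φ {u} {w}

      injective : ∀ {u w} → to u ∼ to w → ∀ i → u i ≈ w i
      injective {u} {w} = _≅_.injective φ {u} {w}

      χ : Carrierᴹ → Fin 2 → Carrier
      χ x = proj₁ (_≅_.surjective φ x)

      to-χ : ∀ x → to (χ x) ∼ x
      to-χ x = proj₂ (_≅_.surjective φ x) (λ _ → refl)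

      χ-unique : ∀ {x w} → to w ∼ x → ∀ i → χ x i ≈ w i
      χ-unique {x} eq = injective (∼-trans (to-χ x) (∼-sym eq))

      χ-form : ∀ i → IsForm (λ x → χ x i)
      χ-form i = record
        { cong   = λ {x} {y} x≈y → χ-unique (∼-trans (to-χ y) (∼-reflexive (≈ᴹ-sym x≈y))) i
        ; +-homo = λ x y → χ-unique (∼-trans (_≅_.+ᴹ-homo φ (χ x) (χ y)) (+-∼ (to-χ x) (to-χ y))) i
        ; *-homo = λ t x → χ-unique (∼-trans (_≅_.*ₗ-homo φ t (χ x)) (*-∼ t (to-χ x))) i
        }

      χ-kernel : ∀ {x} → (∀ i → χ x i ≈ 0#) → x ∈H k
      χ-kernel {x} eq = ∈-resp (≈ᴹ-trans (+ᴹ-congˡ -0≈0) (+ᴹ-identityʳ x))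
        (∼-trans (∼-sym (to-χ x)) (∼-trans (to-≈ eq) to-0))
        where
        -0≈0 : -ᴹ 0ᴹ ≈ᴹ 0ᴹ
        -0≈0 = ≈ᴹ-trans (≈ᴹ-sym (+ᴹ-identityˡ _)) (-ᴹ‿inverseʳ 0ᴹ)

      χ-vanishes : ∀ {x} → x ∈H k → ∀ i → χ x i ≈ 0#
      χ-vanishes x∈ = χ-unique (∼-trans to-0 (∼-sym (∈⇒∼0 x∈)))

      Spans : Point (FiniteField.ring K ^ᵛ 2) (c′ ⊔ ℓ′) → (Fin 2 → Carrier) → Set (c′ ⊔ ℓ′)
      Spans P u = (∀ {w} → Subspace.member (Point.subspace P) w → ∃ λ α → ∀ i → w i ≈ α * u i) ×
                  (∀ α → Subspace.member (Point.subspace P) (λ i → α * u i))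

      SpreadElement : ∀ {j} → j ≢ k → Point (FiniteField.ring K ^ᵛ 2) (c′ ⊔ ℓ′) → Set (c′ ⊔ ℓ′ ⊔ v ⊔ ℓv ⊔ p)
      SpreadElement {j} j≢k P = Subspace.member (inducedSpread H k (j , j≢k)) ≐
                                Subspace.member (fieldReduction ι φ (Point.subspace P))

      -- A vector of `H j` represents its own class in the spread element, with zero component in
      -- `H k`.
      sound : ∀ {j} (j≢k : j ≢ k) P {u} → Spans P u → SpreadElement j≢k P →
              ∀ {x} → x ∈H j → ∃ λ α → ∀ i → χ x i ≈ α * u i
      sound j≢k P (P⊆ , _) (⊆P , _) {x} x∈j =
        let w , w∈P , x∼ = ⊆P (x , (0ᴹ , x , 0∈ , x∈j , ≈ᴹ-sym (+ᴹ-identityˡ x)) , ∼-reflexive ≈ᴹ-refl)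
            α , w≈ = P⊆ w∈P
        in α , λ i → trans (χ-unique (∼-sym x∼) i) (w≈ i)

      -- The spread element only provides a representative y + z in ⟨H k, H j⟩; its part y in `H k`
      -- is zero in the quotient and is dropped.
      onto : ∀ {j} (j≢k : j ≢ k) P {u} → Spans P u → SpreadElement j≢k P →
             ∀ α → ∃ λ x → x ∈H j × (∀ i → χ x i ≈ α * u i)
      onto j≢k P {u} (_ , ⊆P) (_ , P⊆) α =
        let x , (y , z , y∈k , z∈j , x≈) , eq = P⊆ ((λ i → α * u i) , ⊆P α , ∼-reflexive ≈ᴹ-refl)
        in z , z∈j , χ-unique (∼-trans eq (∼-trans (∼-reflexive x≈)
             (∼-trans (+-∼ (∈⇒∼0 y∈k) (∼-reflexive ≈ᴹ-refl)) (∼-reflexive (+ᴹ-identityˡ z)))))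

      spans-basis : (P : Point (FiniteField.ring K ^ᵛ 2) (c′ ⊔ ℓ′)) → Spans P (HasDimension.basis (Point.hasDimension P) 0F)
      spans-basis P =
        (λ w∈P → let a , eq = HasDimension.spanning (Point.hasDimension P) w∈P in a 0F , λ i → trans (eq i) (+-identityʳ _)) ,
        (λ α → Subspace.*ₗ-closed (Point.subspace P) α (HasDimension.contained (Point.hasDimension P) 0F))

      basis≉0 : (P : Point (FiniteField.ring K ^ᵛ 2) (c′ ⊔ ℓ′)) → ¬ (∀ i → HasDimension.basis (Point.hasDimension P) 0F i ≈ 0#)
      basis≉0 P u≈0 = 0≉1 (sym (HasDimension.independent (Point.hasDimension P) (λ _ → 1#)
        (λ i → trans (+-identityʳ _) (trans (*-identityˡ _) (u≈0 i))) 0F))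

    chart : Chart k
    chart = record
      { χ           = χ
      ; χ-form      = χ-form
      ; kernel      = χ-kernel
      ; vanishes    = χ-vanishes
      ; directionOf = λ {j} j≢k → let P , eq = proj₁ spread (j , j≢k) in
          HasDimension.basis (Point.hasDimension P) 0F , record
            { j≢k     = j≢k
            ; nonzero = basis≉0 P
            ; sound   = sound j≢k P (spans-basis P) eq
            ; onto    = onto j≢k P (spans-basis P) eq
            }
      ; ofDirection = λ {u} u≉0 →
          let P = PointOf.pointOf K u u≉0
              (j , j≢k) , eq = proj₂ spread P
              spans : Spans P u
              spans = (λ w∈P → w∈P) , (λ α → α , λ _ → refl)
          in j , record
            { j≢k     = j≢k
            ; nonzero = λ u≈0 → proj₂ u≉0 (u≈0 (proj₁ u≉0))
            ; sound   = sound j≢k P spans eq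
            ; onto    = onto j≢k P spans eq
            }
      }

  -- From a chart to a projection with two prescribed axes.

  module ChartProjection {k : Fin N} (chart : Chart k) where
    open Chart chart

    det : (u w : Fin 2 → Carrier) → Carrier
    det u w = u 0F * w 1F - u 1F * w 0F

    -- Proportional directions would give x in `H j` and y in `H l` with equal coordinates in the
    -- quotient. Then y - x lies in `H k`, so y lies in ⟨H j, H k⟩ and is 0, which makes u or w
    -- vanish.
    det≉0 : ∀ {j l u w} → j ≢ l → Direction χ k j u → Direction χ k l w → det u w ≉ 0#
    det≉0 {j} {l} {u} {w} j≢l U W det≈0 = W.nonzero λ i → decidable-stable (w i ≟ 0#) λ wi≉0 →
      U.nonzero λ i′ → x*y≈0⇒y≈0 wi≉0 (trans (*-comm _ _) (vanish i′ i))
      where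
      module U = Direction U
      module W = Direction W
      proportional : ∀ i i′ → w i * u i′ ≈ u i * w i′
      proportional 0F 0F = *-comm _ _
      proportional 0F 1F = trans (*-comm _ _) (sym (x-y≈0⇒x≈y det≈0))
      proportional 1F 0F = trans (*-comm _ _) (x-y≈0⇒x≈y det≈0)
      proportional 1F 1F = *-comm _ _
      vanish : ∀ i i′ → u i * w i′ ≈ 0#
      vanish i i′ = trans (sym (proj₂ (proj₂ (W.onto (u i))) i′))
        (IsForm.0-homo (χ-form i′) (disjoint⇒0 U.j≢k j≢l (λ k≡l → W.j≢k (≡.sym k≡l)) x∈ y-x∈
          (proj₁ (proj₂ (W.onto (u i)))) (≈ᴹ-sym (x+[y-x]≈y _ _))))
        where
        x y : Carrierᴹ
        x = proj₁ (U.onto (w i))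
        y = proj₁ (W.onto (u i))
        x∈ : x ∈H j
        x∈ = proj₁ (proj₂ (U.onto (w i)))
        y-x∈ : y ⊝ x ∈H k
        y-x∈ = kernel λ i″ → trans (IsForm.⊝-homo (χ-form i″) y x) (x≈y⇒x-y≈0
          (trans (proj₂ (proj₂ (W.onto (u i))) i″) (trans (sym (proportional i i″)) (sym (proj₂ (proj₂ (U.onto (w i))) i″)))))

    combination : ∀ a b → IsForm (λ x → a * χ x 0F - b * χ x 1F)
    combination a b = record
      { cong   = λ x≈y → +-cong (*-congˡ (χ₀.cong x≈y)) (-‿cong (*-congˡ (χ₁.cong x≈y)))
      ; +-homo = λ x y → trans (+-cong (*-congˡ (χ₀.+-homo x y)) (-‿cong (*-congˡ (χ₁.+-homo x y))))
          (solve 6 (λ a b x y x′ y′ → a :* (x :+ x′) :- b :* (y :+ y′) := (a :* x :- b :* y) :+ (a :* x′ :- b :* y′))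
             refl a b (χ x 0F) (χ x 1F) (χ y 0F) (χ y 1F))
      ; *-homo = λ t x → trans (+-cong (*-congˡ (χ₀.*-homo t x)) (-‿cong (*-congˡ (χ₁.*-homo t x))))
          (solve 5 (λ a b x y t → a :* (t :* x) :- b :* (t :* y) := t :* (a :* x :- b :* y))
             refl a b (χ x 0F) (χ x 1F) ⟦ t ⟧)
      }
      where
      module χ₀ = IsForm (χ-form 0F)
      module χ₁ = IsForm (χ-form 1F)

    module _ {l m} (l≢k : l ≢ k) (m≢k : m ≢ k) (l≢m : l ≢ m) where
      private
        u w : Fin 2 → Carrier
        u = proj₁ (directionOf l≢k)
        w = proj₁ (directionOf m≢k)
        U : Direction χ k l u
        U = proj₂ (directionOf l≢k)
        W : Direction χ k m w
        W = proj₂ (directionOf m≢k)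
        module U = Direction U
        module W = Direction W
        δ : Carrier
        δ = det u w
        δ≉0 : δ ≉ 0#
        δ≉0 = det≉0 l≢m U W

        -- These are det (χ x) w and det u (χ x), that is, δ times the coordinates with respect to u
        -- and w. The signs bring both into the form of `combination`.
        ψ₁ ψ₂ : Carrierᴹ → Carrier
        ψ₁ x = w 1F * χ x 0F - w 0F * χ x 1F
        ψ₂ x = (- u 1F) * χ x 0F - (- u 0F) * χ x 1F

        ψ₁-dir : ∀ {x α z} → (∀ i → χ x i ≈ α * z i) → ψ₁ x ≈ α * det z w
        ψ₁-dir {x} {α} {z} eq = trans (+-cong (*-congˡ (eq 0F)) (-‿cong (*-congˡ (eq 1F))))
          (solve 5 (λ a z₀ z₁ w₀ w₁ → w₁ :* (a :* z₀) :- w₀ :* (a :* z₁) := a :* (z₀ :* w₁ :- z₁ :* w₀))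
             refl α (z 0F) (z 1F) (w 0F) (w 1F))

        ψ₂-dir : ∀ {x α z} → (∀ i → χ x i ≈ α * z i) → ψ₂ x ≈ α * det u z
        ψ₂-dir {x} {α} {z} eq = trans (+-cong (*-congˡ (eq 0F)) (-‿cong (*-congˡ (eq 1F))))
          (solve 5 (λ a z₀ z₁ u₀ u₁ → (:- u₁) :* (a :* z₀) :- (:- u₀) :* (a :* z₁) := a :* (u₀ :* z₁ :- u₁ :* z₀))
             refl α (z 0F) (z 1F) (u 0F) (u 1F))

        det-self : ∀ z → det z z ≈ 0#
        det-self z = solve 2 (λ a b → a :* b :- b :* a := con (ℤ.+ 0)) refl (z 0F) (z 1F)

        -- Cramer's rule
        δ*χ : ∀ x i → δ * χ x i ≈ ψ₁ x * u i + ψ₂ x * w i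
        δ*χ x 0F = solve 6 (λ x y u₀ u₁ w₀ w₁ → (u₀ :* w₁ :- u₁ :* w₀) :* x :=
          (w₁ :* x :- w₀ :* y) :* u₀ :+ ((:- u₁) :* x :- (:- u₀) :* y) :* w₀) refl (χ x 0F) (χ x 1F) (u 0F) (u 1F) (w 0F) (w 1F)
        δ*χ x 1F = solve 6 (λ x y u₀ u₁ w₀ w₁ → (u₀ :* w₁ :- u₁ :* w₀) :* y :=
          (w₁ :* x :- w₀ :* y) :* u₁ :+ ((:- u₁) :* x :- (:- u₀) :* y) :* w₁) refl (χ x 0F) (χ x 1F) (u 0F) (u 1F) (w 0F) (w 1F)

        divide : ∀ {a} s → a ≉ 0# → (s * a ⁻¹) * a ≈ s
        divide {a} s a≉0 = trans (*-assoc _ _ _) (trans (*-congˡ (⁻¹-inverseˡ a≉0)) (*-identityʳ s))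

        direction⇒slope : ∀ {j z} → Direction χ k j z → det z w ≉ 0# → ∀ κ → det u z ≈ κ * det z w →
          (∀ {x} → x ∈H j → ψ₂ x ≈ κ * ψ₁ x) × (∀ s → ∃ λ x → x ∈H j × ψ₁ x ≈ s)
        direction⇒slope {j} {z} Z dz≉0 κ eq =
          (λ {x} x∈ → let α , χ≈ = Z.sound x∈ in begin
            ψ₂ x                  ≈⟨ ψ₂-dir χ≈ ⟩
            α * det u z           ≈⟨ *-congˡ eq ⟩
            α * (κ * det z w)     ≈⟨ solve 3 (λ a b c → a :* (b :* c) := b :* (a :* c)) refl α κ (det z w) ⟩
            κ * (α * det z w)     ≈⟨ *-congˡ (ψ₁-dir χ≈) ⟨
            κ * ψ₁ x              ∎) ,
          (λ s → let x , x∈ , χ≈ = Z.onto (s * det z w ⁻¹) in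
            x , x∈ , trans (ψ₁-dir χ≈) (divide s dz≉0))
          where
          module Z = Direction Z
          open ≈-Reasoning setoid

      projection : Projection k l m
      projection = record
        { ψ₁         = ψ₁
        ; ψ₂         = ψ₂
        ; form₁      = combination (w 1F) (w 0F)
        ; form₂      = combination (- u 1F) (- u 0F)
        ; kernel     = λ {x} eq₁ eq₂ → kernel λ i → x*y≈0⇒y≈0 δ≉0 (trans (δ*χ x i)
            (trans (+-cong (trans (*-congʳ eq₁) (zeroˡ _)) (trans (*-congʳ eq₂) (zeroˡ _))) (+-identityʳ 0#)))
        ; vanishes   = λ {x} x∈ →
            trans (ψ₁-dir {x} {0#} {u} (λ i → trans (vanishes x∈ i) (sym (zeroˡ _)))) (zeroˡ _) ,
            trans (ψ₂-dir {x} {0#} {u} (λ i → trans (vanishes x∈ i) (sym (zeroˡ _)))) (zeroˡ _)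
        ; horizontal = direction⇒slope U δ≉0 0# (trans (det-self u) (sym (zeroˡ _)))
        ; vertical   = (λ x∈ → let α , χ≈ = W.sound x∈ in trans (ψ₁-dir χ≈) (trans (*-congˡ (det-self w)) (zeroʳ α))) ,
                       (λ s → let x , x∈ , χ≈ = W.onto (s * δ ⁻¹) in x , x∈ , trans (ψ₂-dir χ≈) (divide s δ≉0))
        ; slope      = λ j≢k j≢m → let z , Z = directionOf j≢k ; dz≉0 = det≉0 j≢m Z W in
            det u z * det z w ⁻¹ , direction⇒slope Z dz≉0 _ (sym (divide (det u z) dz≉0))
        -- The direction u + κ w has determinant δ with w, and u has determinant κ δ with it: slope
        -- κ.
        ; ofSlope    = λ κ → let j , Z = ofDirection (sum≉0 κ) in
            j , Direction.j≢k Z , (λ j≡m → sum∉m κ j≡m Z) ,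
            direction⇒slope Z (λ eq → δ≉0 (trans (sym (det-sum κ)) eq)) κ
              (trans (solve 5 (λ u₀ u₁ w₀ w₁ k → u₀ :* (u₁ :+ k :* w₁) :- u₁ :* (u₀ :+ k :* w₀) := k :* (u₀ :* w₁ :- u₁ :* w₀))
                 refl (u 0F) (u 1F) (w 0F) (w 1F) κ) (*-congˡ (sym (det-sum κ))))
        }
        where
        sum : Carrier → Fin 2 → Carrier
        sum κ i = u i + κ * w i
        det-sum : ∀ κ → det (sum κ) w ≈ δ
        det-sum κ = solve 5 (λ u₀ u₁ w₀ w₁ k → (u₀ :+ k :* w₀) :* w₁ :- (u₁ :+ k :* w₁) :* w₀ := u₀ :* w₁ :- u₁ :* w₀)
                      refl (u 0F) (u 1F) (w 0F) (w 1F) κ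
        sum≉0 : ∀ κ → ∃ λ i → sum κ i ≉ 0#
        sum≉0 κ with sum κ 0F ≟ 0#
        ... | no  eq = 0F , eq
        ... | yes eq₀ = 1F , λ eq₁ → δ≉0 (trans (sym (det-sum κ))
          (trans (+-cong (trans (*-congʳ eq₀) (zeroˡ _)) (-‿cong (trans (*-congʳ eq₁) (zeroˡ _)))) (-‿inverseʳ 0#)))
        -- `ψ₁` vanishes on `H m`, but takes the value δ at a vector with coordinates u + κ w.
        sum∉m : ∀ κ {j} → j ≡ m → Direction χ k j (sum κ) → ⊥
        sum∉m κ ≡.refl Z =
          let x , x∈ , χ≈ = Direction.onto Z 1#
              α , χ≈′ = W.sound x∈
          in δ≉0 (begin
            δ                        ≈⟨ det-sum κ ⟨
            det (sum κ) w            ≈⟨ *-identityˡ _ ⟨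
            1# * det (sum κ) w       ≈⟨ ψ₁-dir χ≈ ⟨
            ψ₁ x                     ≈⟨ ψ₁-dir χ≈′ ⟩
            α * det w w              ≈⟨ *-congˡ (det-self w) ⟩
            α * 0#                   ≈⟨ zeroʳ α ⟩
            0#                       ∎)
          where open ≈-Reasoning setoid

-- Coordinates on V itself.

module Frames {q n N} {F : FiniteField q c″ ℓ} {K : FiniteField (q ℕ.^ n) c′ ℓ′} (ι : Extension F K)
              {V : LeftModule (FiniteField.ring F) v ℓv} (H : Fin N → Subspace V p)
              (disjoint : ∀ {k l m} → k ≢ l → k ≢ m → l ≢ m → Disjoint ⟨ H k , H l ⟩ (H m))
              (disjoint₂ : ∀ {k l} → k ≢ l → Disjoint (H k) (H l)) where
  open FiniteFieldProperties K
  open VectorSpace {n = n} {F = F} {K = K} ι V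
  open Projections {n = n} {F = F} {K = K} ι H disjoint
  open RingHomomorphism ι using (⟦_⟧)

  lift-⊝ : ∀ {e e′} → IsLift e → IsLift e′ → IsLift (λ s → e s ⊝ e′ s)
  lift-⊝ {e} {e′} E E′ = record
    { cong   = λ x≈y → +ᴹ-cong (E.cong x≈y) (-ᴹ‿cong (E′.cong x≈y))
    ; +-homo = λ x y → ≈ᴹ-trans (+ᴹ-cong (E.+-homo x y) (-ᴹ‿cong (E′.+-homo x y))) (⊝-interchange _ _ _ _)
    ; *-homo = λ t x → ≈ᴹ-trans (+ᴹ-cong (E.*-homo t x) (-ᴹ‿cong (E′.*-homo t x)))
        (≈ᴹ-trans (+ᴹ-congˡ (≈ᴹ-trans (≈ᴹ-sym (-1·x≈-x _)) (≈ᴹ-trans (·-comm _ _ _) (*ₗ-congˡ (-1·x≈-x _)))))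
                  (≈ᴹ-sym (*ₗ-distribˡ t _ _)))
    }
    where
    module E = IsLift E
    module E′ = IsLift E′
    module F = FiniteField F
    ·-comm : ∀ s t x → s · (t · x) ≈ᴹ t · (s · x)
    ·-comm s t x = ≈ᴹ-trans (≈ᴹ-sym (LeftModule.*ₗ-assoc V s t x))
      (≈ᴹ-trans (*ₗ-congʳ (F.*-comm s t)) (LeftModule.*ₗ-assoc V t s x))

  record LiftOnto (j : Fin N) (e : Carrier → Carrierᴹ) : Set (c″ ⊔ c′ ⊔ ℓ′ ⊔ v ⊔ ℓv ⊔ p) where
    field
      isLift : IsLift e
      inside : ∀ s → e s ∈H j
      kernel : ∀ {s} → e s ≈ᴹ 0ᴹ → s ≈ 0#
      onto   : ∀ {x} → x ∈H j → ∃ λ s → x ≈ᴹ e s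
    open IsLift isLift public

  module _ {j f} (form : IsForm f) (f-injective : ∀ {x} → x ∈H j → f x ≈ 0# → x ≈ᴹ 0ᴹ)
           (f-onto : ∀ s → ∃ λ x → x ∈H j × f x ≈ s) {δ} (δ≉0 : δ ≉ 0#) where
    private
      module f = IsForm form
      e : Carrier → Carrierᴹ
      e s = proj₁ (f-onto (δ * s))

      e∈ : ∀ s → e s ∈H j
      e∈ s = proj₁ (proj₂ (f-onto (δ * s)))

    inverse-section : ∀ s → f (e s) ≈ δ * s
    inverse-section s = proj₂ (proj₂ (f-onto (δ * s)))

    private
      unique : ∀ {x y} → x ∈H j → y ∈H j → f x ≈ f y → x ≈ᴹ y
      unique {x} {y} x∈ y∈ eq = x-y≈0⇒x≈ᴹy x y (f-injective (⊝∈ x∈ y∈) (trans (f.⊝-homo x y) (x≈y⇒x-y≈0 eq)))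

    -- `e` inverts `f` on `H j` after scaling by δ. The scaling is what later allows `H d` to be put
    -- on the diagonal.
    inverseLift : LiftOnto j e
    inverseLift = record
      { isLift = record
        { cong   = λ {x} {y} x≈y → unique (e∈ x) (e∈ y)
            (trans (inverse-section x) (trans (*-congˡ x≈y) (sym (inverse-section y))))
        ; +-homo = λ x y → unique (e∈ _) (Subspace.+ᴹ-closed (H j) (e∈ x) (e∈ y))
            (trans (inverse-section _) (trans (distribˡ δ x y)
              (sym (trans (f.+-homo _ _) (+-cong (inverse-section x) (inverse-section y))))))
        ; *-homo = λ t x → unique (e∈ _) (Subspace.*ₗ-closed (H j) t (e∈ x))
            (trans (inverse-section _) (trans (solve 3 (λ d t x → d :* (t :* x) := t :* (d :* x)) refl δ ⟦ t ⟧ x)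
              (sym (trans (f.*-homo t _) (*-congˡ (inverse-section x))))))
        }
      ; inside = e∈
      ; kernel = λ {s} es≈0 → x*y≈0⇒y≈0 δ≉0 (trans (sym (inverse-section s)) (f.0-homo es≈0))
      ; onto   = λ {x} x∈ → δ ⁻¹ * f x , unique x∈ (e∈ _)
          (sym (trans (inverse-section _) (x*[x⁻¹*y]≈y (f x) δ≉0)))
      }

  module ProjectionProperties {k l m} (P : Projection k l m) where
    open Projection P
    private
      module ψ₁ = IsForm form₁
      module ψ₂ = IsForm form₂

    slope-injective : ∀ {j κ} → j ≢ k → HasSlope j κ → ∀ {x} → x ∈H j → ψ₁ x ≈ 0# → x ≈ᴹ 0ᴹ
    slope-injective j≢k (S , _) x∈ ψ₁x≈0 =
      disjoint₂ j≢k x∈ (kernel ψ₁x≈0 (trans (S x∈) (trans (*-congˡ ψ₁x≈0) (zeroʳ _))))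

    vertical-injective : m ≢ k → ∀ {x} → x ∈H m → ψ₂ x ≈ 0# → x ≈ᴹ 0ᴹ
    vertical-injective m≢k x∈ ψ₂x≈0 = disjoint₂ m≢k x∈ (kernel (proj₁ vertical x∈) ψ₂x≈0)

    -- With equal slopes, the vectors of `H j` and `H j′` with first coordinate 1 would differ by an
    -- element of `H k`, against disjointness.
    slope-separates : ∀ {j j′ κ κ′} → j ≢ k → j′ ≢ k → j ≢ j′ → HasSlope j κ → HasSlope j′ κ′ → κ ≉ κ′
    slope-separates {j} {j′} {κ} {κ′} j≢k j′≢k j≢j′ (S , onto) (S′ , onto′) κ≈κ′ =
      0≉1 (trans (sym (ψ₁.0-homo y≈0)) (proj₂ (proj₂ (onto′ 1#))))
      where
      x y : Carrierᴹ
      x = proj₁ (onto 1#)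
      y = proj₁ (onto′ 1#)
      x∈ : x ∈H j
      x∈ = proj₁ (proj₂ (onto 1#))
      y∈ : y ∈H j′
      y∈ = proj₁ (proj₂ (onto′ 1#))
      ψ₁y≈ψ₁x : ψ₁ y ≈ ψ₁ x
      ψ₁y≈ψ₁x = trans (proj₂ (proj₂ (onto′ 1#))) (sym (proj₂ (proj₂ (onto 1#))))
      y-x∈ : y ⊝ x ∈H k
      y-x∈ = kernel (trans (ψ₁.⊝-homo y x) (x≈y⇒x-y≈0 ψ₁y≈ψ₁x))
        (trans (ψ₂.⊝-homo y x) (x≈y⇒x-y≈0 (trans (S′ y∈) (trans (*-cong (sym κ≈κ′) ψ₁y≈ψ₁x) (sym (S x∈))))))
      y≈0 : y ≈ᴹ 0ᴹ
      y≈0 = disjoint⇒0 j≢k j≢j′ (λ k≡j′ → j′≢k (≡.sym k≡j′)) x∈ y-x∈ y∈ (≈ᴹ-sym (x+[y-x]≈y x y))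

  -- A basis of V over K with e x 0 0 ∈ H a, e 0 y 0 ∈ H b, e 0 0 z ∈ H c and
  -- e x x x ∈ H d.
  record Frame (a b c d : Fin N) : Set (c″ ⊔ c′ ⊔ ℓ′ ⊔ v ⊔ ℓv ⊔ p) where
    field
      eᵃ eᵇ eᶜ  : Carrier → Carrierᴹ
      liftᵃ     : LiftOnto a eᵃ
      liftᵇ     : LiftOnto b eᵇ
      liftᶜ     : LiftOnto c eᶜ

    e : Carrier → Carrier → Carrier → Carrierᴹ
    e x y z = (eᵃ x +ᴹ eᵇ y) +ᴹ eᶜ z

    -- H j = {e x (κ x) (B x)} for some map B.
    OnGraph : Fin N → Carrier → Set (c′ ⊔ v ⊔ ℓv ⊔ p)
    OnGraph j κ = (∀ x → ∃ λ z → e x (κ * x) z ∈H j) × (∀ {u} → u ∈H j → ∃ λ x → ∃ λ z → u ≈ᴹ e x (κ * x) z)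

    field
      decompose : ∀ u → ∃ λ x → ∃ λ y → ∃ λ z → u ≈ᴹ e x y z
      diagonal  : ∀ x → e x x x ∈H d
      graphOf   : ∀ {j} → j ≢ b → j ≢ c → ∃ (OnGraph j)
      ofGraph   : ∀ κ → ∃ λ j → j ≢ b × j ≢ c × OnGraph j κ

  -- Construction of a frame from the quotients by H c and H a.

  module _ {a b c d} (a≢b : a ≢ b) (a≢c : a ≢ c) (a≢d : a ≢ d) (b≢c : b ≢ c) (b≢d : b ≢ d) (c≢d : c ≢ d)
           (P : Projection c a b) (Q : Projection a b d) where
    private
      open Projection P
      open ProjectionProperties P
      module Q = Projection Q
      module ψ₁ = IsForm form₁
      module ψ₂ = IsForm form₂
      module φ₁ = IsForm Q.form₁
      module φ₂ = IsForm Q.form₂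

      d≢c : d ≢ c
      d≢c d≡c = c≢d (≡.sym d≡c)

      d-slope : ∃ (HasSlope d)
      d-slope = slope d≢c (λ d≡b → b≢d (≡.sym d≡b))

      δ : Carrier
      δ = proj₁ d-slope

      δ≉0 : δ ≉ 0#
      δ≉0 δ≈0 = slope-separates a≢c d≢c a≢d horizontal (proj₂ d-slope) (sym δ≈0)

      -- `eᶜ` is forced by the wish that e s s s be `eᵈ s`. For it to land in `H c`, `eᵇ s` must
      -- have the second coordinate δ s of `eᵈ s`, δ being the slope of `H d`. The factor 1 gives
      -- `eᵃ` and `eᵈ` the shape required by `inverseLift`.
      eᵃ eᵇ eᶜ eᵈ : Carrier → Carrierᴹ
      eᵃ s = proj₁ (proj₂ horizontal (1# * s))
      eᵈ s = proj₁ (proj₂ (proj₂ d-slope) (1# * s))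
      eᵇ s = proj₁ (proj₂ vertical (δ * s))
      eᶜ s = (eᵈ s ⊝ eᵃ s) ⊝ eᵇ s

      a-injective : ∀ {x} → x ∈H a → ψ₁ x ≈ 0# → x ≈ᴹ 0ᴹ
      a-injective = slope-injective a≢c horizontal

      d-injective : ∀ {x} → x ∈H d → ψ₁ x ≈ 0# → x ≈ᴹ 0ᴹ
      d-injective = slope-injective d≢c (proj₂ d-slope)

      liftᵃ : LiftOnto a eᵃ
      liftᵃ = inverseLift form₁ a-injective (proj₂ horizontal) 1≉0

      liftᵈ : LiftOnto d eᵈ
      liftᵈ = inverseLift form₁ d-injective (proj₂ (proj₂ d-slope)) 1≉0

      liftᵇ : LiftOnto b eᵇ
      liftᵇ = inverseLift form₂ (vertical-injective b≢c) (proj₂ vertical) δ≉0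

      module Eᵃ = LiftOnto liftᵃ
      module Eᵇ = LiftOnto liftᵇ
      module Eᵈ = LiftOnto liftᵈ

      ψ₁-eᵃ : ∀ s → ψ₁ (eᵃ s) ≈ s
      ψ₁-eᵃ s = trans (proj₂ (proj₂ (proj₂ horizontal (1# * s)))) (*-identityˡ s)

      ψ₂-eᵃ : ∀ s → ψ₂ (eᵃ s) ≈ 0#
      ψ₂-eᵃ s = trans (proj₁ horizontal (Eᵃ.inside s)) (zeroˡ _)

      ψ₁-eᵈ : ∀ s → ψ₁ (eᵈ s) ≈ s
      ψ₁-eᵈ s = trans (proj₂ (proj₂ (proj₂ (proj₂ d-slope) (1# * s)))) (*-identityˡ s)

      ψ₂-eᵈ : ∀ s → ψ₂ (eᵈ s) ≈ δ * s
      ψ₂-eᵈ s = trans (proj₁ (proj₂ d-slope) (Eᵈ.inside s)) (*-congˡ (ψ₁-eᵈ s))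

      ψ₁-eᵇ : ∀ s → ψ₁ (eᵇ s) ≈ 0#
      ψ₁-eᵇ s = proj₁ vertical (Eᵇ.inside s)

      ψ₂-eᵇ : ∀ s → ψ₂ (eᵇ s) ≈ δ * s
      ψ₂-eᵇ s = proj₂ (proj₂ (proj₂ vertical (δ * s)))

      residue∈ : ∀ {u x y} → ψ₁ u ≈ x → ψ₂ u ≈ δ * y → (u ⊝ eᵃ x) ⊝ eᵇ y ∈H c
      residue∈ {u} {x} {y} eq₁ eq₂ = kernel
        (trans (ψ₁.⊝-homo _ _) (trans (+-cong (trans (ψ₁.⊝-homo _ _) (trans (+-cong eq₁ (-‿cong (ψ₁-eᵃ x)))
          (-‿inverseʳ x))) (-‿cong (ψ₁-eᵇ y))) (-‿inverseʳ 0#)))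
        (trans (ψ₂.⊝-homo _ _) (trans (+-cong (trans (ψ₂.⊝-homo _ _) (+-cong eq₂ (-‿cong (ψ₂-eᵃ x))))
          (-‿cong (ψ₂-eᵇ y))) (solve 1 (λ x → (x :- con (ℤ.+ 0)) :- x := con (ℤ.+ 0)) refl (δ * y))))

      residue-+ : ∀ u w w′ → u ≈ᴹ (w +ᴹ w′) +ᴹ ((u ⊝ w) ⊝ w′)
      residue-+ u w w′ = ≈ᴹ-sym (≈ᴹ-trans (+ᴹ-congˡ (≈ᴹ-trans (+ᴹ-assoc _ _ _) (+ᴹ-congˡ (-ᴹ-+ᴹ-comm w w′))))
        (x+[y-x]≈y (w +ᴹ w′) u))

      eᶜ∈ : ∀ s → eᶜ s ∈H c
      eᶜ∈ s = residue∈ (ψ₁-eᵈ s) (ψ₂-eᵈ s)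

      -- If eᶜ s = 0, then `eᵈ s` lies in ⟨H a, H b⟩ and in `H d`.
      eᶜ-kernel : ∀ {s} → eᶜ s ≈ᴹ 0ᴹ → s ≈ 0#
      eᶜ-kernel {s} eᶜs≈0 = Eᵈ.kernel (disjoint⇒0 a≢b a≢d b≢d (Eᵃ.inside s) (Eᵇ.inside s) (Eᵈ.inside s)
        (≈ᴹ-trans (residue-+ (eᵈ s) (eᵃ s) (eᵇ s)) (≈ᴹ-trans (+ᴹ-congˡ eᶜs≈0) (+ᴹ-identityʳ _))))

      -- Modulo H a, every vector is a sum of elements of H b and H d, so a vector of
      -- H c has the form eᶜ s up to an element of the span of H a and H b.
      eᶜ-onto : ∀ {z} → z ∈H c → ∃ λ s → z ≈ᴹ eᶜ s
      eᶜ-onto {z} z∈ = s , x-y≈0⇒x≈ᴹy z (eᶜ s)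
        (disjoint⇒0 a≢b a≢c b≢c (Subspace.+ᴹ-closed (H a) r∈ (Eᵃ.inside s)) (Subspace.+ᴹ-closed (H b) y∈ (Eᵇ.inside s))
          (⊝∈ z∈ (eᶜ∈ s)) (begin
          z ⊝ eᶜ s
            ≈⟨ +ᴹ-congʳ (residue-+ z w y) ⟩
          ((w +ᴹ y) +ᴹ r) ⊝ eᶜ s
            ≈⟨ +ᴹ-congʳ (+ᴹ-congʳ (+ᴹ-congʳ (≈ᴹ-trans w≈ (residue-+ (eᵈ s) (eᵃ s) (eᵇ s))))) ⟩
          (((((eᵃ s +ᴹ eᵇ s) +ᴹ eᶜ s)) +ᴹ y) +ᴹ r) ⊝ eᶜ s
            ≈⟨ +ᴹ-congʳ (≈ᴹ-trans (+ᴹ-assoc _ _ _) (≈ᴹ-trans (+ᴹ-assoc _ _ _) (+ᴹ-congˡ (+ᴹ-comm _ _)))) ⟩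
          ((eᵃ s +ᴹ eᵇ s) +ᴹ ((y +ᴹ r) +ᴹ eᶜ s)) ⊝ eᶜ s
            ≈⟨ ≈ᴹ-trans (+ᴹ-congʳ (≈ᴹ-sym (+ᴹ-assoc _ _ _))) (+ᴹ-assoc _ _ _) ⟩
          ((eᵃ s +ᴹ eᵇ s) +ᴹ (y +ᴹ r)) +ᴹ (eᶜ s ⊝ eᶜ s)
            ≈⟨ ≈ᴹ-trans (+ᴹ-congˡ (-ᴹ‿inverseʳ _)) (+ᴹ-identityʳ _) ⟩
          (eᵃ s +ᴹ eᵇ s) +ᴹ (y +ᴹ r)       ≈⟨ +ᴹ-cong ≈ᴹ-refl (+ᴹ-comm y r) ⟩
          (eᵃ s +ᴹ eᵇ s) +ᴹ (r +ᴹ y)       ≈⟨ interchange _ _ _ _ ⟩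
          (eᵃ s +ᴹ r) +ᴹ (eᵇ s +ᴹ y)       ≈⟨ +ᴹ-cong (+ᴹ-comm _ _) (+ᴹ-comm _ _) ⟩
          (r +ᴹ eᵃ s) +ᴹ (y +ᴹ eᵇ s)       ∎))
        where
        open ≈-Reasoning ≈ᴹ-setoid
        w y r : Carrierᴹ
        w = proj₁ (proj₂ Q.vertical (Q.ψ₂ z))
        y = proj₁ (proj₂ Q.horizontal (Q.ψ₁ z))
        r = (z ⊝ w) ⊝ y
        w∈ : w ∈H d
        w∈ = proj₁ (proj₂ (proj₂ Q.vertical (Q.ψ₂ z)))
        y∈ : y ∈H b
        y∈ = proj₁ (proj₂ (proj₂ Q.horizontal (Q.ψ₁ z)))
        s : Carrier
        s = proj₁ (Eᵈ.onto w∈)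
        w≈ : w ≈ᴹ eᵈ s
        w≈ = proj₂ (Eᵈ.onto w∈)
        r∈ : r ∈H a
        r∈ = Q.kernel
          (trans (φ₁.⊝-homo _ _) (trans (+-cong (trans (φ₁.⊝-homo _ _) (+-congˡ (-‿cong (proj₁ Q.vertical w∈))))
            (-‿cong (proj₂ (proj₂ (proj₂ Q.horizontal (Q.ψ₁ z))))))
            (solve 1 (λ x → (x :- con (ℤ.+ 0)) :- x := con (ℤ.+ 0)) refl (Q.ψ₁ z))))
          (trans (φ₂.⊝-homo _ _) (trans (+-cong (trans (φ₂.⊝-homo _ _)
            (trans (+-congˡ (-‿cong (proj₂ (proj₂ (proj₂ Q.vertical (Q.ψ₂ z)))))) (-‿inverseʳ _)))
            (-‿cong (trans (proj₁ Q.horizontal y∈) (zeroˡ _)))) (-‿inverseʳ 0#)))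

      liftᶜ : LiftOnto c eᶜ
      liftᶜ = record
        { isLift = lift-⊝ (lift-⊝ Eᵈ.isLift Eᵃ.isLift) Eᵇ.isLift
        ; inside = eᶜ∈
        ; kernel = eᶜ-kernel
        ; onto   = eᶜ-onto
        }

      e : Carrier → Carrier → Carrier → Carrierᴹ
      e x y z = (eᵃ x +ᴹ eᵇ y) +ᴹ eᶜ z

      decompose : ∀ {u x y} → ψ₁ u ≈ x → ψ₂ u ≈ δ * y → ∃ λ z → u ≈ᴹ e x y z
      decompose {u} {x} {y} eq₁ eq₂ = let z , r≈ = eᶜ-onto (residue∈ eq₁ eq₂) in
        z , ≈ᴹ-trans (residue-+ u (eᵃ x) (eᵇ y)) (+ᴹ-congˡ r≈)

      onGraph : ∀ {j κ κ′} → κ ≈ δ * κ′ → HasSlope j κ →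
                (∀ x → ∃ λ z → e x (κ′ * x) z ∈H j) × (∀ {u} → u ∈H j → ∃ λ x → ∃ λ z → u ≈ᴹ e x (κ′ * x) z)
      onGraph {j} {κ} {κ′} κ≈ (S , onto) =
        (λ x → let u , u∈ , ψ₁u≈x = onto x
                   z , u≈ = decompose ψ₁u≈x (scale u∈ ψ₁u≈x)
               in z , ∈-resp u≈ u∈) ,
        (λ {u} u∈ → ψ₁ u , decompose refl (scale u∈ refl))
        where
        scale : ∀ {u x} → u ∈H j → ψ₁ u ≈ x → ψ₂ u ≈ δ * (κ′ * x)
        scale u∈ eq = trans (S u∈) (trans (*-cong κ≈ eq) (*-assoc _ _ _))

    frame : Frame a b c d
    frame = record
      { eᵃ        = eᵃ
      ; eᵇ        = eᵇ
      ; eᶜ        = eᶜ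
      ; liftᵃ     = liftᵃ
      ; liftᵇ     = liftᵇ
      ; liftᶜ     = liftᶜ
      ; decompose = λ u → ψ₁ u , δ ⁻¹ * ψ₂ u , decompose refl (sym (x*[x⁻¹*y]≈y _ δ≉0))
      ; diagonal  = λ x → ∈-resp (residue-+ (eᵈ x) (eᵃ x) (eᵇ x)) (Eᵈ.inside x)
      -- The second axis is scaled by δ, so slopes are divided by δ and `H d` gets slope 1.
      ; graphOf   = λ j≢b j≢c → let κ , S = slope j≢c j≢b in
          δ ⁻¹ * κ , onGraph (sym (x*[x⁻¹*y]≈y κ δ≉0)) S
      ; ofGraph   = λ κ → let j , j≢c , j≢b , S = ofSlope (δ * κ) in j , j≢b , j≢c , onGraph refl S
      }

-- The slope family of a frame.

module FrameSlopes {q n N} {F : FiniteField q c ℓ} {K : FiniteField (q ℕ.^ n) c′ ℓ′}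
                   (n-prime : Prime n) (3≤q : 3 ≤ q) (ι : Extension F K)
                   {V : LeftModule (FiniteField.ring F) v ℓv} (H : Fin N → Subspace V p)
                   (disjoint : ∀ {k l m} → k ≢ l → k ≢ m → l ≢ m → Disjoint ⟨ H k , H l ⟩ (H m))
                   (disjoint₂ : ∀ {k l} → k ≢ l → Disjoint (H k) (H l)) where
  private
    2≤q : 2 ≤ q
    2≤q = ℕ.≤-trans (ℕ.n≤1+n 2) 3≤q
  open FiniteFieldProperties K
  open VectorSpace {n = n} {F = F} {K = K} ι V
  open Projections {n = n} {F = F} {K = K} ι H disjoint
  open Frames {n = n} {F = F} {K = K} ι H disjoint disjoint₂
  open LinearMaps {n = n} {F = F} {K = K} n-prime 2≤q ι
  open SlopeFamilies {n = n} {F = F} {K = K} n-prime 3≤q ι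

  form∘lift : ∀ {f e} → IsForm f → IsLift e → IsLinear (λ s → f (e s))
  form∘lift f e = record
    { cong   = λ x≈y → f.cong (e.cong x≈y)
    ; +-homo = λ x y → trans (f.cong (e.+-homo x y)) (f.+-homo _ _)
    ; *-homo = λ t x → trans (f.cong (e.*-homo t x)) (f.*-homo t _)
    }
    where
    module f = IsForm f
    module e = IsLift e

  module FrameProperties {a b c d} (a≢b : a ≢ b) (a≢c : a ≢ c) (b≢c : b ≢ c) (b≢d : b ≢ d) (c≢d : c ≢ d)
                         (fr : Frame a b c d) where
    open Frame fr
    private
      module Eᵃ = LiftOnto liftᵃ
      module Eᵇ = LiftOnto liftᵇ
      module Eᶜ = LiftOnto liftᶜ

    e-cong : ∀ {x y z x′ y′ z′} → x ≈ x′ → y ≈ y′ → z ≈ z′ → e x y z ≈ᴹ e x′ y′ z′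
    e-cong x≈ y≈ z≈ = +ᴹ-cong (+ᴹ-cong (Eᵃ.cong x≈) (Eᵇ.cong y≈)) (Eᶜ.cong z≈)

    e-⊝ : ∀ x y z x′ y′ z′ → e x y z ⊝ e x′ y′ z′ ≈ᴹ e (x - x′) (y - y′) (z - z′)
    e-⊝ x y z x′ y′ z′ = ≈ᴹ-trans (⊝-interchange _ _ _ _) (+ᴹ-cong
      (≈ᴹ-trans (⊝-interchange _ _ _ _) (+ᴹ-cong (≈ᴹ-sym (Eᵃ.⊝-homo x x′)) (≈ᴹ-sym (Eᵇ.⊝-homo y y′))))
      (≈ᴹ-sym (Eᶜ.⊝-homo z z′)))

    e-xᵃ : ∀ {x y z} → y ≈ 0# → z ≈ 0# → e x y z ≈ᴹ eᵃ x
    e-xᵃ y≈0 z≈0 = ≈ᴹ-trans (+ᴹ-cong (≈ᴹ-trans (+ᴹ-congˡ (Eᵇ.0-homo y≈0)) (+ᴹ-identityʳ _)) (Eᶜ.0-homo z≈0)) (+ᴹ-identityʳ _)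

    e-yᵇ : ∀ {x y z} → x ≈ 0# → z ≈ 0# → e x y z ≈ᴹ eᵇ y
    e-yᵇ x≈0 z≈0 = ≈ᴹ-trans (+ᴹ-cong (≈ᴹ-trans (+ᴹ-congʳ (Eᵃ.0-homo x≈0)) (+ᴹ-identityˡ _)) (Eᶜ.0-homo z≈0)) (+ᴹ-identityʳ _)

    e-zᶜ : ∀ {x y z} → x ≈ 0# → y ≈ 0# → e x y z ≈ᴹ eᶜ z
    e-zᶜ x≈0 y≈0 = ≈ᴹ-trans (+ᴹ-congʳ (≈ᴹ-trans (+ᴹ-cong (Eᵃ.0-homo x≈0) (Eᵇ.0-homo y≈0)) (+ᴹ-identityˡ _))) (+ᴹ-identityˡ _)

    e-yzᵇᶜ : ∀ {x y z} → x ≈ 0# → e x y z ≈ᴹ eᵇ y +ᴹ eᶜ z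
    e-yzᵇᶜ x≈0 = +ᴹ-congʳ (≈ᴹ-trans (+ᴹ-congʳ (Eᵃ.0-homo x≈0)) (+ᴹ-identityˡ _))

    sum≈0⇒x≈0-y : ∀ {x y} → x +ᴹ y ≈ᴹ 0ᴹ → x ≈ᴹ 0ᴹ ⊝ y
    sum≈0⇒x≈0-y {x} {y} eq = ≈ᴹ-sym (≈ᴹ-trans (+ᴹ-congʳ (≈ᴹ-sym eq)) (≈ᴹ-trans (+ᴹ-assoc x y _)
      (≈ᴹ-trans (+ᴹ-congˡ (-ᴹ‿inverseʳ y)) (+ᴹ-identityʳ x))))

    0∈ : ∀ {j} → 0ᴹ ∈H j
    0∈ {j} = Subspace.0ᴹ-closed (H j)

    ᵇᶜ-kernel : ∀ {y z} → eᵇ y +ᴹ eᶜ z ≈ᴹ 0ᴹ → y ≈ 0#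
    ᵇᶜ-kernel {y} {z} eq = Eᵇ.kernel (disjoint₂ b≢c (Eᵇ.inside y)
      (∈-resp (≈ᴹ-sym (sum≈0⇒x≈0-y eq)) (⊝∈ 0∈ (Eᶜ.inside z))))

    e-kernel : ∀ {x y z} → e x y z ≈ᴹ 0ᴹ → x ≈ 0#
    e-kernel {x} {y} {z} eq = Eᵃ.kernel (disjoint⇒0 b≢c (λ b≡a → a≢b (≡.sym b≡a)) (λ c≡a → a≢c (≡.sym c≡a))
      (⊝∈ 0∈ (Eᵇ.inside y)) (⊝∈ 0∈ (Eᶜ.inside z)) (Eᵃ.inside x)
      (≈ᴹ-trans (sum≈0⇒x≈0-y (≈ᴹ-trans (≈ᴹ-sym (+ᴹ-assoc _ _ _)) eq))
        (≈ᴹ-trans (+ᴹ-congʳ (≈ᴹ-sym (+ᴹ-identityˡ 0ᴹ))) (⊝-interchange _ _ _ _))))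

    -- A vector with first coordinate 0 lies in ⟨H b, H c⟩, which meets `H j` only in 0.
    e∈⇒y≈0 : ∀ {j x y z} → j ≢ b → j ≢ c → x ≈ 0# → e x y z ∈H j → y ≈ 0#
    e∈⇒y≈0 {j} {x} {y} {z} j≢b j≢c x≈0 e∈ = ᵇᶜ-kernel
      (disjoint⇒0 b≢c (λ b≡j → j≢b (≡.sym b≡j)) (λ c≡j → j≢c (≡.sym c≡j)) (Eᵇ.inside y) (Eᶜ.inside z)
        (∈-resp (e-yzᵇᶜ x≈0) e∈) ≈ᴹ-refl)

    e∈-z-unique : ∀ {j x y z x′ y′ z′} → j ≢ c → x ≈ x′ → y ≈ y′ → e x y z ∈H j → e x′ y′ z′ ∈H j → z ≈ z′
    e∈-z-unique j≢c x≈x′ y≈y′ e∈ e∈′ = x-y≈0⇒x≈y (Eᶜ.kernel (disjoint₂ j≢c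
      (∈-resp (≈ᴹ-trans (e-⊝ _ _ _ _ _ _) (e-zᶜ (x≈y⇒x-y≈0 x≈x′) (x≈y⇒x-y≈0 y≈y′))) (⊝∈ e∈ e∈′)) (Eᶜ.inside _)))

    -- The two vectors differ by an element of `H c`. If j and j′ were distinct, disjointness would
    -- make the second vector 0, although its first coordinate is 1.
    e∈-j-unique : ∀ {j j′ y y′ z z′} → j ≢ c → j′ ≢ c → y ≈ y′ → e 1# y z ∈H j → e 1# y′ z′ ∈H j′ → j ≡ j′
    e∈-j-unique {j} {j′} j≢c j′≢c y≈y′ e∈ e∈′ = decidable-stable (j Fin.≟ j′) λ j≢j′ →
      0≉1 (sym (e-kernel (disjoint⇒0 j≢c j≢j′ (λ c≡j′ → j′≢c (≡.sym c≡j′)) e∈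
        (∈-resp (≈ᴹ-sym (≈ᴹ-trans (e-⊝ _ _ _ _ _ _) (e-zᶜ (-‿inverseʳ 1#) (x≈y⇒x-y≈0 (sym y≈y′))))) (Eᶜ.inside _))
        e∈′ (≈ᴹ-sym (x+[y-x]≈y _ _)))))

    J : Carrier → Fin N
    J κ = proj₁ (ofGraph κ)

    J≢b : ∀ κ → J κ ≢ b
    J≢b κ = proj₁ (proj₂ (ofGraph κ))

    J≢c : ∀ κ → J κ ≢ c
    J≢c κ = proj₁ (proj₂ (proj₂ (ofGraph κ)))

    B : Carrier → Carrier → Carrier
    B κ x = proj₁ (proj₁ (proj₂ (proj₂ (proj₂ (ofGraph κ)))) x)

    B∈ : ∀ κ x → e x (κ * x) (B κ x) ∈H J κ
    B∈ κ x = proj₂ (proj₁ (proj₂ (proj₂ (proj₂ (ofGraph κ)))) x)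

    B∈1 : ∀ κ → e 1# κ (B κ 1#) ∈H J κ
    B∈1 κ = ∈-resp (e-cong refl (*-identityʳ κ) refl) (B∈ κ 1#)

    B-unique : ∀ {κ j x y z} → J κ ≡ j → y ≈ κ * x → e x y z ∈H j → B κ x ≈ z
    B-unique {κ} ≡.refl y≈ e∈ = e∈-z-unique (J≢c κ) refl (sym y≈) (B∈ κ _) e∈

    diagonal₁ : e 1# 1# 1# ∈H d
    diagonal₁ = diagonal 1#

    J-0 : J 0# ≡ a
    J-0 = e∈-j-unique (J≢c 0#) a≢c refl (B∈1 0#) (∈-resp (≈ᴹ-sym (e-xᵃ refl refl)) (Eᵃ.inside 1#))

    J-1 : J 1# ≡ d
    J-1 = e∈-j-unique (J≢c 1#) (λ d≡c → c≢d (≡.sym d≡c)) refl (B∈1 1#) diagonal₁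

    J-injective : ∀ {κ μ} → J κ ≡ J μ → κ ≈ μ
    J-injective {κ} {μ} eq = x-y≈0⇒x≈y (e∈⇒y≈0 (J≢b κ) (J≢c κ) (-‿inverseʳ 1#)
      (∈-resp (e-⊝ _ _ _ _ _ _) (⊝∈ (B∈1 κ) (≡.subst (e 1# μ (B μ 1#) ∈H_) (≡.sym eq) (B∈1 μ)))))

    J-cong : ∀ {κ μ} → κ ≈ μ → J κ ≡ J μ
    J-cong {κ} {μ} κ≈μ = e∈-j-unique (J≢c κ) (J≢c μ) κ≈μ (B∈1 κ) (B∈1 μ)

    B-cong : ∀ {κ μ x y} → κ ≈ μ → x ≈ y → B κ x ≈ B μ y
    B-cong {κ} {μ} κ≈μ x≈y = B-unique (J-cong κ≈μ) (*-cong (sym κ≈μ) refl)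
      (∈-resp (e-cong (sym x≈y) (*-congˡ (sym x≈y)) refl) (B∈ μ _))

    B-0 : ∀ x → B 0# x ≈ 0#
    B-0 x = B-unique {y = 0#} J-0 (sym (zeroˡ x)) (∈-resp (≈ᴹ-sym (e-xᵃ refl refl)) (Eᵃ.inside x))

    B-1 : ∀ x → B 1# x ≈ x
    B-1 x = B-unique J-1 (sym (*-identityˡ x)) (diagonal x)

    -- If the third coordinates agree, the vectors over x in the two graphs differ by (0 , (κ - μ) x
    -- , 0), an element of `H b`.
    B-separated : ∀ {κ μ x} → κ ≉ μ → B κ x ≈ B μ x → x ≈ 0#
    B-separated {κ} {μ} {x} κ≉μ eq = x*y≈0⇒y≈0 (λ κ-μ≈0 → κ≉μ (x-y≈0⇒x≈y κ-μ≈0))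
      (trans (solve 3 (λ k m x → (k :- m) :* x := k :* x :- m :* x) refl κ μ x)
        (Eᵇ.kernel (disjoint⇒0 (λ eq → κ≉μ (J-injective eq)) (J≢b κ) (J≢b μ) (B∈ κ x) (⊝∈ 0∈ (B∈ μ x)) (Eᵇ.inside _)
          (≈ᴹ-trans (≈ᴹ-sym (≈ᴹ-trans (e-⊝ _ _ _ _ _ _) (e-yᵇ (-‿inverseʳ x) (x≈y⇒x-y≈0 eq))))
                    (+ᴹ-congˡ (≈ᴹ-sym (+ᴹ-identityˡ _)))))))

    -- At x = κ μ y this separates the maps x ↦ B κ (κ⁻¹ x) instead of the B κ.
    B-separated⁻ : ∀ {κ μ x} → κ ≉ 0# → μ ≉ 0# → κ ≉ μ → B κ (μ * x) ≈ B μ (κ * x) → x ≈ 0#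
    B-separated⁻ {κ} {μ} {x} κ≉0 μ≉0 κ≉μ eq = x*y≈0⇒y≈0 (λ μ-κ≈0 → κ≉μ (sym (x-y≈0⇒x≈y μ-κ≈0)))
      (trans (solve 3 (λ k m x → (m :- k) :* x := m :* x :- k :* x) refl κ μ x)
        (Eᵃ.kernel (disjoint⇒0 (λ eq → κ≉μ (J-injective eq)) (J≢a κ≉0) (J≢a μ≉0) (B∈ κ _) (⊝∈ 0∈ (B∈ μ _)) (Eᵃ.inside _)
          (≈ᴹ-trans (≈ᴹ-sym (≈ᴹ-trans (e-⊝ _ _ _ _ _ _)
            (e-xᵃ (solve 3 (λ k m x → k :* (m :* x) :- m :* (k :* x) := con (ℤ.+ 0)) refl κ μ x) (x≈y⇒x-y≈0 eq))))
                    (+ᴹ-congˡ (≈ᴹ-sym (+ᴹ-identityˡ _)))))))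
      where
      J≢a : ∀ {κ} → κ ≉ 0# → J κ ≢ a
      J≢a κ≉0 eq = κ≉0 (J-injective (≡.trans eq (≡.sym J-0)))

    module Slopes (P : Projection b a c) (projections : ∀ {j} → j ≢ b → j ≢ c → j ≢ d → Projection j b c) where
      private
        module P where
          open Projection P public
          open ProjectionProperties P public
          module ψ₁ = IsForm form₁
          module ψ₂ = IsForm form₂

        c≢b : c ≢ b
        c≢b c≡b = b≢c (≡.sym c≡b)

      g g₁ : Carrier → Carrier
      g s  = P.ψ₂ (eᶜ s)
      g₁ s = P.ψ₁ (eᵃ s)

      private
        ψ₁∘e : ∀ {x y z} → P.ψ₁ (e x y z) ≈ g₁ x
        ψ₁∘e {x} {y} {z} = trans (P.ψ₁.+-homo _ _) (trans (+-cong (P.ψ₁.+-homo _ _) (proj₁ P.vertical (Eᶜ.inside z)))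
          (trans (+-congʳ (+-congˡ (proj₁ (P.vanishes (Eᵇ.inside y)))))
                 (solve 1 (λ x → (x :+ con (ℤ.+ 0)) :+ con (ℤ.+ 0) := x) refl (g₁ x))))

        ψ₂∘e : ∀ {x y z} → P.ψ₂ (e x y z) ≈ g z
        ψ₂∘e {x} {y} {z} = trans (P.ψ₂.+-homo _ _) (trans (+-congʳ (trans (P.ψ₂.+-homo _ _)
          (+-cong (trans (proj₁ P.horizontal (Eᵃ.inside x)) (zeroˡ _)) (proj₂ (P.vanishes (Eᵇ.inside y))))))
                 (solve 1 (λ x → (con (ℤ.+ 0) :+ con (ℤ.+ 0)) :+ x := x) refl (g z)))

        g∘B₁ : ∀ κ → ∃ λ s → ∀ x → g (B κ x) ≈ s * g₁ x
        g∘B₁ κ = let s , S , _ = P.slope (J≢b κ) (J≢c κ) in s , λ x →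
          trans (sym ψ₂∘e) (trans (S (B∈ κ x)) (*-congˡ ψ₁∘e))

        g-bijective : IsBijectiveLinear g
        g-bijective = record
          { isLinear   = form∘lift P.form₂ Eᶜ.isLift
          ; kernel     = λ eq → Eᶜ.kernel (P.vertical-injective c≢b (Eᶜ.inside _) eq)
          ; surjective = λ s → let u , u∈ , ψ₂u≈s = proj₂ P.vertical s
                                   z , u≈ = Eᶜ.onto u∈
                               in z , trans (P.ψ₂.cong (≈ᴹ-sym u≈)) ψ₂u≈s
          }

        s₁ : Carrier
        s₁ = proj₁ (g∘B₁ 1#)

        -- The projection measures x by `g₁` and B κ x by `g`. Slope 1, where `B` is the identity,
        -- identifies the two up to a constant.
        g≈s₁*g₁ : ∀ x → g x ≈ s₁ * g₁ x
        g≈s₁*g₁ x = trans (IsBijectiveLinear.cong g-bijective (sym (B-1 x))) (proj₂ (g∘B₁ 1#) x)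

        s₁≉0 : s₁ ≉ 0#
        s₁≉0 s₁≈0 = 0≉1 (sym (IsBijectiveLinear.kernel g-bijective
          (trans (g≈s₁*g₁ 1#) (trans (*-congʳ s₁≈0) (zeroˡ _)))))

        -- Modulo the graph of slope α, the vector over x in the graph of slope κ becomes (0 , (κ -
        -- α) x , B κ x - B α x). With `H b` and `H c` as axes, the slope of `H (J κ)` in this
        -- quotient relates the last two entries.
        base : ∀ {α} → α ≉ 1# → ∃ λ h → ∃ λ h′ → IsBijectiveLinear h × IsLinear h′ ×
               (∀ {κ} → κ ≉ α → ∃ λ t → ∀ x → h (B κ x - B α x) ≈ t * h′ ((κ - α) * x))
        base {α} α≉1 = h , h′ , h-bijective , form∘lift Q.form₁ Eᵇ.isLift , λ {κ} κ≉α →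
          let t , S , _ = Q.slope (λ eq → κ≉α (J-injective eq)) (J≢c κ) in t , λ x → begin
            h (B κ x - B α x)                  ≈⟨ +-identityˡ _ ⟨
            0# + h (B κ x - B α x)             ≈⟨ +-congʳ (proj₁ Q.horizontal′ (Eᵇ.inside _)) ⟨
            Q.ψ₂ (eᵇ (κ * x - α * x)) + h (B κ x - B α x)   ≈⟨ φ₂.+-homo _ _ ⟨
            Q.ψ₂ (eᵇ (κ * x - α * x) +ᴹ eᶜ (B κ x - B α x)) ≈⟨ φ₂.cong (difference x) ⟨
            Q.ψ₂ (e x (κ * x) (B κ x) ⊝ e x (α * x) (B α x)) ≈⟨ drop₂ x ⟩
            Q.ψ₂ (e x (κ * x) (B κ x))         ≈⟨ S (B∈ κ x) ⟩
            t * Q.ψ₁ (e x (κ * x) (B κ x))     ≈⟨ *-congˡ (drop₁ x) ⟨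
            t * Q.ψ₁ (e x (κ * x) (B κ x) ⊝ e x (α * x) (B α x))  ≈⟨ *-congˡ (φ₁.cong (difference x)) ⟩
            t * Q.ψ₁ (eᵇ (κ * x - α * x) +ᴹ eᶜ (B κ x - B α x))   ≈⟨ *-congˡ (φ₁.+-homo _ _) ⟩
            t * (h′ (κ * x - α * x) + Q.ψ₁ (eᶜ (B κ x - B α x)))
              ≈⟨ *-congˡ (trans (+-congˡ (proj₁ Q.vertical (Eᶜ.inside _))) (+-identityʳ _)) ⟩
            t * h′ (κ * x - α * x)
              ≈⟨ *-congˡ (φ₁.cong (Eᵇ.cong (solve 3 (λ k m x → (k :- m) :* x := k :* x :- m :* x) refl κ α x))) ⟨
            t * h′ ((κ - α) * x)               ∎
          where
          open ≈-Reasoning setoid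
          Jα≢d : J α ≢ d
          Jα≢d eq = α≉1 (J-injective (≡.trans eq (≡.sym J-1)))
          projection : Projection (J α) b c
          projection = projections (J≢b α) (J≢c α) Jα≢d
          module Q where
            open Projection projection public
            open ProjectionProperties projection public
            horizontal′ : (∀ {x} → x ∈H b → ψ₂ x ≈ 0#) × (∀ s → ∃ λ x → x ∈H b × ψ₁ x ≈ s)
            horizontal′ = (λ x∈ → trans (proj₁ horizontal x∈) (zeroˡ _)) , proj₂ horizontal
          module φ₁ = IsForm Q.form₁
          module φ₂ = IsForm Q.form₂
          h h′ : Carrier → Carrier
          h s  = Q.ψ₂ (eᶜ s)
          h′ s = Q.ψ₁ (eᵇ s)
          h-bijective : IsBijectiveLinear h
          h-bijective = record
            { isLinear   = form∘lift Q.form₂ Eᶜ.isLift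
            ; kernel     = λ eq → Eᶜ.kernel (Q.vertical-injective (λ c≡J → J≢c α (≡.sym c≡J)) (Eᶜ.inside _) eq)
            ; surjective = λ s → let u , u∈ , ψ₂u≈s = proj₂ Q.vertical s
                                     z , u≈ = Eᶜ.onto u∈
                                 in z , trans (φ₂.cong (≈ᴹ-sym u≈)) ψ₂u≈s
            }
          difference : ∀ {κ} x → e x (κ * x) (B κ x) ⊝ e x (α * x) (B α x) ≈ᴹ
                                 eᵇ (κ * x - α * x) +ᴹ eᶜ (B κ x - B α x)
          difference x = ≈ᴹ-trans (e-⊝ _ _ _ _ _ _) (e-yzᵇᶜ (-‿inverseʳ x))
          drop₁ : ∀ {u} x → Q.ψ₁ (u ⊝ e x (α * x) (B α x)) ≈ Q.ψ₁ u
          drop₁ {u} x = trans (φ₁.⊝-homo _ _) (trans (+-congˡ (-‿cong (proj₁ (Q.vanishes (B∈ α x))))) (x-0≈x (Q.ψ₁ u)))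
          drop₂ : ∀ {u} x → Q.ψ₂ (u ⊝ e x (α * x) (B α x)) ≈ Q.ψ₂ u
          drop₂ {u} x = trans (φ₂.⊝-homo _ _) (trans (+-congˡ (-‿cong (proj₂ (Q.vanishes (B∈ α x))))) (x-0≈x (Q.ψ₂ u)))

      slopeFamily : IsSlopeFamily B g
      slopeFamily = record
        { B-cong      = B-cong
        ; B-0         = B-0
        ; B-1         = B-1
        ; B-separated = B-separated
        ; bijective   = g-bijective
        ; slope       = λ κ → let s , eq = g∘B₁ κ in s * s₁ ⁻¹ , λ x → trans (eq x)
            (trans (*-congˡ (trans (sym (x⁻¹*[x*y]≈y _ s₁≉0)) (*-congˡ (sym (g≈s₁*g₁ x))))) (sym (*-assoc _ _ _)))
        ; base        = base
        }

      open StableSlopes {n = n} {F = F} {K = K} n-prime 3≤q ι using (slopeFamily⇒stable)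

      -- By stability `σ κ` is the multiplier of some k, so `g` takes the same values at B κ x and k
      -- x.
      B-multiplication : 2 ≤ n → ∀ κ → ∃ λ μ → ∀ x → B κ x ≈ μ * x
      B-multiplication 2≤n κ = proj₁ found , λ x →
        IsBijectiveLinear.injective g-bijective (trans (IsSlopeFamily.g∘B slopeFamily κ x) (sym (proj₂ found x)))
        where
        found : ∃ λ k → ∀ x → g (k * x) ≈ IsSlopeFamily.σ slopeFamily κ * g x
        found = stabilises-all⇒multiplier-surjective g-bijective (slopeFamily⇒stable 2≤n slopeFamily B-separated⁻) _

-- From K-generators of the elements to an arc.

module Arcs {q n N} {F : FiniteField q c ℓ} {K : FiniteField (q ℕ.^ n) c′ ℓ′} (ι : Extension F K)
            {V : LeftModule (FiniteField.ring F) v ℓv} (H : Fin N → Subspace V p)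
            (disjoint : ∀ {k l m} → k ≢ l → k ≢ m → l ≢ m → Disjoint ⟨ H k , H l ⟩ (H m))
            (disjoint₂ : ∀ {k l} → k ≢ l → Disjoint (H k) (H l))
            (φ : restrictScalars ι (FiniteField.ring K ^ᵛ 3) ≅ V) where
  open FiniteFieldProperties K
  open VectorSpace {n = n} {F = F} {K = K} ι V
  open Projections {n = n} {F = F} {K = K} ι H disjoint
  open LeftModule (FiniteField.ring K ^ᵛ 3) using ()
    renaming (Carrierᴹ to K³; _≈ᴹ_ to _≋³_; _+ᴹ_ to _+³_; _*ₗ_ to _·³_)

  private
    to : K³ → Carrierᴹ
    to = _≅_.to φ

    to-cong³ : ∀ {u w} → u ≋³ w → to u ≈ᴹ to w
    to-cong³ {u} {w} = _≅_.⟦⟧-cong φ {u} {w}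

    to-kernel : ∀ {w} → to w ≈ᴹ 0ᴹ → ∀ i → w i ≈ 0#
    to-kernel {w} eq = _≅_.injective φ {w} {λ _ → 0#} (≈ᴹ-trans eq (≈ᴹ-sym (_≅_.0ᴹ-homo φ)))

  record Generator (k : Fin N) : Set (c′ ⊔ ℓ′ ⊔ v ⊔ ℓv ⊔ p) where
    field
      w       : K³
      nonzero : ∃ λ i → w i ≉ 0#
      sound   : ∀ α → to (α ·³ w) ∈H k
      onto    : ∀ {u} → u ∈H k → ∃ λ α → u ≈ᴹ to (α ·³ w)

    multiple-kernel : ∀ {α} → (∀ i → α * w i ≈ 0#) → α ≈ 0#
    multiple-kernel eq = x*y≈0⇒y≈0 (proj₂ nonzero) (trans (*-comm _ _) (eq (proj₁ nonzero)))

  module _ (generator : ∀ k → Generator k) where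
    private
      module G k = Generator (generator k)
      open G using (w)

    points : Fin N → Point (FiniteField.ring K ^ᵛ 3) (c′ ⊔ ℓ′)
    points k = PointOf.pointOf K (w k) (G.nonzero k)

    private
      -- A relation would put γ w m, a vector of `H m`, into ⟨H k, H l⟩.
      no-relation : ∀ {k l m α β γ} → k ≢ l → k ≢ m → l ≢ m →
                    (∀ i → (α * w k i + β * w l i) + γ * w m i ≈ 0#) → γ ≈ 0#
      no-relation {k} {l} {m} {α} {β} {γ} k≢l k≢m l≢m eq = G.multiple-kernel m (to-kernel
        (disjoint⇒0 k≢l k≢m l≢m (G.sound k (- α)) (G.sound l (- β)) (G.sound m γ)
          (≈ᴹ-trans (to-cong³ {γ ·³ w m} {((- α) ·³ w k) +³ ((- β) ·³ w l)} λ i → begin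
            γ * w m i
              ≈⟨ solve 6 (λ a x b y c z → c :* z := ((a :* x :+ b :* y) :+ c :* z) :+ ((:- a) :* x :+ (:- b) :* y))
                   refl α (w k i) β (w l i) γ (w m i) ⟩
            ((α * w k i + β * w l i) + γ * w m i) + (- α * w k i + - β * w l i)   ≈⟨ +-congʳ (eq i) ⟩
            0# + (- α * w k i + - β * w l i)                                      ≈⟨ +-identityˡ _ ⟩
            - α * w k i + - β * w l i                                             ∎)
          (_≅_.+ᴹ-homo φ ((- α) ·³ w k) ((- β) ·³ w l)))))
        where open ≈-Reasoning setoid

      -- In coordinates with respect to a basis of `L`, the minor of w k and w l vanishes, so these
      -- two vectors are proportional. `pairwise` then annihilates both coordinates of w l.
      no-collinear : ∀ {k l m} → k ≢ l → k ≢ m → l ≢ m → ¬ Collinear (points k) (points l) (points m)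
      no-collinear {k} {l} {m} k≢l k≢m l≢m (L , dim , k⊆L , l⊆L , m⊆L) = proj₂ (G.nonzero l) (begin
        w l (proj₁ (G.nonzero l))        ≈⟨ W l l⊆L _ ⟩
        P l l⊆L * b₀ (proj₁ (G.nonzero l)) + R l l⊆L * b₁ (proj₁ (G.nonzero l))
          ≈⟨ +-cong (trans (*-congʳ Pl≈0) (zeroˡ _)) (trans (*-congʳ Rl≈0) (zeroˡ _)) ⟩
        0# + 0#                          ≈⟨ +-identityʳ 0# ⟩
        0#                               ∎)
        where
        open ≈-Reasoning setoid
        module L = HasDimension dim
        b₀ b₁ : K³
        b₀ = L.basis 0F
        b₁ = L.basis 1F
        P R : ∀ j → (∀ {x} → Subspace.member (Point.subspace (points j)) x → Subspace.member L x) → Carrier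
        P j j⊆L = proj₁ (L.spanning (j⊆L {w j} (1# , λ _ → sym (*-identityˡ _)))) 0F
        R j j⊆L = proj₁ (L.spanning (j⊆L {w j} (1# , λ _ → sym (*-identityˡ _)))) 1F
        W : ∀ j (j⊆L : ∀ {x} → Subspace.member (Point.subspace (points j)) x → Subspace.member L x) →
            ∀ i → w j i ≈ P j j⊆L * b₀ i + R j j⊆L * b₁ i
        W j j⊆L i = trans (proj₂ (L.spanning (j⊆L {w j} (1# , λ _ → sym (*-identityˡ _)))) i) (+-congˡ (+-identityʳ _))
        det : Carrier → Carrier → Carrier → Carrier → Carrier
        det x y x′ y′ = x * y′ - y * x′
        -- Three vectors of a plane satisfy the relation whose coefficients are their
        -- 2 × 2 minors.
        minor≈0 : det (P k k⊆L) (R k k⊆L) (P l l⊆L) (R l l⊆L) ≈ 0#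
        minor≈0 = no-relation {α = det (P l l⊆L) (R l l⊆L) (P m m⊆L) (R m m⊆L)}
                              {β = det (P m m⊆L) (R m m⊆L) (P k k⊆L) (R k k⊆L)} k≢l k≢m l≢m λ i →
          trans (+-cong (+-cong (*-congˡ (W k k⊆L i)) (*-congˡ (W l l⊆L i))) (*-congˡ (W m m⊆L i)))
            (solve 8 (λ p r p′ r′ p″ r″ x y →
              ((p′ :* r″ :- r′ :* p″) :* (p :* x :+ r :* y) :+ (p″ :* r :- r″ :* p) :* (p′ :* x :+ r′ :* y))
                :+ (p :* r′ :- r :* p′) :* (p″ :* x :+ r″ :* y) := con (ℤ.+ 0)) refl
              (P k k⊆L) (R k k⊆L) (P l l⊆L) (R l l⊆L) (P m m⊆L) (R m m⊆L) (b₀ i) (b₁ i))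
        l≢k : l ≢ k
        l≢k eq = k≢l (≡.sym eq)
        m≢k : m ≢ k
        m≢k eq = k≢m (≡.sym eq)
        m≢l : m ≢ l
        m≢l eq = l≢m (≡.sym eq)
        -- `no-relation` speaks of three generators and of the last coefficient only: w m enters
        -- with coefficient 0, and w k is placed last.
        pairwise : ∀ {s t} → (∀ i → s * w k i ≈ t * w l i) → s ≈ 0#
        pairwise {s} {t} eq = no-relation {α = 0#} {β = - t} m≢l m≢k l≢k λ i →
          trans (+-congˡ (eq i)) (solve 3 (λ x t y → (con (ℤ.+ 0) :* x :+ (:- t) :* y) :+ t :* y := con (ℤ.+ 0))
            refl (w m i) t (w l i))
        Rl≈0 : R l l⊆L ≈ 0#
        Rl≈0 = pairwise {t = R k k⊆L} λ i → begin
          R l l⊆L * w k i                ≈⟨ *-congˡ (W k k⊆L i) ⟩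
          R l l⊆L * (P k k⊆L * b₀ i + R k k⊆L * b₁ i)
            ≈⟨ solve 6 (λ p r p′ r′ x y → r′ :* (p :* x :+ r :* y) :=
                 r :* (p′ :* x :+ r′ :* y) :+ (p :* r′ :- r :* p′) :* x) refl
                 (P k k⊆L) (R k k⊆L) (P l l⊆L) (R l l⊆L) (b₀ i) (b₁ i) ⟩
          R k k⊆L * (P l l⊆L * b₀ i + R l l⊆L * b₁ i) + det (P k k⊆L) (R k k⊆L) (P l l⊆L) (R l l⊆L) * b₀ i
            ≈⟨ +-cong (*-congˡ (sym (W l l⊆L i))) (trans (*-congʳ minor≈0) (zeroˡ _)) ⟩
          R k k⊆L * w l i + 0#           ≈⟨ +-identityʳ _ ⟩
          R k k⊆L * w l i                ∎
        Pl≈0 : P l l⊆L ≈ 0#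
        Pl≈0 = pairwise {t = P k k⊆L} λ i → begin
          P l l⊆L * w k i                ≈⟨ *-congˡ (W k k⊆L i) ⟩
          P l l⊆L * (P k k⊆L * b₀ i + R k k⊆L * b₁ i)
            ≈⟨ solve 6 (λ p r p′ r′ x y → p′ :* (p :* x :+ r :* y) :=
                 p :* (p′ :* x :+ r′ :* y) :- (p :* r′ :- r :* p′) :* y) refl
                 (P k k⊆L) (R k k⊆L) (P l l⊆L) (R l l⊆L) (b₀ i) (b₁ i) ⟩
          P k k⊆L * (P l l⊆L * b₀ i + R l l⊆L * b₁ i) - det (P k k⊆L) (R k k⊆L) (P l l⊆L) (R l l⊆L) * b₁ i
            ≈⟨ +-cong (*-congˡ (sym (W l l⊆L i))) (-‿cong (trans (*-congʳ minor≈0) (zeroˡ _))) ⟩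
          P k k⊆L * w l i - 0#           ≈⟨ x-0≈x (P k k⊆L * w l i) ⟩
          P k k⊆L * w l i                ∎

      1·w : ∀ k → w k ≋³ (1# ·³ w k)
      1·w k i = sym (*-identityˡ _)

      distinct : ∀ {k l} → k ≢ l → ¬ Subspace.member (Point.subspace (points k)) ≐ Subspace.member (Point.subspace (points l))
      distinct {k} {l} k≢l (k⊆l , _) = 0≉1 (sym (G.multiple-kernel k (to-kernel
        (disjoint₂ k≢l (G.sound k 1#) (∈-resp (to-cong³ {proj₁ w∈l ·³ w l} {1# ·³ w k}
          (λ i → trans (sym (proj₂ w∈l i)) (1·w k i))) (G.sound l (proj₁ w∈l)))))))
        where
        w∈l : ∃ λ α → ∀ i → w k i ≈ α * w l i
        w∈l = k⊆l {w k} (1# , 1·w k)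

      reduction : ∀ k → Subspace.member (H k) ≐ Subspace.member (fieldReduction ι φ (Point.subspace (points k)))
      reduction k =
        (λ {u} u∈ → let α , eq = G.onto k u∈ in α ·³ w k , (α , λ _ → refl) , eq) ,
        (λ {u} (x , (α , x≈) , u≈) → ∈-resp (≈ᴹ-sym (≈ᴹ-trans u≈ (to-cong³ {x} {α ·³ w k} x≈))) (G.sound k α))

    arc : IsArc points
    arc = record
      { distinct    = distinct
      ; noCollinear = no-collinear
      }

    elementary : H ≋ λ k → fieldReduction ι φ (Point.subspace (points k))
    elementary = (λ k → k , reduction k) , (λ k → k , reduction k)

-- The frame as an isomorphism with K³, and the generators in it.

module FrameGenerators {q n N} {F : FiniteField q c ℓ} {K : FiniteField (q ℕ.^ n) c′ ℓ′}
         (n-prime : Prime n) (3≤q : 3 ≤ q) (ι : Extension F K)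
         {V : LeftModule (FiniteField.ring F) v ℓv} (H : Fin N → Subspace V p)
         (disjoint : ∀ {k l m} → k ≢ l → k ≢ m → l ≢ m → Disjoint ⟨ H k , H l ⟩ (H m))
         (disjoint₂ : ∀ {k l} → k ≢ l → Disjoint (H k) (H l)) where
  open FiniteFieldProperties K
  open VectorSpace {n = n} {F = F} {K = K} ι V
  open Projections {n = n} {F = F} {K = K} ι H disjoint
  open Frames {n = n} {F = F} {K = K} ι H disjoint disjoint₂
  open FrameSlopes {n = n} {F = F} {K = K} n-prime 3≤q ι H disjoint disjoint₂
  open Arcs {n = n} {F = F} {K = K} ι H disjoint disjoint₂ using (Generator)

  triple : Carrier → Carrier → Carrier → Fin 3 → Carrier
  triple x y z 0F = x
  triple x y z 1F = y
  triple x y z 2F = z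

  module _ {a b c d} (a≢b : a ≢ b) (a≢c : a ≢ c) (b≢c : b ≢ c) (b≢d : b ≢ d) (c≢d : c ≢ d)
           (fr : Frame a b c d) where
    open Frame fr
    open FrameProperties a≢b a≢c b≢c b≢d c≢d fr
    private
      module Eᵃ = LiftOnto liftᵃ
      module Eᵇ = LiftOnto liftᵇ
      module Eᶜ = LiftOnto liftᶜ

      to : (Fin 3 → Carrier) → Carrierᴹ
      to w = e (w 0F) (w 1F) (w 2F)

      e-+ : ∀ x y z x′ y′ z′ → e (x + x′) (y + y′) (z + z′) ≈ᴹ e x y z +ᴹ e x′ y′ z′
      e-+ x y z x′ y′ z′ = ≈ᴹ-trans
        (+ᴹ-cong (≈ᴹ-trans (+ᴹ-cong (Eᵃ.+-homo x x′) (Eᵇ.+-homo y y′)) (interchange _ _ _ _)) (Eᶜ.+-homo z z′))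
        (interchange _ _ _ _)

      e-0 : e 0# 0# 0# ≈ᴹ 0ᴹ
      e-0 = ≈ᴹ-trans (e-zᶜ refl refl) (Eᶜ.0-homo refl)

      e-neg : ∀ x y z → e (- x) (- y) (- z) ≈ᴹ -ᴹ e x y z
      e-neg x y z = inverseʳ-uniqueᴹ _ _ (≈ᴹ-trans (≈ᴹ-sym (e-+ x y z (- x) (- y) (- z)))
        (≈ᴹ-trans (e-cong (-‿inverseʳ x) (-‿inverseʳ y) (-‿inverseʳ z)) e-0))

      e-· : ∀ t x y z → e (RingHomomorphism.⟦_⟧ ι t * x) (RingHomomorphism.⟦_⟧ ι t * y) (RingHomomorphism.⟦_⟧ ι t * z) ≈ᴹ t · e x y z
      e-· t x y z = ≈ᴹ-trans
        (+ᴹ-cong (≈ᴹ-trans (+ᴹ-cong (Eᵃ.*-homo t x) (Eᵇ.*-homo t y)) (≈ᴹ-sym (*ₗ-distribˡ t _ _))) (Eᶜ.*-homo t z))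
        (≈ᴹ-sym (*ₗ-distribˡ t _ _))

      e-kernel₃ : ∀ {x y z} → e x y z ≈ᴹ 0ᴹ → (x ≈ 0#) × (y ≈ 0#) × (z ≈ 0#)
      e-kernel₃ {x} {y} {z} eq = x≈0 , y≈0 , Eᶜ.kernel (≈ᴹ-trans (≈ᴹ-sym (e-zᶜ x≈0 y≈0)) eq)
        where
        x≈0 : x ≈ 0#
        x≈0 = e-kernel eq
        y≈0 : y ≈ 0#
        y≈0 = ᵇᶜ-kernel (≈ᴹ-trans (≈ᴹ-sym (e-yzᵇᶜ x≈0)) eq)

      to-injective : ∀ {u w} → to u ≈ᴹ to w → ∀ i → u i ≈ w i
      to-injective {u} {w} eq i = x-y≈0⇒x≈y (components i)
        where
        zeros : (u 0F - w 0F ≈ 0#) × (u 1F - w 1F ≈ 0#) × (u 2F - w 2F ≈ 0#)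
        zeros = e-kernel₃ (≈ᴹ-trans (≈ᴹ-sym (e-⊝ _ _ _ _ _ _)) (x≈y⇒x-y≈ᴹ0 eq))
        components : ∀ i → u i - w i ≈ 0#
        components 0F = proj₁ zeros
        components 1F = proj₁ (proj₂ zeros)
        components 2F = proj₂ (proj₂ zeros)

    coordinates : restrictScalars ι (FiniteField.ring K ^ᵛ 3) ≅ V
    coordinates = record
      { to            = to
      ; isIsomorphism = record
        { isLeftModuleMonomorphism = record
          { isLeftModuleHomomorphism = record
            { +ᴹ-isGroupHomomorphism = record
              { isMonoidHomomorphism = record
                { isMagmaHomomorphism = record
                  { isRelHomomorphism = record { cong = λ eq → e-cong (eq 0F) (eq 1F) (eq 2F) }
                  ; homo              = λ u w → e-+ _ _ _ _ _ _
                  }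
                ; ε-homo = e-0
                }
              ; ⁻¹-homo = λ u → e-neg _ _ _
              }
            ; *ₗ-homo = λ t u → e-· t _ _ _
            }
          ; injective = to-injective
          }
        ; surjective = λ u → let x , y , z , u≈ = decompose u in
            triple x y z , λ eq → ≈ᴹ-trans (e-cong (eq 0F) (eq 1F) (eq 2F)) (≈ᴹ-sym u≈)
        }
      }

    module _ (B-mult : ∀ κ → ∃ λ μ → ∀ x → B κ x ≈ μ * x) where
      private
        generatorᵇ : Generator coordinates b
        generatorᵇ = record
          { w       = triple 0# 1# 0#
          ; nonzero = 1F , 1≉0
          ; sound   = λ α → ∈-resp (≈ᴹ-sym (e-yᵇ (zeroʳ α) (zeroʳ α))) (Eᵇ.inside _)
          ; onto    = λ u∈ → let s , u≈ = Eᵇ.onto u∈ in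
              s , ≈ᴹ-trans u≈ (≈ᴹ-sym (≈ᴹ-trans (e-yᵇ (zeroʳ s) (zeroʳ s)) (Eᵇ.cong (*-identityʳ s))))
          }

        generatorᶜ : Generator coordinates c
        generatorᶜ = record
          { w       = triple 0# 0# 1#
          ; nonzero = 2F , 1≉0
          ; sound   = λ α → ∈-resp (≈ᴹ-sym (e-zᶜ (zeroʳ α) (zeroʳ α))) (Eᶜ.inside _)
          ; onto    = λ u∈ → let s , u≈ = Eᶜ.onto u∈ in
              s , ≈ᴹ-trans u≈ (≈ᴹ-sym (≈ᴹ-trans (e-zᶜ (zeroʳ s) (zeroʳ s)) (Eᶜ.cong (*-identityʳ s))))
          }

        module _ {j} (j≢b : j ≢ b) (j≢c : j ≢ c) where
          κ : Carrier
          κ = proj₁ (graphOf j≢b j≢c)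

          graph : OnGraph j κ
          graph = proj₂ (graphOf j≢b j≢c)

          μ : Carrier
          μ = proj₁ (B-mult κ)

          -- Both elements contain a vector whose first two coordinates are 1 and κ.
          J≡j : J κ ≡ j
          J≡j = e∈-j-unique (J≢c κ) j≢c refl (B∈ κ 1#) (proj₂ (proj₁ graph 1#))

          generatorʲ : Generator coordinates j
          generatorʲ = record
            { w       = triple 1# κ μ
            ; nonzero = 0F , 1≉0
            ; sound   = λ α → ≡.subst (to (λ i → α * triple 1# κ μ i) ∈H_) J≡j
                (∈-resp (e-cong (sym (*-identityʳ α)) (*-comm κ α) (trans (proj₂ (B-mult κ) α) (*-comm μ α))) (B∈ κ α))
            ; onto    = λ u∈ → let x , z , u≈ = proj₂ graph u∈ in
                x , ≈ᴹ-trans u≈ (e-cong (sym (*-identityʳ x)) (*-comm κ x)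
                  (trans (sym (B-unique J≡j refl (∈-resp u≈ u∈))) (trans (proj₂ (B-mult κ) x) (*-comm μ x))))
            }

      generators : ∀ j → Generator coordinates j
      generators j with j Fin.≟ b | j Fin.≟ c
      ... | yes ≡.refl | _          = generatorᵇ
      ... | no  _      | yes ≡.refl = generatorᶜ
      ... | no  j≢b    | no  j≢c    = generatorʲ j≢b j≢c

-- The choice of a, b, c, d and the conclusion.

almostFull : ∀ {N m} → N ≡ suc m → (T : Subset N) → m ≤ ∣ T ∣ → ∃ λ d → ∀ {k} → k ≢ d → k ∈ T
-- All m members lie in the tail, which is therefore full.
almostFull {m = m} ≡.refl (Subset.outside ∷ T) m≤ = zero , λ
  { {zero}  0≢0 → contradiction ≡.refl 0≢0
  ; {suc k} _   → there (≡.subst (k ∈_) (≡.sym (∣p∣≡n⇒p≡⊤ (ℕ.≤-antisym (∣p∣≤n T) m≤))) ∈⊤)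
  }
-- Nothing is missing here, so `d` is a member of `T` chosen as a placeholder.
almostFull {m = zero}  ≡.refl (Subset.inside ∷ []) _ = zero , λ { {zero} 0≢0 → contradiction ≡.refl 0≢0 }
almostFull {m = suc m} ≡.refl (Subset.inside ∷ T) (s≤s m≤) with d , full ← almostFull ≡.refl T m≤ = suc d , λ
  { {zero}  _     → here
  ; {suc k} k≢d → there (full λ k≡d → k≢d (≡.cong suc k≡d))
  }

threeOthers : ∀ {N} → 4 ≤ N → (d : Fin N) → ∃ λ a → ∃ λ b → ∃ λ c →
              (a ≢ d × b ≢ d × c ≢ d) × (a ≢ b × a ≢ c × b ≢ c)
threeOthers (s≤s (s≤s (s≤s (s≤s _)))) d = punchIn d 0F , punchIn d 1F , punchIn d 2F ,
  (Fin.punchInᵢ≢i d _ , Fin.punchInᵢ≢i d _ , Fin.punchInᵢ≢i d _) ,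
  ((λ eq → contradiction (Fin.punchIn-injective d _ _ eq) λ ()) ,
   (λ eq → contradiction (Fin.punchIn-injective d _ _ eq) λ ()) ,
   (λ eq → contradiction (Fin.punchIn-injective d _ _ eq) λ ()))

anotherIndex : ∀ {N} → 4 ≤ N → (k l : Fin N) → ∃ λ m → m ≢ k × m ≢ l
anotherIndex 4≤N k l with a , b , _ , (a≢k , b≢k , _) , (a≢b , _) ← threeOthers 4≤N k with a Fin.≟ l
... | yes a≡l = b , b≢k , λ b≡l → a≢b (≡.trans a≡l (≡.sym b≡l))
... | no  a≢l = a , a≢k , a≢l

≢-sym : ∀ {N} {k l : Fin N} → k ≢ l → l ≢ k
≢-sym k≢l l≡k = k≢l (≡.sym l≡k)

module _ {q n N} {F : FiniteField q c ℓ} {K : FiniteField (q ℕ.^ n) c′ ℓ′}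
         (n-prime : Prime n) (3≤q : 3 ≤ q) (2≤n : 2 ≤ n) (4≤N : 4 ≤ N) (ι : Extension F K)
         {V : LeftModule (FiniteField.ring F) v ℓv} (H : Fin N → Subspace V p)
         (disjoint : ∀ {k l m} → k ≢ l → k ≢ m → l ≢ m → Disjoint ⟨ H k , H l ⟩ (H m)) where

  -- Some third element contributes the summand 0 to a span, which reduces the claim to `disjoint`.
  pairwiseDisjoint : ∀ {k l} → k ≢ l → Disjoint (H k) (H l)
  pairwiseDisjoint {k} {l} k≢l {x} x∈k x∈l = let m , m≢k , m≢l = anotherIndex 4≤N k l in
    disjoint (≢-sym m≢k) k≢l m≢l
      (x , LeftModule.0ᴹ V , x∈k , Subspace.0ᴹ-closed (H m) , LeftModule.≈ᴹ-sym V (LeftModule.+ᴹ-identityʳ V x)) x∈l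

  open Projections {n = n} {F = F} {K = K} ι H disjoint
  open Frames {n = n} {F = F} {K = K} ι H disjoint pairwiseDisjoint
  open FrameSlopes {n = n} {F = F} {K = K} n-prime 3≤q ι H disjoint pairwiseDisjoint
  open FrameGenerators {n = n} {F = F} {K = K} n-prime 3≤q ι H disjoint pairwiseDisjoint
  open Arcs {n = n} {F = F} {K = K} ι H disjoint pairwiseDisjoint

  fieldReductionOfArc : (d : Fin N) → (∀ {k} → k ≢ d → Chart k) →
    Σ (restrictScalars ι (FiniteField.ring K ^ᵛ 3) ≅ V) λ φ →
    Σ (Fin N → Point (FiniteField.ring K ^ᵛ 3) (c′ ⊔ ℓ′)) λ A →
    IsArc A × H ≋ λ k → fieldReduction ι φ (Point.subspace (A k))
  fieldReductionOfArc d charts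
    with a , b , c , (a≢d , b≢d , c≢d) , (a≢b , a≢c , b≢c) ← threeOthers 4≤N d
    = coordinates a≢b a≢c b≢c b≢d c≢d fr , points _ gens , arc _ gens , elementary _ gens
    where
    project : ∀ {k l m} → k ≢ d → l ≢ k → m ≢ k → l ≢ m → Projection k l m
    project k≢d l≢k m≢k l≢m = ChartProjection.projection (charts k≢d) l≢k m≢k l≢m
    fr : Frame a b c d
    fr = frame a≢b a≢c a≢d b≢c b≢d c≢d (project c≢d a≢c b≢c a≢b) (project a≢d (≢-sym a≢b) (≢-sym a≢d) b≢d)
    open FrameProperties a≢b a≢c b≢c b≢d c≢d fr
    open Slopes (project b≢d a≢b (≢-sym b≢c) a≢c) (λ j≢b j≢c j≢d → project j≢d (≢-sym j≢b) (≢-sym j≢c) b≢c)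
    gens : ∀ j → Generator (coordinates a≢b a≢c b≢c b≢d c≢d fr) j
    gens = generators a≢b a≢c b≢c b≢d c≢d fr (B-multiplication 2≤n)

open import Data.Nat.Base using (_+_; _^_; _<_)

corollary1p3 : ∀ {c ℓ c′ ℓ′ p : Level} (h n : ℕ) → 1 < h → Prime n →
    (F : FiniteField (2 ^ h) c ℓ) (K : FiniteField ((2 ^ h) ^ n) c′ ℓ′)
    (ι : Extension F K) (H : PseudoHyperoval F n p) →
    AtLeast ((2 ^ h) ^ n + 1) (InducesDesarguesianSpread K ι H) →
    IsElementary K ι H
corollary1p3 h n 1<h n-prime F K ι H (T , T-large , desarguesian) = φ , _ , A , arc , H≋A
  where
  open PseudoHyperoval H
  2≤n : 2 ≤ n
  2≤n = ℕ.nonTrivial⇒n>1 n {{prime⇒nonTrivial n-prime}}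
  4≤q : 4 ≤ 2 ^ h
  4≤q = ℕ.^-monoʳ-≤ 2 1<h
  4≤N : 4 ≤ (2 ^ h) ^ n + 2
  4≤N = ℕ.+-monoˡ-≤ 2 (ℕ.≤-trans 2≤n (ℕ.<⇒≤ (n<m^n n (ℕ.≤-trans (s≤s (s≤s z≤n)) 4≤q))))
  exception : ∃ λ d → ∀ {k} → k ≢ d → k ∈ T
  -- Since q^n + 2 is the successor of q^n + 1, the set `T` misses at most one element.
  exception = almostFull (ℕ.+-suc _ 1) T T-large
  disjoint = IsPseudoArc.disjoint isPseudoArc
  result = fieldReductionOfArc {n = n} {F = F} {K = K} n-prime (ℕ.≤-trans (ℕ.n≤1+n 3) 4≤q) 2≤n 4≤N ι element disjoint
    (proj₁ exception) λ k≢d →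
      let φ , spread = desarguesian (proj₂ exception k≢d) in
      Projections.FromSpread.chart {n = n} {F = F} {K = K} ι element disjoint φ spread
  φ = proj₁ result
  A = proj₁ (proj₂ result)
  arc = proj₁ (proj₂ (proj₂ result))
  H≋A = proj₂ (proj₂ (proj₂ result))
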